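{- As $X\to\infty$, $$\#\Omega_1(X)=\frac{1}{4\zeta(2)}X^4+O(X^3\log X),$$ and in particular $\#\Omega_1(X)\sim\frac{1}{4\zeta(2)}X^4$.
   Context: For coprime positive integers $p,q$, $\Delta_{p,q}(t)=\frac{(t^{pq}-1)(t-1)}{(t^p-1)(t^q-1)}$ is the Alexander polynomial of the torus knot $T_{p,q}$. For $X>0$, $\Omega_1(X)$ is the set of all pairs $(T_{p,q},\alpha)$, where $(p,q)$ is an ordered pair of coprime positive integers with $\max\{p,q\}\le X$ (identified with $T_{p,q}$) and $\alpha\in\mathbb{C}$ is a root of $\Delta_{p,q}(t)$. $\zeta(2)=\pi^2/6$; $f(X)\sim h(X)$ means $f(X)/h(X)\to1$; $f(X)=g(X)+O(h(X))$ has its usual meaning: $|f(X)-g(X)|\le C\,h(X)$ for some constant $C$ and all sufficiently large $X$. -}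

module Defs where

open import Data.Fin.Base using (Fin)
open import Data.Integer.Base as ℤ using (ℤ)
import Data.Integer.Properties as ℤₚ
open import Data.List.Base using (List; []; _∷_; map; replicate; _++_)
open import Data.Nat.Base as ℕ using (ℕ; zero; suc; z≤n; s≤s; _!)
open import Data.Nat.Coprimality using (Coprime)
import Data.Nat.Properties as ℕₚ
import Data.Nat.Solver as ℕ-Solver
open import Data.Product.Base using (∃; ∃-syntax; Σ-syntax; _×_; _,_; proj₁; proj₂)
open import Data.Rational.Base as ℚ using (ℚ; 0ℚ; 1ℚ; ½)
import Data.Rational.Properties as ℚₚ
import Data.Rational.Solver as ℚ-Solver
import Data.Rational.Unnormalised.Base as ℚᵘ
import Data.Rational.Unnormalised.Properties as ℚᵘₚ
open import Data.Sum.Base using (inj₁; inj₂)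
open import Function.Bundles using (Bijection)
open import Level using (0ℓ)
open import Relation.Binary.Bundles using (Setoid)
open import Relation.Binary.PropositionalEquality as ≡
  using (_≡_; refl; sym; trans; cong; cong₂; subst)
open import Relation.Nullary using (yes; no; contradiction)

private
  module ℚ-Lemmas where
    open ℚ-Solver.+-*-Solver
    open ℚₚ.≤-Reasoning

    ½-pos : ∀ {ε} → 0ℚ ℚ.< ε → 0ℚ ℚ.< ε ℚ.* ½
    ½-pos {ε} 0<ε = ℚₚ.positive⁻¹ (ε ℚ.* ½)
      {{ℚₚ.pos*pos⇒pos ε {{ℚ.positive 0<ε}} ½}}

    ½+½ : ∀ ε → ε ℚ.* ½ ℚ.+ ε ℚ.* ½ ≡ ε
    ½+½ ε = trans (sym (ℚₚ.*-distribˡ-+ ε ½ ½)) (ℚₚ.*-identityʳ ε)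

    0<1 : 0ℚ ℚ.< 1ℚ
    0<1 = ℚₚ.positive⁻¹ 1ℚ

    ∣x-x∣ : ∀ x → ℚ.∣ x ℚ.- x ∣ ≡ 0ℚ
    ∣x-x∣ x = cong ℚ.∣_∣ (ℚₚ.+-inverseʳ x)

    ∣-∣-sym : ∀ x y → ℚ.∣ x ℚ.- y ∣ ≡ ℚ.∣ y ℚ.- x ∣
    ∣-∣-sym x y = trans
      (cong ℚ.∣_∣ (solve 2 (λ x y → x :- y := :- (y :- x)) refl x y))
      (ℚₚ.∣-p∣≡∣p∣ (y ℚ.- x))

    triangle : ∀ x y z → ℚ.∣ x ℚ.- z ∣ ℚ.≤ ℚ.∣ x ℚ.- y ∣ ℚ.+ ℚ.∣ y ℚ.- z ∣
    triangle x y z = begin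
      ℚ.∣ x ℚ.- z ∣
        ≡⟨ cong ℚ.∣_∣ (solve 3 (λ x y z → x :- z := (x :- y) :+ (y :- z)) refl x y z) ⟩
      ℚ.∣ (x ℚ.- y) ℚ.+ (y ℚ.- z) ∣
        ≤⟨ ℚₚ.∣p+q∣≤∣p∣+∣q∣ (x ℚ.- y) (y ℚ.- z) ⟩
      ℚ.∣ x ℚ.- y ∣ ℚ.+ ℚ.∣ y ℚ.- z ∣ ∎

    p≤∣p∣ : ∀ p → p ℚ.≤ ℚ.∣ p ∣
    p≤∣p∣ p with ℚₚ.≤-total 0ℚ p
    ... | inj₁ 0≤p = ℚₚ.≤-reflexive (sym (ℚₚ.0≤p⇒∣p∣≡p 0≤p))
    ... | inj₂ p≤0 = ℚₚ.≤-trans p≤0 (ℚₚ.0≤∣p∣ p)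

    ∣x∣≤∣y∣+∣x-y∣ : ∀ x y → ℚ.∣ x ∣ ℚ.≤ ℚ.∣ y ∣ ℚ.+ ℚ.∣ x ℚ.- y ∣
    ∣x∣≤∣y∣+∣x-y∣ x y = begin
      ℚ.∣ x ∣
        ≡⟨ cong ℚ.∣_∣ (solve 2 (λ x y → x := y :+ (x :- y)) refl x y) ⟩
      ℚ.∣ y ℚ.+ (x ℚ.- y) ∣
        ≤⟨ ℚₚ.∣p+q∣≤∣p∣+∣q∣ y (x ℚ.- y) ⟩
      ℚ.∣ y ∣ ℚ.+ ℚ.∣ x ℚ.- y ∣ ∎

    ∣∣x∣-∣y∣∣≤∣x-y∣ : ∀ x y → ℚ.∣ ℚ.∣ x ∣ ℚ.- ℚ.∣ y ∣ ∣ ℚ.≤ ℚ.∣ x ℚ.- y ∣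
    ∣∣x∣-∣y∣∣≤∣x-y∣ x y with ℚₚ.∣p∣≡p∨∣p∣≡-p (ℚ.∣ x ∣ ℚ.- ℚ.∣ y ∣)
    ... | inj₁ eq = begin
      ℚ.∣ ℚ.∣ x ∣ ℚ.- ℚ.∣ y ∣ ∣           ≡⟨ eq ⟩
      ℚ.∣ x ∣ ℚ.- ℚ.∣ y ∣                ≤⟨ ℚₚ.+-monoˡ-≤ (ℚ.- ℚ.∣ y ∣) (∣x∣≤∣y∣+∣x-y∣ x y) ⟩
      (ℚ.∣ y ∣ ℚ.+ ℚ.∣ x ℚ.- y ∣) ℚ.- ℚ.∣ y ∣
        ≡⟨ solve 2 (λ a b → (a :+ b) :- a := b) refl ℚ.∣ y ∣ ℚ.∣ x ℚ.- y ∣ ⟩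
      ℚ.∣ x ℚ.- y ∣ ∎
    ... | inj₂ eq = begin
      ℚ.∣ ℚ.∣ x ∣ ℚ.- ℚ.∣ y ∣ ∣           ≡⟨ eq ⟩
      ℚ.- (ℚ.∣ x ∣ ℚ.- ℚ.∣ y ∣)
        ≡⟨ solve 2 (λ a b → :- (a :- b) := b :- a) refl ℚ.∣ x ∣ ℚ.∣ y ∣ ⟩
      ℚ.∣ y ∣ ℚ.- ℚ.∣ x ∣                ≤⟨ ℚₚ.+-monoˡ-≤ (ℚ.- ℚ.∣ x ∣) (∣x∣≤∣y∣+∣x-y∣ y x) ⟩
      (ℚ.∣ x ∣ ℚ.+ ℚ.∣ y ℚ.- x ∣) ℚ.- ℚ.∣ x ∣
        ≡⟨ solve 2 (λ a b → (a :+ b) :- a := b) refl ℚ.∣ x ∣ ℚ.∣ y ℚ.- x ∣ ⟩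
      ℚ.∣ y ℚ.- x ∣                     ≡⟨ ∣-∣-sym y x ⟩
      ℚ.∣ x ℚ.- y ∣ ∎

    +-dist : ∀ a b c d →
      ℚ.∣ (a ℚ.+ b) ℚ.- (c ℚ.+ d) ∣ ℚ.≤ ℚ.∣ a ℚ.- c ∣ ℚ.+ ℚ.∣ b ℚ.- d ∣
    +-dist a b c d = begin
      ℚ.∣ (a ℚ.+ b) ℚ.- (c ℚ.+ d) ∣
        ≡⟨ cong ℚ.∣_∣ (solve 4 (λ a b c d →
             (a :+ b) :- (c :+ d) := (a :- c) :+ (b :- d)) refl a b c d) ⟩
      ℚ.∣ (a ℚ.- c) ℚ.+ (b ℚ.- d) ∣
        ≤⟨ ℚₚ.∣p+q∣≤∣p∣+∣q∣ (a ℚ.- c) (b ℚ.- d) ⟩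
      ℚ.∣ a ℚ.- c ∣ ℚ.+ ℚ.∣ b ℚ.- d ∣ ∎

    neg-dist : ∀ a b → ℚ.∣ (ℚ.- a) ℚ.- (ℚ.- b) ∣ ≡ ℚ.∣ a ℚ.- b ∣
    neg-dist a b = trans
      (cong ℚ.∣_∣ (solve 2 (λ a b → (:- a) :- (:- b) := b :- a) refl a b))
      (∣-∣-sym b a)

    *-mono-∣∣ : ∀ {a b B} c → ℚ.∣ a ∣ ℚ.≤ B → ℚ.∣ b ∣ ℚ.≤ c →
      ℚ.∣ a ∣ ℚ.* ℚ.∣ b ∣ ℚ.≤ B ℚ.* c
    *-mono-∣∣ {a} {b} {B} c a≤B b≤c = begin
      ℚ.∣ a ∣ ℚ.* ℚ.∣ b ∣
        ≤⟨ ℚₚ.*-monoʳ-≤-nonNeg ℚ.∣ b ∣ {{ℚₚ.∣-∣-nonNeg b}} a≤B ⟩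
      B ℚ.* ℚ.∣ b ∣
        ≤⟨ ℚₚ.*-monoˡ-≤-nonNeg B {{ℚ.nonNegative (ℚₚ.≤-trans (ℚₚ.0≤∣p∣ a) a≤B)}} b≤c ⟩
      B ℚ.* c ∎

    *-dist : ∀ {B} a b c d → ℚ.∣ a ∣ ℚ.≤ B → ℚ.∣ d ∣ ℚ.≤ B →
      ℚ.∣ a ℚ.* b ℚ.- c ℚ.* d ∣ ℚ.≤ B ℚ.* (ℚ.∣ a ℚ.- c ∣ ℚ.+ ℚ.∣ b ℚ.- d ∣)
    *-dist {B} a b c d a≤B d≤B = begin
      ℚ.∣ a ℚ.* b ℚ.- c ℚ.* d ∣
        ≡⟨ cong ℚ.∣_∣ (solve 4 (λ a b c d →
             a :* b :- c :* d := d :* (a :- c) :+ a :* (b :- d)) refl a b c d) ⟩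
      ℚ.∣ d ℚ.* (a ℚ.- c) ℚ.+ a ℚ.* (b ℚ.- d) ∣
        ≤⟨ ℚₚ.∣p+q∣≤∣p∣+∣q∣ (d ℚ.* (a ℚ.- c)) (a ℚ.* (b ℚ.- d)) ⟩
      ℚ.∣ d ℚ.* (a ℚ.- c) ∣ ℚ.+ ℚ.∣ a ℚ.* (b ℚ.- d) ∣
        ≡⟨ cong₂ ℚ._+_ (ℚₚ.∣p*q∣≡∣p∣*∣q∣ d (a ℚ.- c)) (ℚₚ.∣p*q∣≡∣p∣*∣q∣ a (b ℚ.- d)) ⟩
      ℚ.∣ d ∣ ℚ.* ℚ.∣ a ℚ.- c ∣ ℚ.+ ℚ.∣ a ∣ ℚ.* ℚ.∣ b ℚ.- d ∣
        ≤⟨ ℚₚ.+-mono-≤ (*-mono-∣∣ {d} {a ℚ.- c} ℚ.∣ a ℚ.- c ∣ d≤B ℚₚ.≤-refl)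
                       (*-mono-∣∣ {a} {b ℚ.- d} ℚ.∣ b ℚ.- d ∣ a≤B ℚₚ.≤-refl) ⟩
      B ℚ.* ℚ.∣ a ℚ.- c ∣ ℚ.+ B ℚ.* ℚ.∣ b ℚ.- d ∣
        ≡⟨ sym (ℚₚ.*-distribˡ-+ B ℚ.∣ a ℚ.- c ∣ ℚ.∣ b ℚ.- d ∣) ⟩
      B ℚ.* (ℚ.∣ a ℚ.- c ∣ ℚ.+ ℚ.∣ b ℚ.- d ∣) ∎

    p≤p+q : ∀ p q → 0ℚ ℚ.< q → p ℚ.≤ p ℚ.+ q
    p≤p+q p q 0<q = begin
      p            ≡⟨ sym (ℚₚ.+-identityʳ p) ⟩
      p ℚ.+ 0ℚ     ≤⟨ ℚₚ.+-monoʳ-≤ p (ℚₚ.<⇒≤ 0<q) ⟩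
      p ℚ.+ q      ∎

    quotient-pos : ∀ {ε B} → 0ℚ ℚ.< ε → 0ℚ ℚ.< B →
      ∃[ η ] 0ℚ ℚ.< η × B ℚ.* η ≡ ε
    quotient-pos {ε} {B} 0<ε 0<B =
      ε ℚ.* ℚ.1/ B ,
      ℚₚ.positive⁻¹ (ε ℚ.* ℚ.1/ B) {{ℚₚ.pos*pos⇒pos ε (ℚ.1/ B) {{ℚₚ.1/pos⇒pos B}}}} ,
      (begin-equality
        B ℚ.* (ε ℚ.* ℚ.1/ B)
          ≡⟨ solve 3 (λ b e i → b :* (e :* i) := e :* (b :* i)) refl B ε (ℚ.1/ B) ⟩
        ε ℚ.* (B ℚ.* ℚ.1/ B)   ≡⟨ cong (ε ℚ.*_) (ℚₚ.*-inverseʳ B) ⟩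
        ε ℚ.* 1ℚ               ≡⟨ ℚₚ.*-identityʳ ε ⟩
        ε ∎)
      where instance
        _ = ℚ.positive 0<ε
        _ = ℚ.positive 0<B
        _ = ℚₚ.pos⇒nonZero B {{ℚ.positive 0<B}}

open ℚ-Lemmas

-- Cauchy sequences of rationals. Equality of reals is _≈_, not _≡_.
record ℝ : Set where
  constructor mkℝ
  field
    seq    : ℕ → ℚ
    cauchy : ∀ ε → 0ℚ ℚ.< ε →
             ∃[ N ] ∀ m n → N ℕ.≤ m → N ℕ.≤ n → ℚ.∣ seq m ℚ.- seq n ∣ ℚ.< ε

open ℝ public

infix 4 _≈_ _≤_ _<_ _#0

_≈_ : ℝ → ℝ → Set
x ≈ y = ∀ ε → 0ℚ ℚ.< ε → ∃[ N ] ∀ n → N ℕ.≤ n → ℚ.∣ seq x n ℚ.- seq y n ∣ ℚ.< ε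

_≤_ : ℝ → ℝ → Set
x ≤ y = ∀ ε → 0ℚ ℚ.< ε → ∃[ N ] ∀ n → N ℕ.≤ n → seq x n ℚ.< seq y n ℚ.+ ε

_<_ : ℝ → ℝ → Set
x < y = ∃[ ε ] 0ℚ ℚ.< ε × ∃[ N ] ∀ n → N ℕ.≤ n → seq x n ℚ.+ ε ℚ.≤ seq y n

-- Apartness from zero, the constructive condition for invertibility.
_#0 : ℝ → Set
x #0 = ∃[ ε ] 0ℚ ℚ.< ε × ∃[ N ] ∀ n → N ℕ.≤ n → ε ℚ.≤ ℚ.∣ seq x n ∣

≈-refl : ∀ {x} → x ≈ x
≈-refl {x} ε 0<ε = 0 , λ n _ → subst (ℚ._< ε) (sym (∣x-x∣ (seq x n))) 0<ε

≈-sym : ∀ {x y} → x ≈ y → y ≈ x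
≈-sym {x} {y} x≈y ε 0<ε with x≈y ε 0<ε
... | N , h = N , λ n N≤n → subst (ℚ._< ε) (∣-∣-sym (seq x n) (seq y n)) (h n N≤n)

≈-trans : ∀ {x y z} → x ≈ y → y ≈ z → x ≈ z
≈-trans {x} {y} {z} x≈y y≈z ε 0<ε
  with x≈y (ε ℚ.* ½) (½-pos 0<ε) | y≈z (ε ℚ.* ½) (½-pos 0<ε)
... | M , f | N , g = M ℕ.⊔ N , λ n M⊔N≤n →
  subst (ℚ.∣ seq x n ℚ.- seq z n ∣ ℚ.<_) (½+½ ε)
    (ℚₚ.≤-<-trans (triangle (seq x n) (seq y n) (seq z n))
      (ℚₚ.+-mono-< (f n (ℕₚ.m⊔n≤o⇒m≤o M N M⊔N≤n)) (g n (ℕₚ.m⊔n≤o⇒n≤o M N M⊔N≤n))))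

fromℚ : ℚ → ℝ
fromℚ q = mkℝ (λ _ → q) λ ε 0<ε → 0 , λ _ _ _ _ → subst (ℚ._< ε) (sym (∣x-x∣ q)) 0<ε

fromℤ : ℤ → ℝ
fromℤ i = fromℚ (i ℚ./ 1)

fromℕ : ℕ → ℝ
fromℕ n = fromℤ (ℤ.+ n)

0ℝ 1ℝ : ℝ
0ℝ = fromℕ 0
1ℝ = fromℕ 1

infixr 9 _^_
infix  8 -_
infixl 7 _*_
infixl 6 _+_ _-_

private
  bounded : ∀ x → ∃[ B ] 0ℚ ℚ.< B × ∃[ N ] ∀ n → N ℕ.≤ n → ℚ.∣ seq x n ∣ ℚ.≤ B
  bounded x with cauchy x 1ℚ 0<1
  ... | N , h =
    ℚ.∣ seq x N ∣ ℚ.+ 1ℚ ,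
    ℚₚ.+-mono-≤-< (ℚₚ.0≤∣p∣ (seq x N)) 0<1 ,
    N , λ n N≤n → ℚₚ.≤-trans (∣x∣≤∣y∣+∣x-y∣ (seq x n) (seq x N))
      (ℚₚ.+-monoʳ-≤ ℚ.∣ seq x N ∣ (ℚₚ.<⇒≤ (h n N N≤n ℕₚ.≤-refl)))

  IsCauchy : (ℕ → ℚ) → Set
  IsCauchy s = ∀ ε → 0ℚ ℚ.< ε →
    ∃[ N ] ∀ m n → N ℕ.≤ m → N ℕ.≤ n → ℚ.∣ s m ℚ.- s n ∣ ℚ.< ε

  +-cauchy : ∀ x y → IsCauchy (λ n → seq x n ℚ.+ seq y n)
  +-cauchy x y ε 0<ε with cauchy x (ε ℚ.* ½) (½-pos 0<ε) | cauchy y (ε ℚ.* ½) (½-pos 0<ε)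
  ... | M , f | N , g = M ℕ.⊔ N , λ m n K≤m K≤n →
    subst (ℚ.∣ _ ∣ ℚ.<_) (½+½ ε)
      (ℚₚ.≤-<-trans (+-dist (seq x m) (seq y m) (seq x n) (seq y n))
        (ℚₚ.+-mono-<
          (f m n (ℕₚ.m⊔n≤o⇒m≤o M N K≤m) (ℕₚ.m⊔n≤o⇒m≤o M N K≤n))
          (g m n (ℕₚ.m⊔n≤o⇒n≤o M N K≤m) (ℕₚ.m⊔n≤o⇒n≤o M N K≤n))))

  neg-cauchy : ∀ x → IsCauchy (λ n → ℚ.- seq x n)
  neg-cauchy x ε 0<ε with cauchy x ε 0<ε
  ... | N , f = N , λ m n N≤m N≤n →
    subst (ℚ._< ε) (sym (neg-dist (seq x m) (seq x n))) (f m n N≤m N≤n)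

  abs-cauchy : ∀ x → IsCauchy (λ n → ℚ.∣ seq x n ∣)
  abs-cauchy x ε 0<ε with cauchy x ε 0<ε
  ... | N , f = N , λ m n N≤m N≤n →
    ℚₚ.≤-<-trans (∣∣x∣-∣y∣∣≤∣x-y∣ (seq x m) (seq x n)) (f m n N≤m N≤n)

  *-close : ∀ {ε η B} a b c d → 0ℚ ℚ.< B → B ℚ.* η ≡ ε →
    ℚ.∣ a ∣ ℚ.≤ B → ℚ.∣ d ∣ ℚ.≤ B →
    ℚ.∣ a ℚ.- c ∣ ℚ.< η ℚ.* ½ → ℚ.∣ b ℚ.- d ∣ ℚ.< η ℚ.* ½ →
    ℚ.∣ a ℚ.* b ℚ.- c ℚ.* d ∣ ℚ.< ε
  *-close {ε} {η} {B} a b c d 0<B Bη≡ε a≤B d≤B ac bd = begin-strict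
    ℚ.∣ a ℚ.* b ℚ.- c ℚ.* d ∣                     ≤⟨ *-dist a b c d a≤B d≤B ⟩
    B ℚ.* (ℚ.∣ a ℚ.- c ∣ ℚ.+ ℚ.∣ b ℚ.- d ∣)
      <⟨ ℚₚ.*-monoʳ-<-pos B {{ℚ.positive 0<B}} (ℚₚ.+-mono-< ac bd) ⟩
    B ℚ.* (η ℚ.* ½ ℚ.+ η ℚ.* ½)                   ≡⟨ cong (B ℚ.*_) (½+½ η) ⟩
    B ℚ.* η                                       ≡⟨ Bη≡ε ⟩
    ε ∎
    where open ℚₚ.≤-Reasoning

  bounded₂ : ∀ x y → ∃[ B ] 0ℚ ℚ.< B × ∃[ N ] ∀ n → N ℕ.≤ n →
    ℚ.∣ seq x n ∣ ℚ.≤ B × ℚ.∣ seq y n ∣ ℚ.≤ B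
  bounded₂ x y =
    let A , 0<A , K , a = bounded x
        B , 0<B , L , b = bounded y
    in A ℚ.+ B , ℚₚ.<-≤-trans 0<A (p≤p+q A B 0<B) , K ℕ.⊔ L , λ n K⊔L≤n →
      ℚₚ.≤-trans (a n (ℕₚ.m⊔n≤o⇒m≤o K L K⊔L≤n)) (p≤p+q A B 0<B) ,
      ℚₚ.≤-trans (b n (ℕₚ.m⊔n≤o⇒n≤o K L K⊔L≤n))
        (subst (B ℚ.≤_) (ℚₚ.+-comm B A) (p≤p+q B A 0<A))

  *-cauchy : ∀ x y → IsCauchy (λ n → seq x n ℚ.* seq y n)
  *-cauchy x y ε 0<ε =
    let B , 0<B , K , bound = bounded₂ x y
        η , 0<η , Bη≡ε      = quotient-pos 0<ε 0<B
        M , f               = cauchy x (η ℚ.* ½) (½-pos 0<η)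
        N , g               = cauchy y (η ℚ.* ½) (½-pos 0<η)
    in K ℕ.⊔ (M ℕ.⊔ N) , λ m n P≤m P≤n →
      let MN≤m = ℕₚ.m⊔n≤o⇒n≤o K (M ℕ.⊔ N) P≤m
          MN≤n = ℕₚ.m⊔n≤o⇒n≤o K (M ℕ.⊔ N) P≤n
      in *-close (seq x m) (seq y m) (seq x n) (seq y n) 0<B Bη≡ε
           (proj₁ (bound m (ℕₚ.m⊔n≤o⇒m≤o K (M ℕ.⊔ N) P≤m)))
           (proj₂ (bound n (ℕₚ.m⊔n≤o⇒m≤o K (M ℕ.⊔ N) P≤n)))
           (f m n (ℕₚ.m⊔n≤o⇒m≤o M N MN≤m) (ℕₚ.m⊔n≤o⇒m≤o M N MN≤n))
           (g m n (ℕₚ.m⊔n≤o⇒n≤o M N MN≤m) (ℕₚ.m⊔n≤o⇒n≤o M N MN≤n))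

_+_ : ℝ → ℝ → ℝ
x + y = mkℝ (λ n → seq x n ℚ.+ seq y n) (+-cauchy x y)

-_ : ℝ → ℝ
- x = mkℝ (λ n → ℚ.- seq x n) (neg-cauchy x)

_-_ : ℝ → ℝ → ℝ
x - y = x + - y

_*_ : ℝ → ℝ → ℝ
x * y = mkℝ (λ n → seq x n ℚ.* seq y n) (*-cauchy x y)

∣_∣ : ℝ → ℝ
∣ x ∣ = mkℝ (λ n → ℚ.∣ seq x n ∣) (abs-cauchy x)

_^_ : ℝ → ℕ → ℝ
x ^ zero  = 1ℝ
x ^ suc n = x ^ n * x

-- Totalised rational inverse. The value at 0 is irrelevant: the terms of a
-- sequence apart from zero are eventually nonzero.
invℚ : ℚ → ℚ
invℚ q with q ℚₚ.≟ 0ℚ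
... | yes _  = 0ℚ
... | no q≢0 = (ℚ.1/ q) {{ℚ.≢-nonZero q≢0}}

private
  invℚ-inverse : ∀ {δ} q → 0ℚ ℚ.< δ → δ ℚ.≤ ℚ.∣ q ∣ → q ℚ.* invℚ q ≡ 1ℚ
  invℚ-inverse q 0<δ δ≤∣q∣ with q ℚₚ.≟ 0ℚ
  ... | yes refl = contradiction (ℚₚ.<-≤-trans 0<δ δ≤∣q∣) (ℚₚ.<-irrefl refl)
  ... | no q≢0   = ℚₚ.*-inverseʳ q {{ℚ.≢-nonZero q≢0}}

  invℚ-bound : ∀ {δ J} q → 0ℚ ℚ.< δ → 0ℚ ℚ.< J → δ ℚ.* J ≡ 1ℚ →
    δ ℚ.≤ ℚ.∣ q ∣ → ℚ.∣ invℚ q ∣ ℚ.≤ J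
  invℚ-bound {δ} {J} q 0<δ 0<J δJ≡1 δ≤∣q∣ = begin
    i                            ≡⟨ sym (ℚₚ.*-identityʳ i) ⟩
    i ℚ.* 1ℚ                     ≡⟨ cong (i ℚ.*_) (sym δJ≡1) ⟩
    i ℚ.* (δ ℚ.* J)              ≤⟨ ℚₚ.*-monoˡ-≤-nonNeg i {{ℚₚ.∣-∣-nonNeg (invℚ q)}}
                                      (ℚₚ.*-monoʳ-≤-nonNeg J {{J≥0}} δ≤∣q∣) ⟩
    i ℚ.* (ℚ.∣ q ∣ ℚ.* J)
      ≡⟨ solve 3 (λ i q J → i :* (q :* J) := (q :* i) :* J) refl i ℚ.∣ q ∣ J ⟩
    (ℚ.∣ q ∣ ℚ.* i) ℚ.* J        ≡⟨ cong (ℚ._* J) (sym (ℚₚ.∣p*q∣≡∣p∣*∣q∣ q (invℚ q))) ⟩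
    ℚ.∣ q ℚ.* invℚ q ∣ ℚ.* J     ≡⟨ cong (λ z → ℚ.∣ z ∣ ℚ.* J) (invℚ-inverse q 0<δ δ≤∣q∣) ⟩
    1ℚ ℚ.* J                     ≡⟨ ℚₚ.*-identityˡ J ⟩
    J                            ∎
    where
      open ℚₚ.≤-Reasoning
      open ℚ-Solver.+-*-Solver
      i   = ℚ.∣ invℚ q ∣
      J≥0 = ℚ.nonNegative (ℚₚ.<⇒≤ 0<J)

  invℚ-close : ∀ {δ J η ε} a b → 0ℚ ℚ.< δ → 0ℚ ℚ.< J → δ ℚ.* J ≡ 1ℚ →
    (J ℚ.* J) ℚ.* η ≡ ε → δ ℚ.≤ ℚ.∣ a ∣ → δ ℚ.≤ ℚ.∣ b ∣ →
    ℚ.∣ a ℚ.- b ∣ ℚ.< η → ℚ.∣ invℚ a ℚ.- invℚ b ∣ ℚ.< ε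
  invℚ-close {δ} {J} {η} {ε} a b 0<δ 0<J δJ≡1 JJη≡ε δ≤a δ≤b ab = begin-strict
    ℚ.∣ i ℚ.- j ∣
      ≡⟨ cong ℚ.∣_∣ (cong₂ ℚ._-_ (sym (ℚₚ.*-identityʳ i)) (sym (ℚₚ.*-identityʳ j))) ⟩
    ℚ.∣ i ℚ.* 1ℚ ℚ.- j ℚ.* 1ℚ ∣
      ≡⟨ cong₂ (λ u v → ℚ.∣ i ℚ.* u ℚ.- j ℚ.* v ∣)
           (sym (invℚ-inverse b 0<δ δ≤b)) (sym (invℚ-inverse a 0<δ δ≤a)) ⟩
    ℚ.∣ i ℚ.* (b ℚ.* j) ℚ.- j ℚ.* (a ℚ.* i) ∣
      ≡⟨ cong ℚ.∣_∣ (solve 4 (λ i j a b →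
           i :* (b :* j) :- j :* (a :* i) := (i :* j) :* (b :- a)) refl i j a b) ⟩
    ℚ.∣ (i ℚ.* j) ℚ.* (b ℚ.- a) ∣
      ≡⟨ ℚₚ.∣p*q∣≡∣p∣*∣q∣ (i ℚ.* j) (b ℚ.- a) ⟩
    ℚ.∣ i ℚ.* j ∣ ℚ.* ℚ.∣ b ℚ.- a ∣
      ≡⟨ cong₂ ℚ._*_ (ℚₚ.∣p*q∣≡∣p∣*∣q∣ i j) (∣-∣-sym b a) ⟩
    (ℚ.∣ i ∣ ℚ.* ℚ.∣ j ∣) ℚ.* ℚ.∣ a ℚ.- b ∣
      ≤⟨ ℚₚ.*-monoʳ-≤-nonNeg ℚ.∣ a ℚ.- b ∣ {{ℚₚ.∣-∣-nonNeg (a ℚ.- b)}}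
           (*-mono-∣∣ {i} {j} J (invℚ-bound a 0<δ 0<J δJ≡1 δ≤a)
                                (invℚ-bound b 0<δ 0<J δJ≡1 δ≤b)) ⟩
    (J ℚ.* J) ℚ.* ℚ.∣ a ℚ.- b ∣
      <⟨ ℚₚ.*-monoʳ-<-pos (J ℚ.* J) {{ℚₚ.pos*pos⇒pos J {{J>0}} J {{J>0}}}} ab ⟩
    (J ℚ.* J) ℚ.* η              ≡⟨ JJη≡ε ⟩
    ε                            ∎
    where
      open ℚₚ.≤-Reasoning
      open ℚ-Solver.+-*-Solver
      i = invℚ a
      j = invℚ b
      J>0 = ℚ.positive 0<J

  inv-cauchy : ∀ x → x #0 → IsCauchy (λ n → invℚ (seq x n))
  inv-cauchy x (δ , 0<δ , K , apart) ε 0<ε =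
    let J , 0<J , δJ≡1  = quotient-pos 0<1 0<δ
        η , 0<η , JJη≡ε = quotient-pos 0<ε
          (ℚₚ.positive⁻¹ (J ℚ.* J)
            {{ℚₚ.pos*pos⇒pos J {{ℚ.positive 0<J}} J {{ℚ.positive 0<J}}}})
        N , f           = cauchy x η 0<η
    in K ℕ.⊔ N , λ m n P≤m P≤n →
      invℚ-close (seq x m) (seq x n) 0<δ 0<J δJ≡1 JJη≡ε
        (apart m (ℕₚ.m⊔n≤o⇒m≤o K N P≤m)) (apart n (ℕₚ.m⊔n≤o⇒m≤o K N P≤n))
        (f m n (ℕₚ.m⊔n≤o⇒n≤o K N P≤m) (ℕₚ.m⊔n≤o⇒n≤o K N P≤n))

_⁻¹[_] : (x : ℝ) → x #0 → ℝ
x ⁻¹[ x#0 ] = mkℝ (λ n → invℚ (seq x n)) (inv-cauchy x x#0)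

_÷_[_] : (x y : ℝ) → y #0 → ℝ
x ÷ y [ y#0 ] = x * y ⁻¹[ y#0 ]

IsLimit : (ℕ → ℝ) → ℝ → Set
IsLimit u l = ∀ ε → 0ℝ < ε → ∃[ N ] ∀ n → N ℕ.≤ n → ∣ u n - l ∣ < ε

_!⁻¹ : ℕ → ℚ
n !⁻¹ = (ℤ.+ 1 ℚ./ (n !)) {{n ℕₚ.!≢0}}

expSum : ℝ → ℕ → ℝ
expSum x zero    = 0ℝ
expSum x (suc n) = expSum x n + x ^ n * fromℚ (n !⁻¹)

IsExp : ℝ → ℝ → Set
IsExp x y = IsLimit (expSum x) y

-- IsLog x l says that l = log x, i.e. that eˡ = x.
IsLog : ℝ → ℝ → Set
IsLog x l = IsExp l x

ζ₂-sum : ℕ → ℚ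
ζ₂-sum zero    = 0ℚ
ζ₂-sum (suc n) = ζ₂-sum n ℚ.+ ℤ.+ 1 ℚ./ (suc n ℕ.* suc n)

private
  recip : ℕ → ℚ
  recip n = ℤ.+ 1 ℚ./ suc n

  toℚᵘ-/ : ∀ i n → ℚ.toℚᵘ (i ℚ./ suc n) ℚᵘ.≃ ℚᵘ.mkℚᵘ i n
  toℚᵘ-/ i n = ℚₚ.toℚᵘ-fromℚᵘ (ℚᵘ.mkℚᵘ i n)

  square≤ : ∀ n → ℤ.+ 1 ℚ./ (suc (suc n) ℕ.* suc (suc n)) ℚ.+ recip (suc n) ℚ.≤ recip n
  square≤ n = ℚₚ.toℚᵘ-cancel-≤ (begin
    ℚ.toℚᵘ (sq ℚ.+ recip (suc n))                ≃⟨ ℚₚ.toℚᵘ-homo-+ sq (recip (suc n)) ⟩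
    ℚ.toℚᵘ sq ℚᵘ.+ ℚ.toℚᵘ (recip (suc n))
      ≃⟨ ℚᵘₚ.+-cong (toℚᵘ-/ (ℤ.+ 1) _) (toℚᵘ-/ (ℤ.+ 1) (suc n)) ⟩
    ℚᵘ.mkℚᵘ (ℤ.+ 1) _ ℚᵘ.+ ℚᵘ.mkℚᵘ (ℤ.+ 1) (suc n)
      ≤⟨ ℚᵘ.*≤* (ℤ.+≤+ ineq) ⟩
    ℚᵘ.mkℚᵘ (ℤ.+ 1) n                            ≃⟨ ℚᵘₚ.≃-sym (toℚᵘ-/ (ℤ.+ 1) n) ⟩
    ℚ.toℚᵘ (recip n)                             ∎)
    where
      open ℚᵘₚ.≤-Reasoning
      sq = ℤ.+ 1 ℚ./ (suc (suc n) ℕ.* suc (suc n))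
      m = suc (suc n)
      ineq : (1 ℕ.* m ℕ.+ 1 ℕ.* (m ℕ.* m)) ℕ.* suc n ℕ.≤ 1 ℕ.* (m ℕ.* m ℕ.* m)
      ineq = ℕₚ.≤-trans (ℕₚ.m≤m+n _ m) (ℕₚ.≤-reflexive
        (solve 1 (λ n → let k = con 1 :+ n; m = con 2 :+ n in
           (con 1 :* m :+ con 1 :* (m :* m)) :* k :+ m := con 1 :* (m :* m :* m)) refl n))
        where open ℕ-Solver.+-*-Solver

  recip-pos : ∀ n → 0ℚ ℚ.< recip n
  recip-pos n = ℚₚ.positive⁻¹ (recip n) {{ℚₚ.normalize-pos 1 (suc n)}}

  recip-small : ∀ ε → 0ℚ ℚ.< ε → ∃[ N ] recip N ℚ.< ε
  recip-small ε@(ℚ.mkℚ ℤ.+[1+ a ] d _) _ = suc d , ℚₚ.toℚᵘ-cancel-< (begin-strict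
    ℚ.toℚᵘ (recip (suc d))       ≃⟨ toℚᵘ-/ (ℤ.+ 1) (suc d) ⟩
    ℚᵘ.mkℚᵘ (ℤ.+ 1) (suc d)      <⟨ ℚᵘ.*<* (ℤ.+<+ ineq) ⟩
    ℚ.toℚᵘ ε                     ∎)
    where
      open ℚᵘₚ.≤-Reasoning
      ineq : 1 ℕ.* suc d ℕ.< suc a ℕ.* suc (suc d)
      ineq = ℕₚ.≤-trans (ℕₚ.≤-reflexive (cong suc (ℕₚ.*-identityˡ (suc d))))
                        (ℕₚ.m≤m+n (suc (suc d)) _)
  recip-small (ℚ.mkℚ ℤ.+0 d c) 0<ε =
    contradiction (ℚ.positive 0<ε) λ { () }
  recip-small (ℚ.mkℚ ℤ.-[1+ _ ] d c) 0<ε =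
    contradiction (ℚ.positive 0<ε) λ { () }

  ζ₂-step : ∀ n → ζ₂-sum n ℚ.≤ ζ₂-sum (suc n)
  ζ₂-step n = p≤p+q (ζ₂-sum n) (ℤ.+ 1 ℚ./ (suc n ℕ.* suc n))
    (ℚₚ.positive⁻¹ _ {{ℚₚ.normalize-pos 1 (suc n ℕ.* suc n)}})

  ζ₂-mono : ∀ j n → ζ₂-sum n ℚ.≤ ζ₂-sum (j ℕ.+ n)
  ζ₂-mono zero    n = ℚₚ.≤-refl
  ζ₂-mono (suc j) n = ℚₚ.≤-trans (ζ₂-mono j n) (ζ₂-step (j ℕ.+ n))

  ζ₂-upper : ∀ j n →
    ζ₂-sum (suc (j ℕ.+ n)) ℚ.+ recip (j ℕ.+ n) ℚ.≤ ζ₂-sum (suc n) ℚ.+ recip n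
  ζ₂-upper zero    n = ℚₚ.≤-refl
  ζ₂-upper (suc j) n = ℚₚ.≤-trans
    (ℚₚ.≤-trans
      (ℚₚ.≤-reflexive (ℚₚ.+-assoc (ζ₂-sum (suc (j ℕ.+ n))) _ (recip (suc (j ℕ.+ n)))))
      (ℚₚ.+-monoʳ-≤ (ζ₂-sum (suc (j ℕ.+ n))) (square≤ (j ℕ.+ n))))
    (ζ₂-upper j n)

  ζ₂-near : ∀ j n → ℚ.∣ ζ₂-sum (suc (j ℕ.+ n)) ℚ.- ζ₂-sum (suc n) ∣ ℚ.< recip n
  ζ₂-near j n = begin-strict
    ℚ.∣ s ℚ.- t ∣                  ≡⟨ ℚₚ.0≤p⇒∣p∣≡p 0≤s-t ⟩
    s ℚ.- t
      <⟨ ℚₚ.≤-<-trans (ℚₚ.≤-reflexive (sym (ℚₚ.+-identityʳ (s ℚ.- t))))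
                      (ℚₚ.+-monoʳ-< (s ℚ.- t) (recip-pos (j ℕ.+ n))) ⟩
    (s ℚ.- t) ℚ.+ r
      ≡⟨ solve 3 (λ s t r → (s :- t) :+ r := (s :+ r) :- t) refl s t r ⟩
    (s ℚ.+ r) ℚ.- t                ≤⟨ ℚₚ.+-monoˡ-≤ (ℚ.- t) (ζ₂-upper j n) ⟩
    (t ℚ.+ recip n) ℚ.- t
      ≡⟨ solve 2 (λ t r → (t :+ r) :- t := r) refl t (recip n) ⟩
    recip n                        ∎
    where
      open ℚₚ.≤-Reasoning
      open ℚ-Solver.+-*-Solver
      s = ζ₂-sum (suc (j ℕ.+ n))
      t = ζ₂-sum (suc n)
      r = recip (j ℕ.+ n)
      t≤s : t ℚ.≤ s
      t≤s = subst (λ k → t ℚ.≤ ζ₂-sum k) (ℕₚ.+-suc j n) (ζ₂-mono j (suc n))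
      0≤s-t : 0ℚ ℚ.≤ s ℚ.- t
      0≤s-t = ℚₚ.≤-trans (ℚₚ.≤-reflexive (sym (ℚₚ.+-inverseʳ t)))
                         (ℚₚ.+-monoˡ-≤ (ℚ.- t) t≤s)

  ζ₂-near′ : ∀ {N m} → suc N ℕ.≤ m → ℚ.∣ ζ₂-sum m ℚ.- ζ₂-sum (suc N) ∣ ℚ.< recip N
  ζ₂-near′ {N} {m} N<m =
    subst (λ k → ℚ.∣ ζ₂-sum k ℚ.- ζ₂-sum (suc N) ∣ ℚ.< recip N)
      (trans (sym (ℕₚ.+-suc (m ℕ.∸ suc N) N)) (ℕₚ.m∸n+n≡m N<m))
      (ζ₂-near (m ℕ.∸ suc N) N)

  ζ₂-cauchy : IsCauchy ζ₂-sum
  ζ₂-cauchy ε 0<ε =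
    let N , r<ε/2 = recip-small (ε ℚ.* ½) (½-pos 0<ε)
    in suc N , λ m n N<m N<n →
      subst (ℚ.∣ ζ₂-sum m ℚ.- ζ₂-sum n ∣ ℚ.<_) (½+½ ε)
        (ℚₚ.≤-<-trans (triangle (ζ₂-sum m) (ζ₂-sum (suc N)) (ζ₂-sum n))
          (ℚₚ.+-mono-<
            (ℚₚ.<-trans (ζ₂-near′ N<m) r<ε/2)
            (subst (ℚ._< ε ℚ.* ½) (∣-∣-sym (ζ₂-sum n) (ζ₂-sum (suc N)))
              (ℚₚ.<-trans (ζ₂-near′ N<n) r<ε/2))))

-- ζ(2) = Σ_{k ≥ 1} 1/k²
ζ₂ : ℝ
ζ₂ = mkℝ ζ₂-sum ζ₂-cauchy

4ζ₂#0 : (fromℕ 4 * ζ₂) #0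
4ζ₂#0 = 1ℚ , 0<1 , 1 , λ where
  (suc n) _ → ℚₚ.≤-trans
    (ℚₚ.≤-trans (ℚ.*≤* (ℤ.+≤+ (s≤s z≤n)))
      (ℚₚ.*-monoˡ-≤-nonNeg (ℤ.+ 4 ℚ./ 1)
        (subst (λ k → 1ℚ ℚ.≤ ζ₂-sum k) (ℕₚ.+-comm n 1) (ζ₂-mono n 1))))
    (p≤∣p∣ (ℤ.+ 4 ℚ./ 1 ℚ.* ζ₂-sum (suc n)))

infix 4 _≈ᶜ_

record ℂ : Set where
  constructor _+i_
  field
    re im : ℝ

open ℂ public

_≈ᶜ_ : ℂ → ℂ → Set
z ≈ᶜ w = re z ≈ re w × im z ≈ im w

_+ᶜ_ _*ᶜ_ : ℂ → ℂ → ℂ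
z +ᶜ w = (re z + re w) +i (im z + im w)
z *ᶜ w = (re z * re w - im z * im w) +i (re z * im w + im z * re w)

ℤ→ℂ : ℤ → ℂ
ℤ→ℂ i = fromℤ i +i 0ℝ

0ᶜ : ℂ
0ᶜ = ℤ→ℂ (ℤ.+ 0)

-- Integer polynomials: coefficient lists, constant term first.
Poly : Set
Poly = List ℤ

coeff : Poly → ℕ → ℤ
coeff []      _       = ℤ.+ 0
coeff (a ∷ _) zero    = a
coeff (_ ∷ f) (suc n) = coeff f n

infix  4 _≈ᵖ_
infixl 7 _*ᵖ_
infixl 6 _+ᵖ_

-- Lists that differ only by trailing zeros represent the same polynomial.
_≈ᵖ_ : Poly → Poly → Set
f ≈ᵖ g = ∀ n → coeff f n ≡ coeff g n

_+ᵖ_ : Poly → Poly → Poly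
[]      +ᵖ g       = g
(a ∷ f) +ᵖ []      = a ∷ f
(a ∷ f) +ᵖ (b ∷ g) = (a ℤ.+ b) ∷ (f +ᵖ g)

_*ᵖ_ : Poly → Poly → Poly
[]      *ᵖ g = []
(a ∷ f) *ᵖ g = map (a ℤ.*_) g +ᵖ (ℤ.+ 0 ∷ (f *ᵖ g))

tⁿ-1 : ℕ → Poly
tⁿ-1 n = (replicate n (ℤ.+ 0) ++ (ℤ.+ 1 ∷ [])) +ᵖ (ℤ.-[1+ 0 ] ∷ [])

evalᶜ : Poly → ℂ → ℂ
evalᶜ []      z = 0ᶜ
evalᶜ (a ∷ f) z = ℤ→ℂ a +ᶜ (z *ᶜ evalᶜ f z)

-- D = (t^{pq} - 1)(t - 1) / ((t^p - 1)(t^q - 1)). For p, q > 0 the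
-- denominator is a nonzero polynomial, so this determines D up to _≈ᵖ_.
IsAlexander : ℕ → ℕ → Poly → Set
IsAlexander p q D = D *ᵖ (tⁿ-1 p *ᵖ tⁿ-1 q) ≈ᵖ tⁿ-1 (p ℕ.* q) *ᵖ tⁿ-1 1

IsAlexanderRoot : ℕ → ℕ → ℂ → Set
IsAlexanderRoot p q α = ∃[ D ] IsAlexander p q D × evalᶜ D α ≈ᶜ 0ᶜ

record Ω₁-Element (X : ℝ) : Set where
  field
    p q     : ℕ
    p>0     : 0 ℕ.< p
    q>0     : 0 ℕ.< q
    coprime : Coprime p q
    max≤X   : fromℕ (p ℕ.⊔ q) ≤ X
    α       : ℂ
    root    : IsAlexanderRoot p q α

-- Elements are compared as pairs (T_{p,q} , α); the proofs are ignored.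
Ω₁ : ℝ → Setoid 0ℓ 0ℓ
Ω₁ X = record
  { Carrier       = Ω₁-Element X
  ; _≈_           = λ s t → p s ≡ p t × q s ≡ q t × α s ≈ᶜ α t
  ; isEquivalence = record
    { refl  = λ {s} → refl , refl , ≈-refl {re (α s)} , ≈-refl {im (α s)}
    ; sym   = λ {s} {t} (a , b , c , d) →
        sym a , sym b ,
        ≈-sym {re (α s)} {re (α t)} c , ≈-sym {im (α s)} {im (α t)} d
    ; trans = λ {s} {t} {u} (a , b , c , d) (a′ , b′ , c′ , d′) →
        trans a a′ , trans b b′ ,
        ≈-trans {re (α s)} {re (α t)} {re (α u)} c c′ ,
        ≈-trans {im (α s)} {im (α t)} {im (α u)} d d′
    }
  }
  where open Ω₁-Element

HasCardinality : Setoid 0ℓ 0ℓ → ℕ → Set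
HasCardinality S n = Bijection (≡.setoid (Fin n)) S

-- A partial function of a real variable, given by its graph: F X y says that
-- F(X) is defined and equal to y. Used for #Ω₁, which depends on the integer
-- part of X and so is not constructively total on ℝ, and for log.
Graph : Set₁
Graph = ℝ → ℝ → Set

#Ω₁ : Graph
#Ω₁ X y = ∃[ N ] HasCardinality (Ω₁ X) N × y ≈ fromℕ N

_≐_+O[_] : Graph → (ℝ → ℝ) → Graph → Set
f ≐ g +O[ h ] = ∃[ C ] ∃[ X₀ ] ∀ X → X₀ ≤ X → ∀ y z → f X y → h X z →
                ∣ y - g X ∣ ≤ C * z

_∼_ : Graph → (ℝ → ℝ) → Set
f ∼ h = ∀ ε → 0ℝ < ε → ∃[ X₀ ] ∀ X → X₀ ≤ X →
        Σ[ hX#0 ∈ h X #0 ] ∀ y → f X y → ∣ (y ÷ h X [ hX#0 ]) - 1ℝ ∣ < ε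

module Submission where

-- For coprime p and q the roots of Δ_{p,q} are the (p - 1)(q - 1) products x y
-- with x^p = y^q = 1 and x, y ≠ 1, so #Ω₁(X) is the sum of (p - 1)(q - 1) over
-- the coprime pairs with p, q ≤ n = ⌊X⌋. Möbius inversion turns Σ p q over these
-- pairs into Σ_d μ(d) d² T(⌊n/d⌋)² with T(k) = k (k + 1) / 2, which is
-- n⁴ / (4 ζ(2)) up to a constant times n³ H_n, and H_n is bounded by log X because
-- the partial sums of exp at H_n - 1 stay below n.
-- Constructively ⌊X⌋ and the primitive roots of unity exist only up to double
-- negation. This suffices, because equality of naturals and ≤ on ℝ are stable.

-- Every estimate is made between rationals, on the terms of Cauchy sequences. ζ(2) appears as its
-- partial sum `Z m` and Σ μ(d)/d² as `M n`; a finite Möbius identity bounds `1ℚ - Z m * M n` for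
-- all m ≥ n at once, so that m can be the index of the sequence that defines ζ(2). Equality in ℂ is
-- undecidable, which rules out counting zeros of a polynomial. Nonvanishing is therefore expressed
-- by invertibility, and roots of unity are listed by a character sum combined with the fact that ℂ
-- is a local ring. A primitive N-th root of unity for N ≥ 3 is (1 + it)/(1 - it) with t = tan(π/N);
-- this t is the limit of a bisection that tests whether the polynomials Im (1 + it)^k / t with 1 ≤
-- k ≤ N are all positive. `IsLog` describes a logarithm only through the exponential series, and
-- the sign of its approximations is unknown. Bounding them from below therefore also takes a bound
-- for truncated series at negative arguments.

open import Data.Integer.Base as ℤ using (ℤ)
import Data.Integer.Properties as ℤₚ
open import Data.Nat.Base as ℕ using (ℕ; zero; suc; s≤s; z≤n)
import Data.Nat.Properties as ℕₚ
open import Data.Product.Base using (∃-syntax; _×_; _,_; proj₁; proj₂)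
open import Data.Rational.Base as ℚ using (ℚ; 0ℚ; 1ℚ; ½)
import Data.Rational.Properties as ℚₚ
import Data.Rational.Solver as ℚ-Solver
open import Data.Sum.Base using (_⊎_; inj₁; inj₂)
open import Level using (0ℓ)
open import Relation.Binary.PropositionalEquality as ≡ using (_≡_)
open import Relation.Nullary using (Dec; yes; no; contradiction; ¬_)
open import Relation.Unary using (Decidable)

-- Inequalities in ℚ and the embedding of ℕ.

module RationalOrder where

  open import Data.Rational.Base
  import Data.Rational.Unnormalised.Base as ℚᵘ
  import Data.Rational.Unnormalised.Properties as ℚᵘₚ
  open ℚₚ
  open ≡ using (refl; sym; trans; cong; cong₂; subst)

  open ℚ-Solver.+-*-Solver using (solve; _:=_; _:+_; _:*_; _:-_; :-_)

  -- The certificate format of most estimates below: the slack `d` is named explicitly, its sign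
  -- follows from closure rules, and the equation is left to the ring solver.
  ≤-by : ∀ {a b} d → 0ℚ ≤ d → a + d ≡ b → a ≤ b
  ≤-by {a} d 0≤d refl = subst (_≤ a + d) (+-identityʳ a) (+-monoʳ-≤ a 0≤d)

  <-by : ∀ {a b} d → 0ℚ < d → a + d ≡ b → a < b
  <-by {a} d 0<d refl = subst (_< a + d) (+-identityʳ a) (+-monoʳ-< a 0<d)

  0≤-diff : ∀ {a b} → a ≤ b → 0ℚ ≤ b - a
  0≤-diff {a} {b} a≤b = subst (_≤ b - a) (+-inverseʳ a) (+-monoˡ-≤ (- a) a≤b)

  0<-diff : ∀ {a b} → a < b → 0ℚ < b - a
  0<-diff {a} {b} a<b = subst (_< b - a) (+-inverseʳ a) (+-monoˡ-< (- a) a<b)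

  0≤+ : ∀ {a b} → 0ℚ ≤ a → 0ℚ ≤ b → 0ℚ ≤ a + b
  0≤+ = +-mono-≤

  0<+ : ∀ {a b} → 0ℚ < a → 0ℚ < b → 0ℚ < a + b
  0<+ = +-mono-<

  0≤* : ∀ {a b} → 0ℚ ≤ a → 0ℚ ≤ b → 0ℚ ≤ a * b
  0≤* {a} {b} 0≤a 0≤b = nonNegative⁻¹ (a * b)
    {{nonNeg*nonNeg⇒nonNeg a {{nonNegative 0≤a}} b {{nonNegative 0≤b}}}}

  0<* : ∀ {a b} → 0ℚ < a → 0ℚ < b → 0ℚ < a * b
  0<* {a} {b} 0<a 0<b = positive⁻¹ (a * b)
    {{pos*pos⇒pos a {{positive 0<a}} b {{positive 0<b}}}}

  0≤² : ∀ a → 0ℚ ≤ a * a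
  0≤² a with ≤-total 0ℚ a
  ... | inj₁ 0≤a = 0≤* 0≤a 0≤a
  ... | inj₂ a≤0 = subst (0ℚ ≤_) (solve 1 (λ a → (:- a) :* (:- a) := a :* a) refl a)
                     (0≤* (neg-antimono-≤ a≤0) (neg-antimono-≤ a≤0))

  0<1 : 0ℚ < 1ℚ
  0<1 = positive⁻¹ 1ℚ

  0<½ : 0ℚ < ½
  0<½ = positive⁻¹ ½

  0≤1 : 0ℚ ≤ 1ℚ
  0≤1 = <⇒≤ 0<1

  ½-pos : ∀ {ε} → 0ℚ < ε → 0ℚ < ε * ½
  ½-pos 0<ε = 0<* 0<ε 0<½

  *-mono-≤ : ∀ {a b c d} → 0ℚ ≤ a → a ≤ b → 0ℚ ≤ c → c ≤ d → a * c ≤ b * d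
  *-mono-≤ {a} {b} {c} {d} 0≤a a≤b 0≤c c≤d = ≤-trans
    (*-monoʳ-≤-nonNeg c {{nonNegative 0≤c}} a≤b)
    (*-monoˡ-≤-nonNeg b {{nonNegative (≤-trans 0≤a a≤b)}} c≤d)

  *-monoˡ-≤ : ∀ {a b} c → 0ℚ ≤ c → a ≤ b → c * a ≤ c * b
  *-monoˡ-≤ c 0≤c = *-monoˡ-≤-nonNeg c {{nonNegative 0≤c}}

  *-monoʳ-≤ : ∀ {a b} c → 0ℚ ≤ c → a ≤ b → a * c ≤ b * c
  *-monoʳ-≤ c 0≤c = *-monoʳ-≤-nonNeg c {{nonNegative 0≤c}}

  *-cancelˡ-≤ : ∀ {a b} c → 0ℚ < c → c * a ≤ c * b → a ≤ b
  *-cancelˡ-≤ c 0<c = *-cancelˡ-≤-pos c {{positive 0<c}}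

  ∣p∣≤ : ∀ {p q} → p ≤ q → - p ≤ q → ∣ p ∣ ≤ q
  ∣p∣≤ {p} p≤q -p≤q with ∣p∣≡p∨∣p∣≡-p p
  ... | inj₁ eq = subst (_≤ _) (sym eq) p≤q
  ... | inj₂ eq = subst (_≤ _) (sym eq) -p≤q

  p≤∣p∣ : ∀ p → p ≤ ∣ p ∣
  p≤∣p∣ p with ≤-total 0ℚ p
  ... | inj₁ 0≤p = ≤-reflexive (sym (0≤p⇒∣p∣≡p 0≤p))
  ... | inj₂ p≤0 = ≤-trans p≤0 (0≤∣p∣ p)

  -p≤∣p∣ : ∀ p → - p ≤ ∣ p ∣
  -p≤∣p∣ p = subst (- p ≤_) (∣-p∣≡∣p∣ p) (p≤∣p∣ (- p))

  ∣p-q∣-comm : ∀ p q → ∣ p - q ∣ ≡ ∣ q - p ∣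
  ∣p-q∣-comm p q = trans
    (cong ∣_∣ (solve 2 (λ x y → x :- y := :- (y :- x)) refl p q)) (∣-p∣≡∣p∣ (q - p))

  ∣p-q∣≤⇒p≤ : ∀ p q {r} → ∣ p - q ∣ ≤ r → p ≤ q + r
  ∣p-q∣≤⇒p≤ p q {r} h = ≤-by (r - (p - q)) (0≤-diff (≤-trans (p≤∣p∣ (p - q)) h))
    (solve 3 (λ p q r → p :+ (r :- (p :- q)) := q :+ r) refl p q r)

  ∣p-q∣≤⇒q≤ : ∀ p q {r} → ∣ p - q ∣ ≤ r → q ≤ p + r
  ∣p-q∣≤⇒q≤ p q h = ∣p-q∣≤⇒p≤ q p (subst (_≤ _) (∣p-q∣-comm p q) h)

  ∣p-q∣≤ : ∀ p q {r} → p ≤ q + r → q ≤ p + r → ∣ p - q ∣ ≤ r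
  ∣p-q∣≤ p q {r} h k = ∣p∣≤
    (≤-by (q + r - p) (0≤-diff h) (solve 3 (λ p q r → p :- q :+ (q :+ r :- p) := r) refl p q r))
    (≤-by (p + r - q) (0≤-diff k) (solve 3 (λ p q r → :- (p :- q) :+ (p :+ r :- q) := r) refl p q r))

  triangle : ∀ x y z → ∣ x - z ∣ ≤ ∣ x - y ∣ + ∣ y - z ∣
  triangle x y z = subst (λ w → ∣ w ∣ ≤ ∣ x - y ∣ + ∣ y - z ∣)
    (solve 3 (λ x y z → (x :- y) :+ (y :- z) := x :- z) refl x y z)
    (∣p+q∣≤∣p∣+∣q∣ (x - y) (y - z))

  reciprocal : ∀ {p} → 0ℚ < p → ∃[ r ] 0ℚ < r × p * r ≡ 1ℚ
  reciprocal {p} 0<p = 1/ p , positive⁻¹ (1/ p) {{1/pos⇒pos p}} , *-inverseʳ p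
    where instance
      _ = positive 0<p
      _ = pos⇒nonZero p {{positive 0<p}}

  fromℤᵘ : ∀ i → toℚᵘ (i / 1) ℚᵘ.≃ ℚᵘ.mkℚᵘ i 0
  fromℤᵘ i = toℚᵘ-fromℚᵘ (ℚᵘ.mkℚᵘ i 0)

  /1-homo-+ : ∀ i j → (i ℤ.+ j) / 1 ≡ i / 1 + j / 1
  /1-homo-+ i j = toℚᵘ-injective (begin-equality
    toℚᵘ ((i ℤ.+ j) / 1)                 ≃⟨ fromℤᵘ (i ℤ.+ j) ⟩
    ℚᵘ.mkℚᵘ (i ℤ.+ j) 0
      ≡⟨ cong (λ k → ℚᵘ.mkℚᵘ k 0) (cong₂ ℤ._+_ (sym (ℤₚ.*-identityʳ i)) (sym (ℤₚ.*-identityʳ j))) ⟩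
    ℚᵘ.mkℚᵘ i 0 ℚᵘ.+ ℚᵘ.mkℚᵘ j 0         ≃⟨ ℚᵘₚ.+-cong (fromℤᵘ i) (fromℤᵘ j) ⟨
    toℚᵘ (i / 1) ℚᵘ.+ toℚᵘ (j / 1)       ≃⟨ toℚᵘ-homo-+ (i / 1) (j / 1) ⟨
    toℚᵘ (i / 1 + j / 1)                 ∎)
    where open ℚᵘₚ.≤-Reasoning

  /1-homo-* : ∀ i j → (i ℤ.* j) / 1 ≡ i / 1 * (j / 1)
  /1-homo-* i j = toℚᵘ-injective (begin-equality
    toℚᵘ ((i ℤ.* j) / 1)                 ≃⟨ fromℤᵘ (i ℤ.* j) ⟩
    ℚᵘ.mkℚᵘ i 0 ℚᵘ.* ℚᵘ.mkℚᵘ j 0         ≃⟨ ℚᵘₚ.*-cong (fromℤᵘ i) (fromℤᵘ j) ⟨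
    toℚᵘ (i / 1) ℚᵘ.* toℚᵘ (j / 1)       ≃⟨ toℚᵘ-homo-* (i / 1) (j / 1) ⟨
    toℚᵘ (i / 1 * (j / 1))                 ∎)
    where open ℚᵘₚ.≤-Reasoning

  infix 9 1/_+1

  opaque
    -- Opaque, so that conversion checking never unfolds these rationals to normal forms with their
    -- gcd computations; `⟦⟧-def` and `1/+1-def` recover the library expressions.
    ⟦_⟧ : ℕ → ℚ
    ⟦ n ⟧ = ℤ.+ n / 1

    1/_+1 : ℕ → ℚ
    1/ n +1 = ℤ.+ 1 / suc n

    ⟦⟧-def : ∀ n → ⟦ n ⟧ ≡ ℤ.+ n / 1
    ⟦⟧-def n = refl

    1/+1-def : ∀ n → 1/ n +1 ≡ ℤ.+ 1 / suc n
    1/+1-def n = refl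

    ⟦0⟧ : ⟦ 0 ⟧ ≡ 0ℚ
    ⟦0⟧ = refl

    ⟦1⟧ : ⟦ 1 ⟧ ≡ 1ℚ
    ⟦1⟧ = refl

    ⟦⟧-+ : ∀ m n → ⟦ m ℕ.+ n ⟧ ≡ ⟦ m ⟧ + ⟦ n ⟧
    ⟦⟧-+ m n = /1-homo-+ (ℤ.+ m) (ℤ.+ n)

    ⟦⟧-* : ∀ m n → ⟦ m ℕ.* n ⟧ ≡ ⟦ m ⟧ * ⟦ n ⟧
    ⟦⟧-* m n = trans (cong (_/ 1) (ℤₚ.pos-* m n)) (/1-homo-* (ℤ.+ m) (ℤ.+ n))

    0≤⟦⟧ : ∀ n → 0ℚ ≤ ⟦ n ⟧
    0≤⟦⟧ n = nonNegative⁻¹ ⟦ n ⟧ {{normalize-nonNeg n 1}}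

    0<⟦suc⟧ : ∀ n → 0ℚ < ⟦ suc n ⟧
    0<⟦suc⟧ n = positive⁻¹ ⟦ suc n ⟧ {{normalize-pos (suc n) 1}}

    0<1/+1 : ∀ n → 0ℚ < 1/ n +1
    0<1/+1 n = positive⁻¹ (1/ n +1) {{normalize-pos 1 (suc n)}}

    1/+1-* : ∀ n → ⟦ suc n ⟧ * 1/ n +1 ≡ 1ℚ
    1/+1-* n = toℚᵘ-injective (begin-equality
      toℚᵘ (⟦ suc n ⟧ * 1/ n +1)               ≃⟨ toℚᵘ-homo-* ⟦ suc n ⟧ (1/ n +1) ⟩
      toℚᵘ ⟦ suc n ⟧ ℚᵘ.* toℚᵘ (1/ n +1)
        ≃⟨ ℚᵘₚ.*-cong (fromℤᵘ (ℤ.+ suc n)) (toℚᵘ-fromℚᵘ (ℚᵘ.mkℚᵘ (ℤ.+ 1) n)) ⟩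
      ℚᵘ.mkℚᵘ (ℤ.+ suc n) 0 ℚᵘ.* ℚᵘ.mkℚᵘ (ℤ.+ 1) n
        ≃⟨ ℚᵘₚ.*-inverseʳ (ℚᵘ.mkℚᵘ (ℤ.+ suc n) 0) ⟩
      ℚᵘ.mkℚᵘ (ℤ.+ 1) 0                        ∎)
      where open ℚᵘₚ.≤-Reasoning

    archimedean : ∀ p → ∃[ n ] p < ⟦ n ⟧
    -- The numerator plus one exceeds the fraction, as the denominator is at least 1.
    archimedean (mkℚ ℤ.+[1+ a ] d c) = suc (suc a) , toℚᵘ-cancel-< (begin-strict
      ℚᵘ.mkℚᵘ ℤ.+[1+ a ] d               <⟨ ℚᵘ.*<* (ℤ.+<+ ineq) ⟩
      ℚᵘ.mkℚᵘ (ℤ.+ suc (suc a)) 0        ≃⟨ fromℤᵘ (ℤ.+ suc (suc a)) ⟨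
      toℚᵘ ⟦ suc (suc a) ⟧               ∎)
      where
      open ℚᵘₚ.≤-Reasoning
      ineq : suc a ℕ.* 1 ℕ.< suc (suc a) ℕ.* suc d
      ineq = ℕₚ.<-≤-trans (ℕ.s≤s ℕₚ.≤-refl) (ℕₚ.*-monoʳ-≤ (suc (suc a)) (ℕ.s≤s ℕ.z≤n))
    archimedean (mkℚ ℤ.+0 d c) = 1 , ≤-<-trans (nonPositive⁻¹ (mkℚ ℤ.+0 d c)) 0<1
    archimedean (mkℚ ℤ.-[1+ a ] d c) =
      1 , ≤-<-trans (nonPositive⁻¹ (mkℚ ℤ.-[1+ a ] d c)) 0<1

  ⟦⟧-suc : ∀ n → ⟦ suc n ⟧ ≡ 1ℚ + ⟦ n ⟧
  ⟦⟧-suc n = trans (⟦⟧-+ 1 n) (cong (_+ ⟦ n ⟧) ⟦1⟧)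

  ⟦⟧-mono-≤ : ∀ {m n} → m ℕ.≤ n → ⟦ m ⟧ ≤ ⟦ n ⟧
  ⟦⟧-mono-≤ {m} {n} m≤n = ≤-by ⟦ n ℕ.∸ m ⟧ (0≤⟦⟧ _)
    (trans (sym (⟦⟧-+ m (n ℕ.∸ m))) (cong ⟦_⟧ (ℕₚ.m+[n∸m]≡n m≤n)))

  ⟦⟧-mono-< : ∀ {m n} → m ℕ.< n → ⟦ m ⟧ < ⟦ n ⟧
  ⟦⟧-mono-< {m} m<n = <-≤-trans
    (<-by 1ℚ 0<1 (trans (+-comm ⟦ m ⟧ 1ℚ) (sym (⟦⟧-suc m)))) (⟦⟧-mono-≤ m<n)

-- Finite sums of rationals, indicators, and sums over multiples.

module FiniteSums where

  open import Data.Nat.Divisibility using (_∣_; _∣?_; divides; ∣m+n∣m⇒∣n; n∣m*n; >⇒∤)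
  open import Data.Rational.Base
  open import Function.Base using (_∘_)
  open ℚₚ
  open ≡ using (refl; sym; trans; cong; cong₂; subst)
  open RationalOrder

  open ℚ-Solver.+-*-Solver using (solve; _:=_; _:+_; _:*_; con)

  ∑ : ℕ → (ℕ → ℚ) → ℚ
  ∑ zero    f = 0ℚ
  ∑ (suc n) f = ∑ n f + f n

  ∑-cong : ∀ n {f g} → (∀ i → i ℕ.< n → f i ≡ g i) → ∑ n f ≡ ∑ n g
  ∑-cong zero    h = refl
  ∑-cong (suc n) h = cong₂ _+_ (∑-cong n λ i i<n → h i (ℕₚ.m<n⇒m<1+n i<n)) (h n ℕₚ.≤-refl)

  ∑-mono : ∀ n {f g} → (∀ i → i ℕ.< n → f i ≤ g i) → ∑ n f ≤ ∑ n g
  ∑-mono zero    h = ≤-refl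
  ∑-mono (suc n) h = +-mono-≤ (∑-mono n λ i i<n → h i (ℕₚ.m<n⇒m<1+n i<n)) (h n ℕₚ.≤-refl)

  ∑-+ : ∀ n f g → ∑ n (λ i → f i + g i) ≡ ∑ n f + ∑ n g
  ∑-+ zero    f g = refl
  ∑-+ (suc n) f g = trans (cong (_+ (f n + g n)) (∑-+ n f g))
    (solve 4 (λ a b c d → (a :+ b) :+ (c :+ d) := (a :+ c) :+ (b :+ d)) refl
       (∑ n f) (∑ n g) (f n) (g n))

  ∑-*ˡ : ∀ n c f → ∑ n (λ i → c * f i) ≡ c * ∑ n f
  ∑-*ˡ zero    c f = sym (*-zeroʳ c)
  ∑-*ˡ (suc n) c f = trans (cong (_+ c * f n) (∑-*ˡ n c f)) (sym (*-distribˡ-+ c (∑ n f) (f n)))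

  ∑-*ʳ : ∀ n c f → ∑ n (λ i → f i * c) ≡ ∑ n f * c
  ∑-*ʳ n c f = trans (∑-cong n λ i _ → *-comm (f i) c) (trans (∑-*ˡ n c f) (*-comm c (∑ n f)))

  ∑-zero : ∀ n → ∑ n (λ _ → 0ℚ) ≡ 0ℚ
  ∑-zero zero    = refl
  ∑-zero (suc n) = trans (+-identityʳ _) (∑-zero n)

  ∑-const : ∀ n c → ∑ n (λ _ → c) ≡ ⟦ n ⟧ * c
  ∑-const zero    c = sym (trans (cong (_* c) ⟦0⟧) (*-zeroˡ c))
  ∑-const (suc n) c = trans (cong (_+ c) (∑-const n c)) (sym (trans (cong (_* c) (⟦⟧-suc n))
    (solve 2 (λ n c → (con 1ℚ :+ n) :* c := n :* c :+ c) refl ⟦ n ⟧ c)))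

  ∑-swap : ∀ m n (f : ℕ → ℕ → ℚ) → ∑ m (λ i → ∑ n (λ j → f i j)) ≡ ∑ n (λ j → ∑ m (λ i → f i j))
  ∑-swap zero    n f = sym (∑-zero n)
  ∑-swap (suc m) n f = trans (cong (_+ ∑ n (f m)) (∑-swap m n f))
    (sym (∑-+ n (λ j → ∑ m (λ i → f i j)) (f m)))

  ∑-nonNeg : ∀ n {f} → (∀ i → 0ℚ ≤ f i) → 0ℚ ≤ ∑ n f
  ∑-nonNeg zero    h = ≤-refl
  ∑-nonNeg (suc n) h = 0≤+ (∑-nonNeg n h) (h n)

  ∑-monoⁿ : ∀ {m n f} → (∀ i → 0ℚ ≤ f i) → m ℕ.≤ n → ∑ m f ≤ ∑ n f
  ∑-monoⁿ {m} {zero}  h z≤n = ≤-refl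
  ∑-monoⁿ {m} {suc n} {f} h m≤1+n with ℕₚ.m≤n⇒m<n∨m≡n m≤1+n
  ... | inj₂ refl = ≤-refl
  ... | inj₁ (s≤s m≤n) = ≤-trans (∑-monoⁿ h m≤n) (≤-by (f n) (h n) refl)

  ∑-∣∣ : ∀ n f → ∣ ∑ n f ∣ ≤ ∑ n (λ i → ∣ f i ∣)
  ∑-∣∣ zero    f = ≤-refl
  ∑-∣∣ (suc n) f = ≤-trans (∣p+q∣≤∣p∣+∣q∣ (∑ n f) (f n)) (+-monoˡ-≤ ∣ f n ∣ (∑-∣∣ n f))

  ∑-truncate : ∀ {m n f} → m ℕ.≤ n → (∀ i → m ℕ.≤ i → f i ≡ 0ℚ) → ∑ n f ≡ ∑ m f
  ∑-truncate {m} {zero}  z≤n h = refl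
  ∑-truncate {m} {suc n} m≤1+n h with ℕₚ.m≤n⇒m<n∨m≡n m≤1+n
  ... | inj₂ refl = refl
  ... | inj₁ (s≤s m≤n) = trans (cong₂ _+_ (∑-truncate m≤n h) (h n m≤n)) (+-identityʳ _)

  ∑-product : ∀ m n f g → ∑ m f * ∑ n g ≡ ∑ m (λ i → ∑ n (λ j → f i * g j))
  ∑-product m n f g = trans (sym (∑-*ʳ m (∑ n g) f)) (∑-cong m λ i _ → sym (∑-*ˡ n (f i) g))

  𝟙 : ∀ {a} {A : Set a} → Dec A → ℚ
  𝟙 (yes _) = 1ℚ
  𝟙 (no _)  = 0ℚ

  𝟙-yes : ∀ {a} {A : Set a} (d : Dec A) → A → 𝟙 d ≡ 1ℚ
  𝟙-yes (yes _) a = refl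
  𝟙-yes (no ¬a) a = contradiction a ¬a

  𝟙-no : ∀ {a} {A : Set a} (d : Dec A) → ¬ A → 𝟙 d ≡ 0ℚ
  𝟙-no (yes a) ¬a = contradiction a ¬a
  𝟙-no (no _)  ¬a = refl

  𝟙-cong : ∀ {a b} {A : Set a} {B : Set b} (d : Dec A) (e : Dec B) → (A → B) → (B → A) → 𝟙 d ≡ 𝟙 e
  𝟙-cong (yes a) e f g = sym (𝟙-yes e (f a))
  𝟙-cong (no ¬a) e f g = sym (𝟙-no e (¬a ∘ g))

  -- Lexicographic induction on the block count `k` and the remainder `r`: peeling off the last
  -- index meets a multiple exactly when `r` is 0, and then the previous block is full, with
  -- remainder `d`.
  ∑-multiples : ∀ d k r (F : ℕ → ℚ) → r ℕ.< suc d →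
    ∑ (suc (r ℕ.+ k ℕ.* suc d)) (λ m → 𝟙 (suc d ∣? m) * F m) ≡
    ∑ (suc k) (λ e → F (e ℕ.* suc d))
  ∑-multiples d zero zero F _ = cong (0ℚ +_) (trans
    (cong (_* F 0) (𝟙-yes (suc d ∣? 0) (divides 0 refl))) (*-identityˡ (F 0)))
  ∑-multiples d (suc k) zero F _ = cong₂ _+_ (∑-multiples d k d F ℕₚ.≤-refl) (trans
    (cong (_* F (suc k ℕ.* suc d)) (𝟙-yes (suc d ∣? _) (n∣m*n (suc k)))) (*-identityˡ _))
  ∑-multiples d k (suc r) F r<d = trans
    (cong₂ _+_ (∑-multiples d k r F (ℕₚ.<-trans ℕₚ.≤-refl r<d))
      (trans (cong (_* F (suc r ℕ.+ k ℕ.* suc d)) (𝟙-no (suc d ∣? _) λ h →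
        >⇒∤ r<d (∣m+n∣m⇒∣n (subst (suc d ∣_) (ℕₚ.+-comm (suc r) _) h) (n∣m*n k)))) (*-zeroˡ (F (suc r ℕ.+ k ℕ.* suc d)))))
    (+-identityʳ _)

-- The Möbius function and its divisor sums.

module Moebius where

  open import Data.Nat.Divisibility
    using (_∣_; _∤_; _∣?_; divides; ∣-trans; ∣-refl; n∣m*n; m∣m*n; >⇒∤; ∣⇒≤; 0∣⇒≡0; *-monoʳ-∣)
  open import Data.Nat.DivMod using (_/_; _%_; m≡m%n+[m/n]*n; m%n<n)
  open import Data.Nat.GCD using (gcd; gcd[m,n]∣m; gcd[m,n]∣n; gcd-greatest)
  open import Data.Nat.Coprimality
    using (Coprime; coprime-divisor; coprime?; coprime⇒gcd≡1; gcd≡1⇒coprime)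
  open import Data.Rational.Base hiding (_/_; NonZero)
  open import Function.Base using (_∘_)
  open ℚₚ
  open ≡ using (refl; sym; trans; cong; cong₂; subst)
  open RationalOrder
  open FiniteSums

  open ℚ-Solver.+-*-Solver using (solve; _:=_; _:+_; _:*_; _:-_; :-_; con)

  Minimal : (ℕ → Set) → ℕ → Set
  Minimal P m = P m × (∀ k → k ℕ.< m → ¬ P k)

  minimal-below : ∀ {P} → Decidable P → ∀ b →
    (∃[ m ] m ℕ.< b × Minimal P m) ⊎ (∀ k → k ℕ.< b → ¬ P k)
  minimal-below P? zero = inj₂ λ _ ()
  minimal-below P? (suc b) with minimal-below P? b
  ... | inj₁ (m , m<b , h) = inj₁ (m , ℕₚ.m<n⇒m<1+n m<b , h)
  ... | inj₂ none with P? b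
  ...   | yes p = inj₁ (b , ℕₚ.≤-refl , p , none)
  ...   | no ¬p = inj₂ λ k k<1+b → case-< k (ℕₚ.m≤n⇒m<n∨m≡n (ℕₚ.≤-pred k<1+b))
    where
    case-< : ∀ k → k ℕ.< b ⊎ k ≡ b → ¬ _
    case-< k (inj₁ k<b)  = none k k<b
    case-< k (inj₂ refl) = ¬p

  minimal : ∀ {P} → Decidable P → ∀ {n} → P n → ∃[ m ] m ℕ.≤ n × Minimal P m
  minimal P? {n} p with minimal-below P? (suc n)
  ... | inj₁ (m , s≤s m≤n , h) = m , m≤n , h
  ... | inj₂ none = contradiction p (none n ℕₚ.≤-refl)

  minimal-unique : ∀ {P m n} → Minimal P m → Minimal P n → m ≡ n
  minimal-unique {m = m} {n} (pm , below-m) (pn , below-n) =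
    ℕₚ.≤-antisym (ℕₚ.≮⇒≥ λ n<m → below-m n n<m pn) (ℕₚ.≮⇒≥ λ m<n → below-n m m<n pm)

  NontrivialDivisor : ℕ → ℕ → Set
  NontrivialDivisor n d = 2 ℕ.≤ d × d ∣ n

  nontrivialDivisor? : ∀ n → Decidable (NontrivialDivisor n)
  nontrivialDivisor? n d with 2 ℕₚ.≤? d | d ∣? n
  ... | yes a | yes b = yes (a , b)
  ... | no ¬a | _     = no (¬a ∘ proj₁)
  ... | _     | no ¬b = no (¬b ∘ proj₂)

  LeastFactor : ℕ → ℕ → Set
  LeastFactor n = Minimal (NontrivialDivisor n)

  opaque
    leastFactor : ∀ {n} → 2 ℕ.≤ n → ∃[ p ] LeastFactor n p
    leastFactor {n} 2≤n with minimal (nontrivialDivisor? n) {n} (2≤n , ∣-refl)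
    ... | p , _ , h = p , h

  leastFactor-of-divisor : ∀ {n m p} → LeastFactor n p → m ∣ n → p ∣ m → LeastFactor m p
  leastFactor-of-divisor ((2≤p , _) , least) m∣n p∣m =
    (2≤p , p∣m) , λ k k<p (2≤k , k∣m) → least k k<p (2≤k , ∣-trans k∣m m∣n)

  -- k is fuel: it bounds the number of prime factors still to be split off.
  μ-fuel : ℕ → ℕ → ℚ
  μ-fuel k       0 = 0ℚ
  μ-fuel k       1 = 1ℚ
  μ-fuel zero    (suc (suc n)) = 0ℚ
  μ-fuel (suc k) (suc (suc n)) with leastFactor {suc (suc n)} (s≤s (s≤s z≤n))
  ... | p , (_ , divides e _) , _ with p ∣? e
  ...   | yes _ = 0ℚ
  ...   | no  _ = - μ-fuel k e

  μ : ℕ → ℚ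
  μ n = μ-fuel n n

  quotient-< : ∀ {n e p} → suc n ≡ e ℕ.* p → 2 ℕ.≤ p → e ℕ.< suc n
  quotient-< {n} {zero} eq 2≤p = s≤s z≤n
  quotient-< {n} {suc e} {p} eq 2≤p = subst (suc e ℕ.<_) (sym eq)
    (subst (ℕ._< suc e ℕ.* p) (ℕₚ.*-identityʳ (suc e)) (ℕₚ.*-monoʳ-< (suc e) 2≤p))

  μ-fuel-irrelevant : ∀ k l n → n ℕ.≤ k → n ℕ.≤ l → μ-fuel k n ≡ μ-fuel l n
  μ-fuel-irrelevant k l 0 _ _ = refl
  μ-fuel-irrelevant k l 1 _ _ = refl
  μ-fuel-irrelevant (suc k) (suc l) (suc (suc n)) (s≤s n≤k) (s≤s n≤l)
    with leastFactor {suc (suc n)} (s≤s (s≤s z≤n))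
  ... | p , (2≤p , divides e eq) , _ with p ∣? e
  ...   | yes _ = refl
  ...   | no  _ = cong -_ (μ-fuel-irrelevant k l e
            (ℕₚ.≤-trans e≤n n≤k) (ℕₚ.≤-trans e≤n n≤l))
    where e≤n = ℕₚ.≤-pred (quotient-< {suc n} eq 2≤p)

  -- The least factor is unique, so the factorisation chosen by `μ-fuel` is the given one;
  -- irrelevance of the fuel then restores `μ e`.
  μ-split : ∀ {p e} → 1 ℕ.≤ e → LeastFactor (e ℕ.* p) p →
    (p ∣ e → μ (e ℕ.* p) ≡ 0ℚ) × (p ∤ e → μ (e ℕ.* p) ≡ - μ e)
  μ-split {p} {e} 1≤e lf = helper _ refl
    where
    2≤p = proj₁ (proj₁ lf)
    helper : ∀ n → e ℕ.* p ≡ n → (p ∣ e → μ n ≡ 0ℚ) × (p ∤ e → μ n ≡ - μ e)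
    helper 0 eq = contradiction (subst (1 ℕ.≤_) eq (ℕₚ.*-mono-≤ 1≤e (ℕₚ.<⇒≤ 2≤p))) λ ()
    helper 1 eq = contradiction (subst (2 ℕ.≤_) eq (ℕₚ.*-mono-≤ 1≤e 2≤p)) λ { (s≤s ()) }
    helper (suc (suc n)) eq with leastFactor {suc (suc n)} (s≤s (s≤s z≤n))
    ... | p′ , lf′@((2≤p′ , divides e′ eq′) , _)
      with refl ← minimal-unique lf′ (subst (λ m → LeastFactor m p) eq lf)
      with refl ← ℕₚ.*-cancelʳ-≡ e e′ p {{ℕ.>-nonZero (ℕₚ.<⇒≤ 2≤p)}} (trans eq eq′)
      with p ∣? e
    ...   | yes p∣e = (λ _ → refl) , (λ p∤e → contradiction p∣e p∤e)
    ...   | no  p∤e = (λ p∣e → contradiction p∣e p∤e) , λ _ →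
              cong -_ (μ-fuel-irrelevant (suc n) e e (ℕₚ.≤-pred (quotient-< {suc n} eq′ 2≤p)) ℕₚ.≤-refl)

  ∣μ-fuel∣≤1 : ∀ k n → ∣ μ-fuel k n ∣ ≤ 1ℚ
  ∣μ-fuel∣≤1 k       0 = 0≤1
  ∣μ-fuel∣≤1 k       1 = ≤-refl
  ∣μ-fuel∣≤1 zero    (suc (suc n)) = 0≤1
  ∣μ-fuel∣≤1 (suc k) (suc (suc n)) with leastFactor {suc (suc n)} (s≤s (s≤s z≤n))
  ... | p , (_ , divides e _) , _ with p ∣? e
  ...   | yes _ = 0≤1
  ...   | no  _ = subst (_≤ 1ℚ) (sym (∣-p∣≡∣p∣ (μ-fuel k e))) (∣μ-fuel∣≤1 k e)

  ∣μ∣≤1 : ∀ n → ∣ μ n ∣ ≤ 1ℚ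
  ∣μ∣≤1 n = ∣μ-fuel∣≤1 n n

  module _ {g p} (1≤g : 1 ℕ.≤ g) (lf : LeastFactor g p) where
    private
      p∣g = proj₂ (proj₁ lf)
      2≤p = proj₁ (proj₁ lf)

      -- Minimality takes the place of primality: a common divisor strictly between 1 and `p` would
      -- be a smaller nontrivial divisor of `g`.
      p∤⇒coprime : ∀ {e} → p ∤ e → Coprime p e
      p∤⇒coprime p∤e {d} (d∣p , d∣e) with ℕₚ.m≤n⇒m<n∨m≡n (∣⇒≤ {{ℕ.>-nonZero (ℕₚ.<⇒≤ 2≤p)}} d∣p)
      ... | inj₂ refl = contradiction d∣e p∤e
      p∤⇒coprime p∤e {0} (d∣p , d∣e) | inj₁ d<p =
        contradiction (subst (2 ℕ.≤_) (0∣⇒≡0 d∣p) 2≤p) λ ()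
      p∤⇒coprime p∤e {1} (d∣p , d∣e) | inj₁ d<p = refl
      p∤⇒coprime p∤e {suc (suc d)} (d∣p , d∣e) | inj₁ d<p =
        contradiction (s≤s (s≤s z≤n) , ∣-trans d∣p p∣g) (proj₂ lf _ d<p)

      e*p∣g : ∀ {e} → p ∤ e → e ∣ g → e ℕ.* p ∣ g
      e*p∣g {e} p∤e (divides o eq) = subst (e ℕ.* p ∣_) (trans (ℕₚ.*-comm e o) (sym eq))
        (*-monoʳ-∣ e (coprime-divisor (p∤⇒coprime p∤e) (subst (p ∣_) (trans eq (ℕₚ.*-comm o e)) p∣g)))

      f h : ℕ → ℚ
      f d = 𝟙 (d ∣? g) * μ d
      h d = (1ℚ - 𝟙 (p ∣? d)) * f d

      f≡0 : ∀ {d} → d ∤ g → f d ≡ 0ℚ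
      f≡0 {d} d∤g = trans (cong (_* μ d) (𝟙-no (d ∣? g) d∤g)) (*-zeroˡ (μ d))

      0∤g : 0 ∤ g
      0∤g 0∣g = contradiction (subst (1 ℕ.≤_) (0∣⇒≡0 0∣g) 1≤g) λ ()

      -- If `p` divides `e`, then p² divides e p and μ vanishes. Otherwise μ changes sign on passing
      -- from `e` to e p, and by coprimality both or neither divide `g`.
      f-multiple : ∀ e → f (e ℕ.* p) ≡ - h e
      f-multiple zero = trans (f≡0 0∤g) (sym (cong -_ (trans
        (cong ((1ℚ - 𝟙 (p ∣? 0)) *_) (f≡0 0∤g)) (*-zeroʳ (1ℚ - 𝟙 (p ∣? 0))))))
      f-multiple e@(suc _) with p ∣? e
      ... | yes p∣e = trans fep≡0 (sym (cong -_ (*-zeroˡ (f e))))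
        where
        fep≡0 : f (e ℕ.* p) ≡ 0ℚ
        fep≡0 with e ℕ.* p ∣? g
        ... | yes ep∣g = trans (*-identityˡ _)
                (proj₁ (μ-split (s≤s z≤n) (leastFactor-of-divisor lf ep∣g (n∣m*n e))) p∣e)
        ... | no _     = *-zeroˡ (μ (e ℕ.* p))
      ... | no p∤e with e ∣? g
      ...   | no e∤g = trans (f≡0 λ ep∣g → e∤g (∣-trans (m∣m*n p) ep∣g))
                         (solve 1 (λ x → con 0ℚ := :- ((con 1ℚ :- con 0ℚ) :* (con 0ℚ :* x))) refl (μ e))
      ...   | yes e∣g = trans (cong₂ _*_ (𝟙-yes (e ℕ.* p ∣? g) ep∣g)
                (proj₂ (μ-split (s≤s z≤n) (leastFactor-of-divisor lf ep∣g (n∣m*n e))) p∤e))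
                (solve 1 (λ x → con 1ℚ :* (:- x) := :- ((con 1ℚ :- con 0ℚ) :* (con 1ℚ :* x))) refl (μ e))
        where ep∣g = e*p∣g p∤e e∣g

    -- Divisors are paired as e and e p. The part of `f` off the multiples of `p` is `h`; the part
    -- on the multiples, reindexed by e ↦ e p, is `- h`, and the two cancel. The reindexed sum ends
    -- at n / p, but extends to n by zeros because e p > n ≥ g beyond that.
    ∑-μ-divisors-least : ∀ {n} → g ℕ.≤ n → ∑ (suc n) f ≡ 0ℚ
    ∑-μ-divisors-least {n} g≤n = helper p refl
      where
      helper : ∀ p′ → p ≡ p′ → ∑ (suc n) f ≡ 0ℚ
      helper zero eq = contradiction (subst (2 ℕ.≤_) eq 2≤p) λ ()
      helper p′@(suc d) refl =
        trans (∑-cong (suc n) λ i _ → solve 2 (λ a x → x := (con 1ℚ :- a) :* x :+ a :* x) refl (𝟙 (p ∣? i)) (f i))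
        (trans (∑-+ (suc n) h (λ i → 𝟙 (p ∣? i) * f i))
        (trans (cong (∑ (suc n) h +_) multiples)
        (+-inverseʳ (∑ (suc n) h))))
        where
        k r : ℕ
        k = n / p
        r = n % p
        n≡ : n ≡ r ℕ.+ k ℕ.* p
        n≡ = m≡m%n+[m/n]*n n p
        k≤n : k ℕ.≤ n
        k≤n = subst (k ℕ.≤_) (sym n≡) (ℕₚ.≤-trans (ℕₚ.m≤m*n k p) (ℕₚ.m≤n+m _ r))
        beyond : ∀ e → suc k ℕ.≤ e → f (e ℕ.* p) ≡ 0ℚ
        beyond e k<e = f≡0 (>⇒∤ {{ℕ.>-nonZero 1≤g}} (ℕₚ.≤-<-trans g≤n
          (subst (ℕ._< e ℕ.* p) (sym n≡) (ℕₚ.<-≤-trans (ℕₚ.+-monoˡ-< (k ℕ.* p) (m%n<n n p))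
            (ℕₚ.*-monoˡ-≤ p k<e)))))
        multiples : ∑ (suc n) (λ i → 𝟙 (p ∣? i) * f i) ≡ - ∑ (suc n) h
        multiples =
          trans (cong (λ m → ∑ (suc m) (λ i → 𝟙 (p ∣? i) * f i)) n≡)
          (trans (∑-multiples d k r f (m%n<n n p))
          (trans (sym (∑-truncate {suc k} {suc n} (s≤s k≤n) beyond))
          (trans (∑-cong (suc n) λ e _ → trans (f-multiple e) (neg-is-* (h e)))
          (trans (∑-*ˡ (suc n) (- 1ℚ) h) (sym (neg-is-* (∑ (suc n) h)))))))
          where
          neg-is-* : ∀ x → - x ≡ - 1ℚ * x
          neg-is-* = solve 1 (λ x → :- x := (:- con 1ℚ) :* x) refl

  ∑-μ-divisors : ∀ {g n} → 1 ℕ.≤ g → g ℕ.≤ n →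
    ∑ (suc n) (λ d → 𝟙 (d ∣? g) * μ d) ≡ 𝟙 (g ℕₚ.≟ 1)
  ∑-μ-divisors {suc zero} {suc n} _ _ = trans
    (∑-truncate {2} {suc (suc n)} (s≤s (s≤s z≤n)) λ i 2≤i → trans
      (cong (_* μ i) (𝟙-no (i ∣? 1) (>⇒∤ 2≤i))) (*-zeroˡ (μ i)))
    refl
  ∑-μ-divisors {g@(suc (suc _))} 1≤g g≤n =
    ∑-μ-divisors-least 1≤g (proj₂ (leastFactor {g} (s≤s (s≤s z≤n)))) g≤n

  ∑-μ-commonDivisors : ∀ {p q n} → 1 ℕ.≤ p → p ℕ.≤ n →
    ∑ (suc n) (λ d → 𝟙 (d ∣? p) * 𝟙 (d ∣? q) * μ d) ≡ 𝟙 (coprime? p q)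
  ∑-μ-commonDivisors {p} {q} {n} 1≤p p≤n =
    trans (∑-cong (suc n) λ d _ → cong (_* μ d) (𝟙-gcd d))
    (trans (∑-μ-divisors {g} {n} 1≤g (ℕₚ.≤-trans (∣⇒≤ {{ℕ.>-nonZero 1≤p}} (gcd[m,n]∣m p q)) p≤n))
    (𝟙-cong (g ℕₚ.≟ 1) (coprime? p q) gcd≡1⇒coprime coprime⇒gcd≡1))
    where
    g = gcd p q
    1≤g : 1 ℕ.≤ g
    1≤g with g in eq
    ... | zero  = contradiction (subst (1 ℕ.≤_) (0∣⇒≡0 (subst (_∣ p) eq (gcd[m,n]∣m p q))) 1≤p) λ ()
    ... | suc _ = s≤s z≤n
    𝟙-gcd : ∀ d → 𝟙 (d ∣? p) * 𝟙 (d ∣? q) ≡ 𝟙 (d ∣? g)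
    𝟙-gcd d with d ∣? p | d ∣? q
    ... | yes a | yes b = sym (𝟙-yes (d ∣? g) (gcd-greatest a b))
    ... | no ¬a | w     = trans (*-zeroˡ (𝟙 w)) (sym (𝟙-no (d ∣? g) λ h → ¬a (∣-trans h (gcd[m,n]∣m p q))))
    ... | yes _ | no ¬b = trans (*-zeroʳ 1ℚ) (sym (𝟙-no (d ∣? g) λ h → ¬b (∣-trans h (gcd[m,n]∣n p q))))

-- The sum of p q over coprime pairs, compared with n⁴ / (4 ζ(2)).

module CoprimeSums where

  open import Data.Nat.Divisibility using (_∣_; _∣?_)
  open import Data.Nat.DivMod using (m≡m%n+[m/n]*n; m%n<n)
  open import Data.Nat.Coprimality using (coprime?)
  open import Data.Rational.Base
  open ℚₚ
  open ≡ using (refl; sym; trans; cong; cong₂; subst; subst₂)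
  open RationalOrder
  open FiniteSums
  open Moebius

  open ℚ-Solver.+-*-Solver using (solve; _:=_; _:+_; _:*_; _:-_; :-_; con)

  2ℚ 3ℚ 4ℚ 8ℚ : ℚ
  2ℚ = ℤ.+ 2 / 1
  3ℚ = ℤ.+ 3 / 1
  4ℚ = ℤ.+ 4 / 1
  8ℚ = ℤ.+ 8 / 1

  0≤2 : 0ℚ ≤ 2ℚ
  0≤2 = nonNegative⁻¹ 2ℚ

  rec : ℕ → ℚ
  rec zero    = 0ℚ
  rec (suc n) = 1/ n +1

  rec² : ℕ → ℚ
  rec² n = rec n * rec n

  0≤rec : ∀ n → 0ℚ ≤ rec n
  0≤rec zero    = ≤-refl
  0≤rec (suc n) = <⇒≤ (0<1/+1 n)

  0≤rec² : ∀ n → 0ℚ ≤ rec² n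
  0≤rec² n = 0≤* (0≤rec n) (0≤rec n)

  *-rec : ∀ {n} → 1 ℕ.≤ n → ⟦ n ⟧ * rec n ≡ 1ℚ
  *-rec {suc n} _ = 1/+1-* n

  0<⟦⟧ : ∀ {n} → 1 ℕ.≤ n → 0ℚ < ⟦ n ⟧
  0<⟦⟧ {suc n} _ = 0<⟦suc⟧ n

  -- Junk values: rec 0 = 0, so the sums may start at index 0.
  H Z M : ℕ → ℚ
  H n = ∑ (suc n) rec
  Z n = ∑ (suc n) rec²
  M n = ∑ (suc n) (λ d → μ d * rec² d)

  S : ℕ → ℚ
  S n = ∑ (suc n) λ p → ∑ (suc n) λ q → 𝟙 (coprime? p q) * (⟦ p ⟧ * ⟦ q ⟧)

  A : ℕ → ℕ → ℚ
  A n d = ∑ (suc n) λ p → 𝟙 (d ∣? p) * ⟦ p ⟧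

  S-inversion : ∀ n → S n ≡ ∑ (suc n) (λ d → μ d * (A n d * A n d))
  S-inversion n =
    trans (∑-cong (suc n) λ p p≤n → ∑-cong (suc n) λ q _ → expand p q (ℕₚ.≤-pred p≤n))
    (trans (∑-cong (suc n) λ p _ → ∑-swap (suc n) (suc n) (λ q d → μ d * (a d p * a d q)))
    (trans (∑-swap (suc n) (suc n) (λ p d → ∑ (suc n) λ q → μ d * (a d p * a d q)))
    (∑-cong (suc n) λ d _ →
      trans (∑-cong (suc n) λ p _ → ∑-*ˡ (suc n) (μ d) (λ q → a d p * a d q))
      (trans (∑-*ˡ (suc n) (μ d) (λ p → ∑ (suc n) λ q → a d p * a d q))
      (cong (μ d *_) (sym (∑-product (suc n) (suc n) (a d) (a d))))))))
    where
    a : ℕ → ℕ → ℚ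
    a d p = 𝟙 (d ∣? p) * ⟦ p ⟧
    rearrange : ∀ p q d →
      𝟙 (d ∣? p) * 𝟙 (d ∣? q) * μ d * (⟦ p ⟧ * ⟦ q ⟧) ≡ μ d * (a d p * a d q)
    rearrange p q d = solve 5 (λ x y m p q → x :* y :* m :* (p :* q) := m :* ((x :* p) :* (y :* q)))
      refl (𝟙 (d ∣? p)) (𝟙 (d ∣? q)) (μ d) ⟦ p ⟧ ⟦ q ⟧
    expand′ : ∀ p q c → c * (⟦ p ⟧ * ⟦ q ⟧) ≡
      ∑ (suc n) (λ d → 𝟙 (d ∣? p) * 𝟙 (d ∣? q) * μ d) * (⟦ p ⟧ * ⟦ q ⟧) →
      c * (⟦ p ⟧ * ⟦ q ⟧) ≡ ∑ (suc n) (λ d → μ d * (a d p * a d q))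
    expand′ p q c eq = trans eq (trans
      (sym (∑-*ʳ (suc n) (⟦ p ⟧ * ⟦ q ⟧) (λ d → 𝟙 (d ∣? p) * 𝟙 (d ∣? q) * μ d)))
      (∑-cong (suc n) λ d _ → rearrange p q d))
    expand : ∀ p q → p ℕ.≤ n →
      𝟙 (coprime? p q) * (⟦ p ⟧ * ⟦ q ⟧) ≡ ∑ (suc n) (λ d → μ d * (a d p * a d q))
    expand zero q _ = expand′ 0 q (𝟙 (coprime? 0 q)) (subst
      (λ z → 𝟙 (coprime? 0 q) * (z * ⟦ q ⟧) ≡ B * (z * ⟦ q ⟧)) (sym ⟦0⟧)
      (solve 3 (λ c b q → c :* (con 0ℚ :* q) := b :* (con 0ℚ :* q)) refl (𝟙 (coprime? 0 q)) B ⟦ q ⟧))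
      where B = ∑ (suc n) (λ d → 𝟙 (d ∣? 0) * 𝟙 (d ∣? q) * μ d)
    expand (suc p) q p<n = expand′ (suc p) q (𝟙 (coprime? (suc p) q))
      (cong (_* (⟦ suc p ⟧ * ⟦ q ⟧)) (sym (∑-μ-commonDivisors (s≤s z≤n) p<n)))

  ∑-⟦⟧ : ∀ k → 2ℚ * ∑ (suc k) ⟦_⟧ ≡ ⟦ k ⟧ * (⟦ k ⟧ + 1ℚ)
  ∑-⟦⟧ zero = subst (λ z → 2ℚ * (0ℚ + z) ≡ z * (z + 1ℚ)) (sym ⟦0⟧) refl
  ∑-⟦⟧ (suc k) = trans (*-distribˡ-+ 2ℚ (∑ (suc k) ⟦_⟧) ⟦ suc k ⟧)
    (trans (cong (_+ 2ℚ * ⟦ suc k ⟧) (∑-⟦⟧ k))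
    (subst (λ z → ⟦ k ⟧ * (⟦ k ⟧ + 1ℚ) + 2ℚ * z ≡ z * (z + 1ℚ)) (sym (⟦⟧-suc k))
    (solve 1 (λ k → k :* (k :+ con 1ℚ) :+ con 2ℚ :* (con 1ℚ :+ k) :=
       (con 1ℚ :+ k) :* ((con 1ℚ :+ k) :+ con 1ℚ)) refl ⟦ k ⟧)))

  module Multiples (n d : ℕ) (d<n : suc d ℕ.≤ n) where
    k r : ℕ
    k = n ℕ./ suc d
    r = n ℕ.% suc d

    n≡ : n ≡ r ℕ.+ k ℕ.* suc d
    n≡ = m≡m%n+[m/n]*n n (suc d)

    r<d : r ℕ.< suc d
    r<d = m%n<n n (suc d)

    D K R N : ℚ
    D = ⟦ suc d ⟧
    K = ⟦ k ⟧
    R = ⟦ r ⟧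
    N = ⟦ n ⟧

    0≤D : 0ℚ ≤ D
    0≤D = 0≤⟦⟧ (suc d)
    0≤N : 0ℚ ≤ N
    0≤N = 0≤⟦⟧ n
    D≤N : D ≤ N
    D≤N = ⟦⟧-mono-≤ d<n
    R≤D : R ≤ D
    R≤D = ⟦⟧-mono-≤ (ℕₚ.<⇒≤ r<d)

    N≡ : N ≡ R + K * D
    N≡ = trans (cong ⟦_⟧ n≡) (trans (⟦⟧-+ r _) (cong (R +_) (⟦⟧-* k (suc d))))

    1≤k : 1 ℕ.≤ k
    1≤k = ℕₚ.≮⇒≥ λ { (s≤s k≤0) → ℕₚ.<-irrefl refl (ℕₚ.<-≤-trans r<d (ℕₚ.≤-trans d<n
      (ℕₚ.≤-reflexive (trans n≡ (trans (cong (λ k → r ℕ.+ k ℕ.* suc d) (ℕₚ.n≤0⇒n≡0 k≤0))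
        (ℕₚ.+-identityʳ r)))))) }

    ∑-multiples-of : ∀ (F : ℕ → ℚ) →
      ∑ (suc n) (λ m → 𝟙 (suc d ∣? m) * F m) ≡ ∑ (suc k) (λ e → F (e ℕ.* suc d))
    ∑-multiples-of F = trans
      (cong (λ n → ∑ (suc n) (λ m → 𝟙 (suc d ∣? m) * F m)) n≡) (∑-multiples d k r F r<d)

    A-closed : 2ℚ * D * A n (suc d) ≡ (K * D) * (K * D + D)
    A-closed = trans
      (cong (2ℚ * D *_) (trans (∑-multiples-of ⟦_⟧)
        (trans (∑-cong (suc k) λ e _ → ⟦⟧-* e (suc d)) (∑-*ʳ (suc k) D ⟦_⟧))))
      (trans (solve 3 (λ t d s → t :* d :* (s :* d) := d :* d :* (t :* s)) refl 2ℚ D (∑ (suc k) ⟦_⟧))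
      (trans (cong (D * D *_) (∑-⟦⟧ k))
      (solve 2 (λ d k → d :* d :* (k :* (k :+ con 1ℚ)) := (k :* d) :* (k :* d :+ d)) refl D K)))

    -- By `A-closed` the first term is K D (K D + D), and N = R + K D with 0 ≤ R ≤ D. Both slacks
    -- are then sums of products of nonnegative quantities.
    A-approx : ∣ 2ℚ * D * A n (suc d) - N * N ∣ ≤ N * D
    A-approx = subst (λ z → ∣ z - N * N ∣ ≤ N * D) (sym A-closed) (∣p-q∣≤ ((K * D) * (K * D + D)) (N * N)
      (≤-by (R * (K * D) + N * R + D * R) (0≤+ (0≤+ (0≤* 0≤R 0≤KD) (0≤* 0≤N 0≤R)) (0≤* 0≤D 0≤R))
        (subst (λ N → K * D * (K * D + D) + (R * (K * D) + N * R + D * R) ≡ N * N + N * D) (sym N≡)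
          (solve 3 (λ r k d → k :* d :* (k :* d :+ d) :+ (r :* (k :* d) :+ (r :+ k :* d) :* r :+ d :* r)
            := (r :+ k :* d) :* (r :+ k :* d) :+ (r :+ k :* d) :* d) refl R K D)))
      (≤-by ((D - R) * (K * D) + N * (D - R)) (0≤+ (0≤* 0≤D-R 0≤KD) (0≤* 0≤N 0≤D-R))
        (subst (λ N → N * N + ((D - R) * (K * D) + N * (D - R)) ≡ K * D * (K * D + D) + N * D)
          (sym N≡)
          (solve 3 (λ r k d → (r :+ k :* d) :* (r :+ k :* d) :+
              ((d :- r) :* (k :* d) :+ (r :+ k :* d) :* (d :- r))
            := k :* d :* (k :* d :+ d) :+ (r :+ k :* d) :* d) refl R K D))))
      where
      0≤R = 0≤⟦⟧ r
      0≤KD = 0≤* (0≤⟦⟧ k) 0≤D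
      0≤D-R = 0≤-diff R≤D

    ρ : ℚ
    ρ = rec (suc d)

    Dρ≡1 : D * ρ ≡ 1ℚ
    Dρ≡1 = 1/+1-* d

    0≤ρ : 0ℚ ≤ ρ
    0≤ρ = 0≤rec (suc d)

    -- Since D ρ = 1, the difference equals ρ² (2 D A - N²) (2 D A + N²). The first bracket is at
    -- most N D by `A-approx`, and the second at most 3 N² because D ≤ N.
    A²-approx : ∣ 4ℚ * (A n (suc d) * A n (suc d)) - N * N * N * N * (ρ * ρ) ∣ ≤ 3ℚ * (N * N * N) * ρ
    A²-approx = begin
      ∣ 4ℚ * (a * a) - N * N * N * N * (ρ * ρ) ∣
        ≡⟨ cong ∣_∣ scaled ⟩
      ∣ ρ * ρ * ((2ℚ * D * a - N * N) * (2ℚ * D * a + N * N)) ∣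
        ≡⟨ trans (∣p*q∣≡∣p∣*∣q∣ (ρ * ρ) _) (cong₂ _*_ (0≤p⇒∣p∣≡p (0≤* 0≤ρ 0≤ρ))
             (∣p*q∣≡∣p∣*∣q∣ (2ℚ * D * a - N * N) (2ℚ * D * a + N * N))) ⟩
      ρ * ρ * (∣ 2ℚ * D * a - N * N ∣ * ∣ 2ℚ * D * a + N * N ∣)
        ≤⟨ *-monoˡ-≤ (ρ * ρ) (0≤* 0≤ρ 0≤ρ)
             (*-mono-≤ (0≤∣p∣ (2ℚ * D * a - N * N)) A-approx
               (0≤∣p∣ (2ℚ * D * a + N * N)) sum-bound) ⟩
      ρ * ρ * (N * D * (3ℚ * (N * N)))
        ≡⟨ solve 3 (λ ρ d n → ρ :* ρ :* (n :* d :* (con 3ℚ :* (n :* n))) :=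
             (d :* ρ) :* (con 3ℚ :* (n :* n :* n) :* ρ)) refl ρ D N ⟩
      (D * ρ) * (3ℚ * (N * N * N) * ρ)
        ≡⟨ trans (cong (_* (3ℚ * (N * N * N) * ρ)) Dρ≡1) (*-identityˡ _) ⟩
      3ℚ * (N * N * N) * ρ ∎
      where
      open ≤-Reasoning
      a : ℚ
      a = A n (suc d)
      scaled : 4ℚ * (a * a) - N * N * N * N * (ρ * ρ) ≡
        ρ * ρ * ((2ℚ * D * a - N * N) * (2ℚ * D * a + N * N))
      scaled = trans
        (subst (λ u → 4ℚ * (a * a) - N * N * N * N * (ρ * ρ) ≡
                      u * u * (4ℚ * (a * a)) - N * N * N * N * (ρ * ρ)) (sym Dρ≡1)
          (solve 2 (λ x y → x :- y := con 1ℚ :* con 1ℚ :* x :- y) refl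
            (4ℚ * (a * a)) (N * N * N * N * (ρ * ρ))))
        (solve 4 (λ a n ρ d →
            (d :* ρ) :* (d :* ρ) :* (con 4ℚ :* (a :* a)) :- n :* n :* n :* n :* (ρ :* ρ) :=
            ρ :* ρ :* ((con 2ℚ :* d :* a :- n :* n) :* (con 2ℚ :* d :* a :+ n :* n)))
          refl a N ρ D)
      sum-bound : ∣ 2ℚ * D * a + N * N ∣ ≤ 3ℚ * (N * N)
      sum-bound = begin
        ∣ 2ℚ * D * a + N * N ∣
          ≡⟨ cong ∣_∣ (solve 2 (λ x y → x :+ y := (x :- y) :+ con 2ℚ :* y) refl (2ℚ * D * a) (N * N)) ⟩
        ∣ (2ℚ * D * a - N * N) + 2ℚ * (N * N) ∣
          ≤⟨ ∣p+q∣≤∣p∣+∣q∣ (2ℚ * D * a - N * N) (2ℚ * (N * N)) ⟩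
        ∣ 2ℚ * D * a - N * N ∣ + ∣ 2ℚ * (N * N) ∣
          ≤⟨ +-mono-≤ (≤-trans A-approx (*-monoˡ-≤ N 0≤N D≤N))
               (≤-reflexive (0≤p⇒∣p∣≡p (0≤* 0≤2 (0≤* 0≤N 0≤N)))) ⟩
        N * N + 2ℚ * (N * N)
          ≡⟨ solve 1 (λ n → n :* n :+ con 2ℚ :* (n :* n) := con 3ℚ :* (n :* n)) refl N ⟩
        3ℚ * (N * N) ∎

  rec-* : ∀ m n → rec (m ℕ.* n) ≡ rec m * rec n
  rec-* zero    n       = sym (*-zeroˡ (rec n))
  rec-* (suc m) zero    = trans (cong rec (ℕₚ.*-zeroʳ m)) (sym (*-zeroʳ (rec (suc m))))
  rec-* (suc m) (suc n) = begin-equality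
    rec mn                                             ≡⟨ *-identityˡ (rec mn) ⟨
    1ℚ * rec mn
      ≡⟨ cong₂ (λ a b → a * b * rec mn) (1/+1-* m) (1/+1-* n) ⟨
    ⟦ suc m ⟧ * rec (suc m) * (⟦ suc n ⟧ * rec (suc n)) * rec mn
      ≡⟨ solve 5 (λ m r n s t → m :* r :* (n :* s) :* t := (m :* n :* t) :* (r :* s)) refl
           ⟦ suc m ⟧ (rec (suc m)) ⟦ suc n ⟧ (rec (suc n)) (rec mn) ⟩
    ⟦ suc m ⟧ * ⟦ suc n ⟧ * rec mn * (rec (suc m) * rec (suc n))
      ≡⟨ cong (λ z → z * rec mn * (rec (suc m) * rec (suc n))) (⟦⟧-* (suc m) (suc n)) ⟨
    ⟦ mn ⟧ * rec mn * (rec (suc m) * rec (suc n))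
      ≡⟨ cong (_* (rec (suc m) * rec (suc n))) (1/+1-* _) ⟩
    1ℚ * (rec (suc m) * rec (suc n))                   ≡⟨ *-identityˡ _ ⟩
    rec (suc m) * rec (suc n)                          ∎
    where
    open ≤-Reasoning
    mn = suc m ℕ.* suc n

  rec-1 : rec 1 ≡ 1ℚ
  rec-1 = trans (sym (*-identityˡ (rec 1))) (trans (cong (_* rec 1) (sym ⟦1⟧)) (1/+1-* 0))

  rec-telescope : ∀ n → rec (suc n) ≡ rec (suc n) * rec (suc (suc n)) + rec (suc (suc n))
  rec-telescope n = begin-equality
    a                       ≡⟨ solve 1 (λ a → a := a :* con 1ℚ) refl a ⟩
    a * 1ℚ                  ≡⟨ cong (a *_) (1/+1-* (suc n)) ⟨
    a * (⟦ suc (suc n) ⟧ * b) ≡⟨ cong (λ z → a * (z * b)) (⟦⟧-suc (suc n)) ⟩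
    a * ((1ℚ + ⟦ suc n ⟧) * b)
      ≡⟨ solve 3 (λ a b n → a :* ((con 1ℚ :+ n) :* b) := a :* b :+ (n :* a) :* b) refl a b ⟦ suc n ⟧ ⟩
    a * b + (⟦ suc n ⟧ * a) * b ≡⟨ cong (λ z → a * b + z * b) (1/+1-* n) ⟩
    a * b + 1ℚ * b          ≡⟨ cong (a * b +_) (*-identityˡ b) ⟩
    a * b + b               ∎
    where
    open ≤-Reasoning
    a = rec (suc n)
    b = rec (suc (suc n))

  rec-antitone : ∀ n → rec (suc (suc n)) ≤ rec (suc n)
  rec-antitone n = ≤-by (rec (suc n) * rec (suc (suc n)))
    (0≤* (0≤rec (suc n)) (0≤rec (suc (suc n))))
    (trans (+-comm (rec (suc (suc n))) _) (sym (rec-telescope n)))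

  rec²+rec≤rec : ∀ n → rec² (suc (suc n)) + rec (suc (suc n)) ≤ rec (suc n)
  rec²+rec≤rec n = subst (rec² (suc (suc n)) + rec (suc (suc n)) ≤_) (sym (rec-telescope n))
    (+-monoˡ-≤ (rec (suc (suc n))) (*-monoʳ-≤ (rec (suc (suc n))) (0≤rec (suc (suc n))) (rec-antitone n)))

  -- Together with `Z-mono` this confines all later partial sums to the interval from `Z k` to
  -- `Z k + rec k`; a step telescopes through 1/(n + 1)² ≤ 1/n - 1/(n + 1).
  Z-decreasing : ∀ j k → Z (j ℕ.+ suc k) + rec (j ℕ.+ suc k) ≤ Z (suc k) + rec (suc k)
  Z-decreasing zero k = ≤-refl
  Z-decreasing (suc j) k = ≤-trans
    (subst (λ m → Z (suc m) + rec (suc m) ≤ Z m + rec m) (sym (ℕₚ.+-suc j k))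
      (≤-trans (≤-reflexive (+-assoc (Z (suc (j ℕ.+ k))) _ _))
        (+-monoʳ-≤ (Z (suc (j ℕ.+ k))) (rec²+rec≤rec (j ℕ.+ k)))))
    (Z-decreasing j k)

  Z-mono : ∀ {k n} → k ℕ.≤ n → Z k ≤ Z n
  Z-mono k≤n = ∑-monoⁿ 0≤rec² (s≤s k≤n)

  Z-upper : ∀ {k n} → 1 ℕ.≤ k → k ℕ.≤ n → Z n ≤ Z k + rec k
  Z-upper {suc k} {n} _ k<n = ≤-trans
    (≤-by (rec n) (0≤rec n) refl)
    (subst (λ m → Z m + rec m ≤ Z (suc k) + rec (suc k)) (ℕₚ.m∸n+n≡m k<n)
      (Z-decreasing (n ℕ.∸ suc k) k))

  Z-1 : Z 1 ≡ 1ℚ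
  Z-1 = subst (λ z → 0ℚ + 0ℚ * 0ℚ + z * z ≡ 1ℚ) (sym rec-1) refl

  Z≤2 : ∀ {n} → 1 ℕ.≤ n → Z n ≤ 2ℚ
  Z≤2 1≤n = ≤-trans (Z-upper ℕₚ.≤-refl 1≤n) (≤-reflexive (cong₂ _+_ Z-1 rec-1))

  1≤Z : ∀ {n} → 1 ℕ.≤ n → 1ℚ ≤ Z n
  1≤Z {n} 1≤n = subst (_≤ Z n) Z-1 (Z-mono 1≤n)

  B : ℕ → ℕ → ℚ
  B n d = ∑ (suc n) λ m → 𝟙 (d ∣? m) * rec² m

  -- After exchanging the sums, the inner one is Σ μ(d) over d ∣ m, which singles out m = 1. This is
  -- a finite form of ζ(2) Σ μ(d)/d² = 1, because `B n d` is close to `rec² d * Z n`.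
  M-inversion : ∀ {n} → 1 ℕ.≤ n → ∑ (suc n) (λ d → μ d * B n d) ≡ 1ℚ
  M-inversion {n@(suc n′)} 1≤n =
    trans (∑-cong (suc n) λ d _ → sym (∑-*ˡ (suc n) (μ d) (λ m → 𝟙 (d ∣? m) * rec² m)))
    (trans (∑-swap (suc n) (suc n) (λ d m → μ d * (𝟙 (d ∣? m) * rec² m)))
    (trans (∑-cong (suc n) λ m m≤n → inner m (ℕₚ.≤-pred m≤n))
    (trans (∑-truncate {2} {suc n} (s≤s (s≤s z≤n)) λ i 2≤i → trans
        (cong (_* rec² i) (𝟙-no (i ℕₚ.≟ 1) λ i≡1 → ℕₚ.<-irrefl (sym i≡1) 2≤i)) (*-zeroˡ (rec² i)))
    (subst (λ z → 0ℚ + 0ℚ * (0ℚ * 0ℚ) + 1ℚ * (z * z) ≡ 1ℚ) (sym rec-1) refl))))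
    where
    inner : ∀ m → m ℕ.≤ n →
      ∑ (suc n) (λ d → μ d * (𝟙 (d ∣? m) * rec² m)) ≡ 𝟙 (m ℕₚ.≟ 1) * rec² m
    inner m m≤n = trans
      (trans (∑-cong (suc n) λ d _ →
          solve 3 (λ a b c → a :* (b :* c) := b :* a :* c) refl (μ d) (𝟙 (d ∣? m)) (rec² m))
        (∑-*ʳ (suc n) (rec² m) (λ d → 𝟙 (d ∣? m) * μ d)))
      (factor m m≤n)
      where
      factor : ∀ m → m ℕ.≤ n →
        ∑ (suc n) (λ d → 𝟙 (d ∣? m) * μ d) * rec² m ≡ 𝟙 (m ℕₚ.≟ 1) * rec² m
      factor zero    _   = trans (*-zeroʳ (∑ (suc n) (λ d → 𝟙 (d ∣? 0) * μ d))) (sym (*-zeroʳ (𝟙 (0 ℕₚ.≟ 1))))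
      factor (suc m) m<n = cong (_* rec² (suc m)) (∑-μ-divisors (s≤s z≤n) m<n)

  module _ {n d : ℕ} (d<n : suc d ℕ.≤ n) where
    open Multiples n d d<n

    B-closed : B n (suc d) ≡ rec² (suc d) * Z k
    B-closed = trans (∑-multiples-of rec²) (trans
      (∑-cong (suc k) λ e _ → trans (cong₂ _*_ (rec-* e (suc d)) (rec-* e (suc d)))
        (solve 2 (λ e d → (e :* d) :* (e :* d) := (d :* d) :* (e :* e)) refl (rec e) (rec (suc d))))
      (∑-*ˡ (suc k) (rec² (suc d)) rec²))

    -- The factor 2 arises from n = r + k (d + 1) with r < d + 1 ≤ k (d + 1), so that n ≤ 2 k (d +
    -- 1).
    rec-product : rec (suc d) * rec k ≤ 2ℚ * rec n
    rec-product = *-cancelˡ-≤ N (0<⟦⟧ 1≤n) (begin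
      N * (ρ * rec k)                     ≤⟨ *-monoʳ-≤ (ρ * rec k) (0≤* 0≤ρ (0≤rec k)) N≤2KD ⟩
      2ℚ * (K * D) * (ρ * rec k)
        ≡⟨ solve 4 (λ k d r s → con 2ℚ :* (k :* d) :* (r :* s) := con 2ℚ :* ((d :* r) :* (k :* s)))
             refl K D ρ (rec k) ⟩
      2ℚ * ((D * ρ) * (K * rec k))        ≡⟨ cong₂ (λ a b → 2ℚ * (a * b)) Dρ≡1 (*-rec 1≤k) ⟩
      2ℚ * (1ℚ * 1ℚ)                      ≡⟨ cong (2ℚ *_) (*-rec 1≤n) ⟨
      2ℚ * (N * rec n)                    ≡⟨ solve 2 (λ a b → con 2ℚ :* (a :* b) := a :* (con 2ℚ :* b)) refl N (rec n) ⟩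
      N * (2ℚ * rec n)                    ∎)
      where
      open ≤-Reasoning
      1≤n = ℕₚ.≤-trans (s≤s z≤n) d<n
      D≤KD : D ≤ K * D
      D≤KD = subst (_≤ K * D) (*-identityˡ D)
        (*-monoʳ-≤ D 0≤D (subst (_≤ K) ⟦1⟧ (⟦⟧-mono-≤ 1≤k)))
      N≤2KD : N ≤ 2ℚ * (K * D)
      N≤2KD = subst₂ _≤_ (sym N≡) (solve 1 (λ x → x :+ x := con 2ℚ :* x) refl (K * D))
        (+-monoˡ-≤ (K * D) (≤-trans R≤D D≤KD))

    -- In `B-closed`, replacing `Z k` by any later `Z m` costs at most 1/k, and 1/k times 1/(d + 1)
    -- is at most 2/n.
    B-approx : ∀ {m} → n ℕ.≤ m → ∣ B n (suc d) - rec² (suc d) * Z m ∣ ≤ 2ℚ * rec n * rec (suc d)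
    B-approx {m} n≤m = subst (λ b → ∣ b - ρ * ρ * Z m ∣ ≤ 2ℚ * rec n * ρ) (sym B-closed)
      (∣p-q∣≤ (ρ * ρ * Z k) (ρ * ρ * Z m)
        (≤-trans (*-monoˡ-≤ (ρ * ρ) 0≤ρ² (Z-mono k≤m)) (≤-by (2ℚ * rec n * ρ) 0≤c refl))
        (begin
          ρ * ρ * Z m                    ≤⟨ *-monoˡ-≤ (ρ * ρ) 0≤ρ² (Z-upper 1≤k k≤m) ⟩
          ρ * ρ * (Z k + rec k)
            ≡⟨ solve 3 (λ r z s → r :* r :* (z :+ s) := r :* r :* z :+ (r :* s) :* r) refl ρ (Z k) (rec k) ⟩
          ρ * ρ * Z k + (ρ * rec k) * ρ  ≤⟨ +-monoʳ-≤ (ρ * ρ * Z k) (*-monoʳ-≤ ρ 0≤ρ rec-product) ⟩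
          ρ * ρ * Z k + 2ℚ * rec n * ρ   ∎))
      where
      open ≤-Reasoning
      0≤ρ² = 0≤* 0≤ρ 0≤ρ
      0≤c = 0≤* (0≤* 0≤2 (0≤rec n)) 0≤ρ
      k≤m = ℕₚ.≤-trans (ℕₚ.≤-trans (ℕₚ.m≤m*n k (suc d)) (ℕₚ.≤-trans (ℕₚ.m≤n+m _ r) (ℕₚ.≤-reflexive (sym n≡)))) n≤m

  ∑-μ-bound : ∀ n c (x : ℕ → ℚ) → (∀ d → suc d ℕ.≤ n → ∣ x (suc d) ∣ ≤ c * rec (suc d)) →
    ∣ ∑ (suc n) (λ d → μ d * x d) ∣ ≤ c * H n
  ∑-μ-bound n c x bound = ≤-trans (∑-∣∣ (suc n) (λ d → μ d * x d)) (≤-trans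
    (∑-mono (suc n) λ d d≤n → term d (ℕₚ.≤-pred d≤n)) (≤-reflexive (∑-*ˡ (suc n) c rec)))
    where
    term : ∀ d → d ℕ.≤ n → ∣ μ d * x d ∣ ≤ c * rec d
    -- The term at 0 vanishes through `μ 0`, whatever `x 0` is.
    term zero _ = ≤-reflexive (trans (cong ∣_∣ (*-zeroˡ (x 0))) (sym (*-zeroʳ c)))
    term (suc d) d<n = begin
      ∣ μ (suc d) * x (suc d) ∣        ≡⟨ ∣p*q∣≡∣p∣*∣q∣ (μ (suc d)) (x (suc d)) ⟩
      ∣ μ (suc d) ∣ * ∣ x (suc d) ∣    ≤⟨ *-monoʳ-≤ ∣ x (suc d) ∣ (0≤∣p∣ (x (suc d))) (∣μ∣≤1 (suc d)) ⟩
      1ℚ * ∣ x (suc d) ∣               ≡⟨ *-identityˡ _ ⟩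
      ∣ x (suc d) ∣                    ≤⟨ bound d d<n ⟩
      c * rec (suc d)                  ∎
      where open ≤-Reasoning

  ∑-μ-difference : ∀ n c (x y : ℕ → ℚ) →
    ∑ (suc n) (λ d → μ d * (x d - c * y d)) ≡ ∑ (suc n) (λ d → μ d * x d) - c * ∑ (suc n) (λ d → μ d * y d)
  ∑-μ-difference n c x y =
    trans (∑-cong (suc n) λ d _ →
      solve 4 (λ m x c y → m :* (x :- c :* y) := m :* x :+ (:- c) :* (m :* y)) refl (μ d) (x d) c (y d))
    (trans (∑-+ (suc n) (λ d → μ d * x d) (λ d → (- c) * (μ d * y d)))
    (trans (cong (∑ (suc n) (λ d → μ d * x d) +_) (∑-*ˡ (suc n) (- c) (λ d → μ d * y d)))
    (solve 3 (λ a c b → a :+ (:- c) :* b := a :- c :* b) refl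
      (∑ (suc n) (λ d → μ d * x d)) c (∑ (suc n) (λ d → μ d * y d)))))

  -- `M-inversion` writes 1 as a sum of `μ d * B n d`, so the difference becomes one sum of
  -- `μ d * (B n d - Z m * rec² d)`, to which `B-approx` applies termwise.
  Z*M-approx : ∀ {n m} → 1 ℕ.≤ n → n ℕ.≤ m → ∣ 1ℚ - Z m * M n ∣ ≤ 2ℚ * rec n * H n
  Z*M-approx {n} {m} 1≤n n≤m = subst (λ z → ∣ z ∣ ≤ 2ℚ * rec n * H n)
    (trans (∑-μ-difference n (Z m) (B n) rec²) (cong (_- Z m * M n) (M-inversion 1≤n)))
    (∑-μ-bound n (2ℚ * rec n) (λ d → B n d - Z m * rec² d) λ d d<n →
      subst (λ z → ∣ B n (suc d) - z ∣ ≤ 2ℚ * rec n * rec (suc d)) (*-comm (rec² (suc d)) (Z m))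
        (B-approx d<n n≤m))

  4S-approx : ∀ n → let N = ⟦ n ⟧ in ∣ 4ℚ * S n - N * N * N * N * M n ∣ ≤ 3ℚ * (N * N * N) * H n
  4S-approx n = subst (λ z → ∣ z ∣ ≤ 3ℚ * (N * N * N) * H n)
    (trans (∑-μ-difference n (N * N * N * N) (λ d → 4ℚ * (A n d * A n d)) rec²)
      (cong (_- N * N * N * N * M n) (trans
        (∑-cong (suc n) λ d _ → solve 2 (λ m a → m :* (con 4ℚ :* a) := con 4ℚ :* (m :* a)) refl (μ d) (A n d * A n d))
        (trans (∑-*ˡ (suc n) 4ℚ (λ d → μ d * (A n d * A n d))) (cong (4ℚ *_) (sym (S-inversion n)))))))
    (∑-μ-bound n (3ℚ * (N * N * N)) (λ d → 4ℚ * (A n d * A n d) - N * N * N * N * rec² d)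
      λ d d<n → Multiples.A²-approx n d d<n)
    where N = ⟦ n ⟧

  -- The difference is Z (4 S - N⁴ M) - N⁴ (1 - Z M). With Z ≤ 2 and N · (1/N) = 1, the constant is
  -- 8 = 2 · 3 + 2.
  S-approx : ∀ {n m} → 1 ℕ.≤ n → n ℕ.≤ m → let N = ⟦ n ⟧ in
    ∣ 4ℚ * Z m * S n - N * N * N * N ∣ ≤ 8ℚ * (N * N * N) * H n
  S-approx {n} {m} 1≤n n≤m = begin
    ∣ 4ℚ * Z m * S n - N⁴ ∣
      ≡⟨ cong ∣_∣ (solve 4 (λ z s n m → con 4ℚ :* z :* s :- n :=
           z :* (con 4ℚ :* s :- n :* m) :- n :* (con 1ℚ :- z :* m)) refl (Z m) (S n) N⁴ (M n)) ⟩
    ∣ Z m * (4ℚ * S n - N⁴ * M n) - N⁴ * (1ℚ - Z m * M n) ∣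
      ≤⟨ ∣p-q∣≤∣p∣+∣q∣ (Z m * (4ℚ * S n - N⁴ * M n)) (N⁴ * (1ℚ - Z m * M n)) ⟩
    ∣ Z m * (4ℚ * S n - N⁴ * M n) ∣ + ∣ N⁴ * (1ℚ - Z m * M n) ∣
      ≡⟨ cong₂ _+_ (∣p*q∣≡∣p∣*∣q∣ (Z m) (4ℚ * S n - N⁴ * M n)) (∣p*q∣≡∣p∣*∣q∣ N⁴ (1ℚ - Z m * M n)) ⟩
    ∣ Z m ∣ * ∣ 4ℚ * S n - N⁴ * M n ∣ + ∣ N⁴ ∣ * ∣ 1ℚ - Z m * M n ∣
      ≤⟨ +-mono-≤
          (*-mono-≤ (0≤∣p∣ (Z m)) (subst (_≤ 2ℚ) (sym (0≤p⇒∣p∣≡p 0≤Z)) (Z≤2 (ℕₚ.≤-trans 1≤n n≤m)))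
            (0≤∣p∣ (4ℚ * S n - N⁴ * M n)) (4S-approx n))
          (*-mono-≤ (0≤∣p∣ N⁴) (≤-reflexive (0≤p⇒∣p∣≡p 0≤N⁴))
            (0≤∣p∣ (1ℚ - Z m * M n)) (Z*M-approx 1≤n n≤m)) ⟩
    2ℚ * (3ℚ * (N * N * N) * H n) + N⁴ * (2ℚ * rec n * H n)
      ≡⟨ solve 3 (λ n r h → con 2ℚ :* (con 3ℚ :* (n :* n :* n) :* h) :+ n :* n :* n :* n :* (con 2ℚ :* r :* h)
           := con 2ℚ :* (con 3ℚ :* (n :* n :* n) :* h) :+ n :* n :* n :* (con 2ℚ :* h) :* (n :* r)) refl N (rec n) (H n) ⟩
    2ℚ * (3ℚ * (N * N * N) * H n) + N * N * N * (2ℚ * H n) * (N * rec n)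
      ≡⟨ cong (λ z → 2ℚ * (3ℚ * (N * N * N) * H n) + N * N * N * (2ℚ * H n) * z) (*-rec 1≤n) ⟩
    2ℚ * (3ℚ * (N * N * N) * H n) + N * N * N * (2ℚ * H n) * 1ℚ
      ≡⟨ solve 2 (λ n h → con 2ℚ :* (con 3ℚ :* (n :* n :* n) :* h) :+ n :* n :* n :* (con 2ℚ :* h) :* con 1ℚ
           := con 8ℚ :* (n :* n :* n) :* h) refl N (H n) ⟩
    8ℚ * (N * N * N) * H n ∎
    where
    open ≤-Reasoning
    N N⁴ : ℚ
    N = ⟦ n ⟧
    N⁴ = N * N * N * N
    0≤Z = ∑-nonNeg (suc m) 0≤rec²
    0≤N = 0≤⟦⟧ n
    0≤N⁴ = 0≤* (0≤* (0≤* 0≤N 0≤N) 0≤N) 0≤N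

-- Truncated exponential series and harmonic numbers.

module Exponential where

  open import Data.Nat.Base using (_!)
  open import Data.Rational.Base
  open import Defs using (_!⁻¹)
  open ℚₚ
  open ≡ using (refl; sym; trans; cong; cong₂; subst; subst₂)
  open RationalOrder
  open FiniteSums
  open CoprimeSums

  open ℚ-Solver.+-*-Solver using (solve; _:=_; _:+_; _:*_; _:-_; :-_; con)

  pow : ℚ → ℕ → ℚ
  pow x zero    = 1ℚ
  pow x (suc n) = pow x n * x

  expTerm : ℚ → ℕ → ℚ
  expTerm x n = pow x n * n !⁻¹

  exp : ℚ → ℕ → ℚ
  exp x k = ∑ k (expTerm x)

  !⁻¹≡rec : ∀ n → n !⁻¹ ≡ rec (n !)
  !⁻¹≡rec n = helper (n !) {{n ℕₚ.!≢0}}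
    where
    helper : ∀ m .{{_ : ℕ.NonZero m}} → ℤ.+ 1 / m ≡ rec m
    helper (suc m) = sym (1/+1-def m)

  0≤!⁻¹ : ∀ n → 0ℚ ≤ n !⁻¹
  0≤!⁻¹ n = subst (0ℚ ≤_) (sym (!⁻¹≡rec n)) (0≤rec (n !))

  !⁻¹-suc : ∀ n → ⟦ suc n ⟧ * suc n !⁻¹ ≡ n !⁻¹
  !⁻¹-suc n = begin-equality
    N * suc n !⁻¹                        ≡⟨ cong (N *_) (!⁻¹≡rec (suc n)) ⟩
    N * rec (suc n ℕ.* n !)              ≡⟨ cong (N *_) (rec-* (suc n) (n !)) ⟩
    N * (rec (suc n) * rec (n !))        ≡⟨ *-assoc N (rec (suc n)) (rec (n !)) ⟨
    N * rec (suc n) * rec (n !)          ≡⟨ cong (_* rec (n !)) (1/+1-* n) ⟩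
    1ℚ * rec (n !)                       ≡⟨ *-identityˡ (rec (n !)) ⟩
    rec (n !)                            ≡⟨ !⁻¹≡rec n ⟨
    n !⁻¹                                ∎
    where
    open ≤-Reasoning
    N = ⟦ suc n ⟧

  expTerm-suc : ∀ x n → ⟦ suc n ⟧ * expTerm x (suc n) ≡ x * expTerm x n
  expTerm-suc x n = trans
    (solve 4 (λ n p x f → n :* ((p :* x) :* f) := x :* (p :* (n :* f))) refl
      ⟦ suc n ⟧ (pow x n) x (suc n !⁻¹))
    (cong (λ z → x * (pow x n * z)) (!⁻¹-suc n))

  0≤pow : ∀ {x} n → 0ℚ ≤ x → 0ℚ ≤ pow x n
  0≤pow zero    0≤x = 0≤1
  0≤pow (suc n) 0≤x = 0≤* (0≤pow n 0≤x) 0≤x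

  pow-mono : ∀ {x y} n → 0ℚ ≤ x → x ≤ y → pow x n ≤ pow y n
  pow-mono zero    0≤x x≤y = ≤-refl
  pow-mono (suc n) 0≤x x≤y = *-mono-≤ (0≤pow n 0≤x) (pow-mono n 0≤x x≤y) 0≤x x≤y

  0≤expTerm : ∀ {x} n → 0ℚ ≤ x → 0ℚ ≤ expTerm x n
  0≤expTerm n 0≤x = 0≤* (0≤pow n 0≤x) (0≤!⁻¹ n)

  exp-mono : ∀ {x y} k → 0ℚ ≤ x → x ≤ y → exp x k ≤ exp y k
  exp-mono k 0≤x x≤y = ∑-mono k λ n _ → *-monoʳ-≤ (n !⁻¹) (0≤!⁻¹ n) (pow-mono n 0≤x x≤y)

  -- The mean value inequality for the power n + 1 between x and x + h, with the derivative taken at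
  -- the right end.
  pow-+-≤ : ∀ {x h} n → 0ℚ ≤ x → 0ℚ ≤ h →
    pow (x + h) (suc n) ≤ pow x (suc n) + ⟦ suc n ⟧ * (h * pow (x + h) n)
  pow-+-≤ {x} {h} zero 0≤x 0≤h = ≤-reflexive (subst
    (λ z → 1ℚ * (x + h) ≡ 1ℚ * x + z * (h * 1ℚ)) (sym ⟦1⟧)
    (solve 2 (λ x h → con 1ℚ :* (x :+ h) := con 1ℚ :* x :+ con 1ℚ :* (h :* con 1ℚ)) refl x h))
  pow-+-≤ {x} {h} (suc n) 0≤x 0≤h = begin
    p * y                                   ≡⟨ *-distribˡ-+ p x h ⟩
    p * x + p * h
      ≤⟨ +-monoˡ-≤ (p * h) (*-monoʳ-≤ x 0≤x (pow-+-≤ n 0≤x 0≤h)) ⟩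
    (q + N * (h * r)) * x + p * h
      ≤⟨ ≤-by (N * (h * r) * h) (0≤* (0≤* (0≤⟦⟧ (suc n)) (0≤* 0≤h (0≤pow n 0≤y))) 0≤h)
          (solve 6 (λ q N h r x p → (q :+ N :* (h :* r)) :* x :+ p :* h :+ N :* (h :* r) :* h :=
             q :* x :+ (p :* h :+ N :* (h :* (r :* (x :+ h))))) refl q N h r x p) ⟩
    q * x + (p * h + N * (h * p))
      ≡⟨ cong (q * x +_) (solve 3 (λ p h N → p :* h :+ N :* (h :* p) := (con 1ℚ :+ N) :* (h :* p)) refl p h N) ⟩
    q * x + (1ℚ + N) * (h * p)
      ≡⟨ cong (λ z → q * x + z * (h * p)) (⟦⟧-suc (suc n)) ⟨
    q * x + ⟦ suc (suc n) ⟧ * (h * p)       ∎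
    where
    open ≤-Reasoning
    y = x + h
    p = pow y (suc n)
    q = pow x (suc n)
    r = pow y n
    N = ⟦ suc n ⟧
    0≤y = 0≤+ 0≤x 0≤h

  expTerm-+-≤ : ∀ {x h} n → 0ℚ ≤ x → 0ℚ ≤ h →
    expTerm (x + h) (suc n) ≤ expTerm x (suc n) + h * expTerm (x + h) n
  expTerm-+-≤ {x} {h} n 0≤x 0≤h = begin
    pow (x + h) (suc n) * f
      ≤⟨ *-monoʳ-≤ f (0≤!⁻¹ (suc n)) (pow-+-≤ n 0≤x 0≤h) ⟩
    (pow x (suc n) + N * (h * p)) * f
      ≡⟨ solve 5 (λ q N h p f → (q :+ N :* (h :* p)) :* f := q :* f :+ h :* (p :* (N :* f))) refl
           (pow x (suc n)) N h p f ⟩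
    pow x (suc n) * f + h * (p * (N * f))   ≡⟨ cong (λ z → pow x (suc n) * f + h * (p * z)) (!⁻¹-suc n) ⟩
    expTerm x (suc n) + h * expTerm (x + h) n ∎
    where
    open ≤-Reasoning
    N = ⟦ suc n ⟧
    f = suc n !⁻¹
    p = pow (x + h) n

  -- The inequality exp (x + h) ≤ exp x / (1 - h), which survives truncation of the series.
  exp-+-≤ : ∀ {x h} k → 0ℚ ≤ x → 0ℚ ≤ h → exp (x + h) k ≤ exp x k + h * exp (x + h) k
  exp-+-≤ {x} {h} zero 0≤x 0≤h = ≤-reflexive (solve 1 (λ h → con 0ℚ := con 0ℚ :+ h :* con 0ℚ) refl h)
  exp-+-≤ {x} {h} (suc k) 0≤x 0≤h = ≤-trans (shifted k)
    (+-monoʳ-≤ (exp x (suc k)) (*-monoˡ-≤ h 0≤h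
      (≤-by (expTerm (x + h) k) (0≤expTerm k (0≤+ 0≤x 0≤h)) refl)))
    where
    shifted : ∀ k → exp (x + h) (suc k) ≤ exp x (suc k) + h * exp (x + h) k
    shifted zero = ≤-reflexive (solve 1 (λ h → con 0ℚ :+ con 1ℚ :* con 1ℚ :=
      con 0ℚ :+ con 1ℚ :* con 1ℚ :+ h :* con 0ℚ) refl h)
    shifted (suc k) = ≤-trans (+-mono-≤ (shifted k) (expTerm-+-≤ k 0≤x 0≤h)) (≤-reflexive
      (solve 5 (λ a h b c d → a :+ h :* b :+ (c :+ h :* d) := a :+ c :+ h :* (b :+ d)) refl
        (exp x (suc k)) h (exp (x + h) k) (expTerm x (suc k)) (expTerm (x + h) k)))

  -- For n ≥ 1 this is 1/2 + ... + 1/n, a lower bound for log n.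
  G : ℕ → ℚ
  G n = H n - 1ℚ

  G-1 : G 1 ≡ 0ℚ
  G-1 = subst (λ z → 0ℚ + 0ℚ + z - 1ℚ ≡ 0ℚ) (sym rec-1) refl

  G-suc : ∀ n → G (suc n) ≡ G n + rec (suc n)
  G-suc n = solve 2 (λ h r → h :+ r :- con 1ℚ := h :- con 1ℚ :+ r) refl (H n) (rec (suc n))

  0≤G : ∀ n → 0ℚ ≤ G (suc n)
  0≤G zero    = ≤-reflexive (sym G-1)
  0≤G (suc n) = subst (0ℚ ≤_) (sym (G-suc (suc n))) (0≤+ (0≤G n) (0≤rec (suc (suc n))))

  exp-0≤1 : ∀ k → exp 0ℚ k ≤ 1ℚ
  exp-0≤1 zero = 0≤1
  exp-0≤1 (suc zero) = ≤-refl
  exp-0≤1 (suc (suc k)) = ≤-trans (≤-reflexive (trans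
    (cong (exp 0ℚ (suc k) +_) (solve 2 (λ p f → p :* con 0ℚ :* f := con 0ℚ) refl (pow 0ℚ k) (suc k !⁻¹)))
    (+-identityʳ _))) (exp-0≤1 (suc k))

  -- With h = 1/(n + 2), the inequality (1 - h) exp (x + h) ≤ exp x multiplies the bound by 1/(1 -
  -- h) = (n + 2)/(n + 1), which turns n + 1 into n + 2.
  exp-G : ∀ n k → exp (G (suc n)) k ≤ ⟦ suc n ⟧
  exp-G zero k = subst₂ (λ g o → exp g k ≤ o) (sym G-1) (sym ⟦1⟧) (exp-0≤1 k)
  exp-G (suc n) k = subst (λ g → exp g k ≤ N+1) (sym (G-suc (suc n))) (*-cancelˡ-≤ N (0<⟦suc⟧ n) (begin
    N * E                         ≡⟨ solve 2 (λ n e → n :* e := (con 1ℚ :+ n) :* e :- e) refl N E ⟩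
    (1ℚ + N) * E - E              ≡⟨ cong (λ z → z * E - E) (⟦⟧-suc (suc n)) ⟨
    N+1 * E - E
      ≤⟨ +-monoˡ-≤ (- E) (*-monoˡ-≤ N+1 (0≤⟦⟧ (suc (suc n))) (exp-+-≤ k (0≤G n) (0≤rec (suc (suc n))))) ⟩
    N+1 * (exp (G (suc n)) k + r * E) - E
      ≡⟨ solve 4 (λ m e r f → m :* (e :+ r :* f) :- f := m :* e :+ ((m :* r) :* f :- f)) refl
           N+1 (exp (G (suc n)) k) r E ⟩
    N+1 * exp (G (suc n)) k + ((N+1 * r) * E - E)
      ≡⟨ cong (λ z → N+1 * exp (G (suc n)) k + (z * E - E)) (1/+1-* (suc n)) ⟩
    N+1 * exp (G (suc n)) k + (1ℚ * E - E)
      ≡⟨ solve 2 (λ x e → x :+ (con 1ℚ :* e :- e) := x) refl (N+1 * exp (G (suc n)) k) E ⟩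
    N+1 * exp (G (suc n)) k         ≤⟨ *-monoˡ-≤ N+1 (0≤⟦⟧ (suc (suc n))) (exp-G n k) ⟩
    N+1 * N                         ≡⟨ *-comm N+1 N ⟩
    N * N+1                         ∎))
    where
    open ≤-Reasoning
    N = ⟦ suc n ⟧
    N+1 = ⟦ suc (suc n) ⟧
    r = rec (suc (suc n))
    E = exp (G (suc n) + r) k

  -- Defined by recursion so that a series truncated at `double (suc m)` unfolds to one more even
  -- and one more odd term.
  double : ℕ → ℕ
  double zero    = zero
  double (suc n) = suc (suc (double n))

  double≡+ : ∀ n → double n ≡ n ℕ.+ n
  double≡+ zero    = refl
  double≡+ (suc n) = trans (cong (λ k → suc (suc k)) (double≡+ n)) (cong suc (sym (ℕₚ.+-suc n n)))

  ⟦double⟧ : ∀ n → ⟦ double n ⟧ ≡ ⟦ n ⟧ + ⟦ n ⟧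
  ⟦double⟧ n = trans (cong ⟦_⟧ (double≡+ n)) (⟦⟧-+ n n)

  ∑-head : ∀ n f → ∑ (suc n) f ≡ f 0 + ∑ n (λ i → f (suc i))
  ∑-head zero    f = +-comm 0ℚ (f 0)
  ∑-head (suc n) f = trans (cong (_+ f (suc n)) (∑-head n f)) (+-assoc (f 0) _ _)

  -- exp y (2m) = C + S and exp (- y) (2m) = C - S for the truncated cosh C and
  -- sinh S. Integrating the y-derivative of C² - S² term by term gives C² - S² = 1 - 2 I.
  module _ (y : ℚ) where
    private
      c s : ℕ → ℚ
      c i = expTerm y (double i)
      s i = expTerm y (suc (double i))

      C S′ : ℕ → ℚ
      C m = ∑ m c
      S′ m = ∑ m s

      exp≡C+S : ∀ m → exp y (double m) ≡ C m + S′ m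
      exp≡C+S zero    = refl
      exp≡C+S (suc m) = trans (cong (λ z → z + c m + s m) (exp≡C+S m))
        (solve 4 (λ a b d e → a :+ b :+ d :+ e := a :+ d :+ (b :+ e)) refl (C m) (S′ m) (c m) (s m))

      pow-neg-even : ∀ i → pow (- y) (double i) ≡ pow y (double i)
      pow-neg-even zero    = refl
      pow-neg-even (suc i) = trans (cong (λ z → z * - y * - y) (pow-neg-even i))
        (solve 2 (λ p y → p :* (:- y) :* (:- y) := p :* y :* y) refl (pow y (double i)) y)

      exp-neg≡C-S : ∀ m → exp (- y) (double m) ≡ C m - S′ m
      exp-neg≡C-S zero    = refl
      exp-neg≡C-S (suc m) = trans
        (cong₂ (λ z p → z + p * (double m !⁻¹) + p * - y * (suc (double m) !⁻¹))
          (exp-neg≡C-S m) (pow-neg-even m))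
        (solve 6 (λ a b p y f g → a :- b :+ p :* f :+ p :* (:- y) :* g :=
            a :+ p :* f :- (b :+ p :* y :* g)) refl
          (C m) (S′ m) (pow y (double m)) y (double m !⁻¹) (suc (double m) !⁻¹))

      s-rec : ∀ i → (1ℚ + 2ℚ * ⟦ i ⟧) * s i ≡ y * c i
      s-rec i = trans
        (cong (_* s i) (sym (trans (⟦⟧-suc (double i)) (trans (cong (1ℚ +_) (⟦double⟧ i))
          (solve 1 (λ n → con 1ℚ :+ (n :+ n) := con 1ℚ :+ con 2ℚ :* n) refl ⟦ i ⟧)))))
        (expTerm-suc y (double i))

      c-rec : ∀ i → 2ℚ * ⟦ suc i ⟧ * c (suc i) ≡ y * s i
      c-rec i = trans
        (cong (_* c (suc i)) (sym (trans (⟦double⟧ (suc i))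
          (solve 1 (λ n → n :+ n := con 2ℚ :* n) refl ⟦ suc i ⟧))))
        (expTerm-suc y (suc (double i)))

      -- The y-derivative of C² - S² collapses to -2 C m · s (m - 1) for m ≥ 1, and `I m` is the
      -- integral of C m · s (m - 1) from 0 to y. Each product c m · c i is shared in the ratio m :
      -- i, the ratio of its degrees; `I` collects the shares of m and `U` those of i.
      I U : ℕ → ℚ
      a : ℕ → ℕ → ℚ
      I m = ∑ m (λ i → c m * c i * (⟦ m ⟧ * rec (m ℕ.+ i)))
      a m i = c m * c i * (⟦ i ⟧ * rec (m ℕ.+ i))
      U m = ∑ m (a m)

      I-U-split : ∀ m i → c (suc m) * c i ≡ c (suc m) * c i * (⟦ suc m ⟧ * rec (suc m ℕ.+ i)) + a (suc m) i
      I-U-split m i = begin-equality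
        t                            ≡⟨ *-identityʳ t ⟨
        t * 1ℚ                       ≡⟨ cong (t *_) (1/+1-* (m ℕ.+ i)) ⟨
        t * (⟦ suc m ℕ.+ i ⟧ * r)    ≡⟨ cong (λ z → t * (z * r)) (⟦⟧-+ (suc m) i) ⟩
        t * ((⟦ suc m ⟧ + ⟦ i ⟧) * r)
          ≡⟨ solve 4 (λ t m i r → t :* ((m :+ i) :* r) := t :* (m :* r) :+ t :* (i :* r)) refl
               t ⟦ suc m ⟧ ⟦ i ⟧ r ⟩
        t * (⟦ suc m ⟧ * r) + t * (⟦ i ⟧ * r) ∎
        where
        open ≤-Reasoning
        t = c (suc m) * c i
        r = rec (suc m ℕ.+ i)

      -- The product rule, integrated: the derivative of s m · s i is s m · c i + c m · s i, and the
      -- two summands on the right are the integrals of these.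
      ss-split : ∀ m i → s m * s i ≡ c (suc m) * c i * (⟦ suc m ⟧ * rec (suc m ℕ.+ i)) + a m (suc i)
      ss-split m i = subst
        (λ k → s m * s i ≡ c (suc m) * c i * (⟦ suc m ⟧ * r) + c m * c (suc i) * (⟦ suc i ⟧ * rec k))
        (sym (ℕₚ.+-suc m i)) (sym (begin-equality
        c (suc m) * c i * (⟦ suc m ⟧ * r) + c m * c (suc i) * (⟦ suc i ⟧ * r)
          ≡⟨ solve 7 (λ x ci M r cm z N → x :* ci :* (M :* r) :+ cm :* z :* (N :* r) :=
               con ½ :* r :* ((con 2ℚ :* M :* x) :* ci :+ (con 2ℚ :* N :* z) :* cm)) refl
               (c (suc m)) (c i) ⟦ suc m ⟧ r (c m) (c (suc i)) ⟦ suc i ⟧ ⟩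
        ½ * r * ((2ℚ * ⟦ suc m ⟧ * c (suc m)) * c i + (2ℚ * ⟦ suc i ⟧ * c (suc i)) * c m)
          ≡⟨ cong₂ (λ u v → ½ * r * (u * c i + v * c m)) (c-rec m) (c-rec i) ⟩
        ½ * r * ((y * s m) * c i + (y * s i) * c m)
          ≡⟨ solve 6 (λ r y sm ci si cm → con ½ :* r :* ((y :* sm) :* ci :+ (y :* si) :* cm) :=
               con ½ :* r :* (sm :* (y :* ci) :+ si :* (y :* cm))) refl r y (s m) (c i) (s i) (c m) ⟩
        ½ * r * (s m * (y * c i) + s i * (y * c m))
          ≡⟨ cong₂ (λ u v → ½ * r * (s m * u + s i * v)) (s-rec i) (s-rec m) ⟨
        ½ * r * (s m * ((1ℚ + 2ℚ * ⟦ i ⟧) * s i) + s i * ((1ℚ + 2ℚ * ⟦ m ⟧) * s m))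
          ≡⟨ solve 5 (λ r sm si i m → con ½ :* r :* (sm :* ((con 1ℚ :+ con 2ℚ :* i) :* si) :+
                 si :* ((con 1ℚ :+ con 2ℚ :* m) :* sm)) := sm :* si :* ((con 1ℚ :+ m :+ i) :* r)) refl
               r (s m) (s i) ⟦ i ⟧ ⟦ m ⟧ ⟩
        s m * s i * ((1ℚ + ⟦ m ⟧ + ⟦ i ⟧) * r)
          ≡⟨ cong (λ z → s m * s i * (z * r)) (trans (⟦⟧-+ (suc m) i) (cong (_+ ⟦ i ⟧) (⟦⟧-suc m))) ⟨
        s m * s i * (⟦ suc m ℕ.+ i ⟧ * r)    ≡⟨ cong (s m * s i *_) (1/+1-* (m ℕ.+ i)) ⟩
        s m * s i * 1ℚ                        ≡⟨ *-identityʳ (s m * s i) ⟩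
        s m * s i                             ∎))
        where
        open ≤-Reasoning
        r = rec (suc m ℕ.+ i)

      cC≡I+U : ∀ m → c (suc m) * C (suc m) ≡ I (suc m) + U (suc m)
      cC≡I+U m = trans (sym (∑-*ˡ (suc m) (c (suc m)) c)) (trans
        (∑-cong (suc m) λ i _ → I-U-split m i) (∑-+ (suc m) _ (a (suc m))))

      sS≡I+U : ∀ m → s m * S′ (suc m) ≡ I (suc m) + (U m + a m m + a m (suc m))
      sS≡I+U m = trans (sym (∑-*ˡ (suc m) (s m) s)) (trans
        (∑-cong (suc m) λ i _ → ss-split m i) (trans
        (∑-+ (suc m) _ (λ i → a m (suc i)))
        (cong (I (suc m) +_) (sym (trans (∑-head (suc m) (a m)) (trans
          (cong (_+ ∑ (suc m) (λ i → a m (suc i))) a0≡0) (+-identityˡ _)))))))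
        where
        a0≡0 : a m 0 ≡ 0ℚ
        a0≡0 = subst (λ z → c m * c 0 * (z * rec (m ℕ.+ 0)) ≡ 0ℚ) (sym ⟦0⟧)
          (solve 2 (λ x r → x :* (con 0ℚ :* r) := con 0ℚ) refl (c m * c 0) (rec (m ℕ.+ 0)))

      2a-diagonal : ∀ m → 2ℚ * a (suc m) (suc m) ≡ c (suc m) * c (suc m)
      2a-diagonal m = sym (trans (I-U-split m (suc m))
        (solve 1 (λ x → x :+ x := con 2ℚ :* x) refl (a (suc m) (suc m))))

      2a-off-diagonal : ∀ m → 2ℚ * a m (suc m) ≡ s m * s m
      2a-off-diagonal m = sym (trans (ss-split m m) (trans
        (cong (_+ a m (suc m)) (cong₂ _*_ (*-comm (c (suc m)) (c m))
          (cong (λ k → ⟦ suc m ⟧ * rec k) (sym (ℕₚ.+-suc m m)))))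
        (solve 1 (λ x → x :+ x := con 2ℚ :* x) refl (a m (suc m)))))

      C²-S² : ∀ m → C (suc m) * C (suc m) - S′ (suc m) * S′ (suc m) + 2ℚ * I (suc m) ≡ 1ℚ
      C²-S² zero = begin-equality
        C 1 * C 1 - S′ 1 * S′ 1 + 2ℚ * I 1
          ≡⟨ solve 3 (λ C S I → C :* C :- (con 0ℚ :+ S) :* (con 0ℚ :+ S) :+ con 2ℚ :* I :=
               C :* C :- con 2ℚ :* (S :* (con 0ℚ :+ S) :- I) :+ S :* S) refl (C 1) (s 0) (I 1) ⟩
        C 1 * C 1 - 2ℚ * (s 0 * S′ 1 - I 1) + s 0 * s 0
          ≡⟨ cong₂ (λ u v → C 1 * C 1 - 2ℚ * (u - I 1) + v) (sS≡I+U 0) (sym (2a-off-diagonal 0)) ⟩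
        C 1 * C 1 - 2ℚ * (I 1 + (U 0 + a 0 0 + a 0 1) - I 1) + 2ℚ * a 0 1
          ≡⟨ solve 4 (λ C I a b → C :* C :- con 2ℚ :* (I :+ (con 0ℚ :+ a :+ b) :- I) :+ con 2ℚ :* b :=
               C :* C :- con 2ℚ :* a) refl (C 1) (I 1) (a 0 0) (a 0 1) ⟩
        C 1 * C 1 - 2ℚ * a 0 0        ≡⟨ refl ⟩
        1ℚ * 1ℚ - 2ℚ * (1ℚ * (⟦ 0 ⟧ * 0ℚ))
          ≡⟨ solve 1 (λ z → con 1ℚ :* con 1ℚ :- con 2ℚ :* (con 1ℚ :* (z :* con 0ℚ)) := con 1ℚ) refl ⟦ 0 ⟧ ⟩
        1ℚ ∎
        where open ≤-Reasoning
      C²-S² (suc m) = trans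
        (begin-equality
        (C n + c n) * (C n + c n) - (S′ n + s n) * (S′ n + s n) + 2ℚ * I (suc n)
          ≡⟨ solve 5 (λ C c S s I → (C :+ c) :* (C :+ c) :- (S :+ s) :* (S :+ s) :+ con 2ℚ :* I :=
               C :* C :- S :* S :+ con 2ℚ :* (c :* C) :+ c :* c :+ s :* s :- con 2ℚ :* (s :* (S :+ s) :- I))
               refl (C n) (c n) (S′ n) (s n) (I (suc n)) ⟩
        C n * C n - S′ n * S′ n + 2ℚ * (c n * C n) + c n * c n + s n * s n - 2ℚ * (s n * S′ (suc n) - I (suc n))
          ≡⟨ cong₂ (λ u v → C n * C n - S′ n * S′ n + 2ℚ * u + c n * c n + s n * s n - 2ℚ * (v - I (suc n)))
               (cC≡I+U m) (sS≡I+U n) ⟩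
        C n * C n - S′ n * S′ n + 2ℚ * (I n + U n) + c n * c n + s n * s n
          - 2ℚ * (I (suc n) + (U n + a n n + a n (suc n)) - I (suc n))
          ≡⟨ cong₂ (λ u v → C n * C n - S′ n * S′ n + 2ℚ * (I n + U n) + u + v
               - 2ℚ * (I (suc n) + (U n + a n n + a n (suc n)) - I (suc n)))
               (sym (2a-diagonal m)) (sym (2a-off-diagonal n)) ⟩
        C n * C n - S′ n * S′ n + 2ℚ * (I n + U n) + 2ℚ * a n n + 2ℚ * a n (suc n)
          - 2ℚ * (I (suc n) + (U n + a n n + a n (suc n)) - I (suc n))
          ≡⟨ solve 6 (λ R I U a b J → R :+ con 2ℚ :* (I :+ U) :+ con 2ℚ :* a :+ con 2ℚ :* b
               :- con 2ℚ :* (J :+ (U :+ a :+ b) :- J) := R :+ con 2ℚ :* I) refl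
               (C n * C n - S′ n * S′ n) (I n) (U n) (a n n) (a n (suc n)) (I (suc n)) ⟩
        C n * C n - S′ n * S′ n + 2ℚ * I n ∎)
        (C²-S² m)
        where
        open ≤-Reasoning
        n = suc m

    exp*exp-neg≤1 : 0ℚ ≤ y → ∀ m → exp y (double (suc m)) * exp (- y) (double (suc m)) ≤ 1ℚ
    exp*exp-neg≤1 0≤y m = ≤-by (2ℚ * I n) (0≤* 0≤2 (∑-nonNeg n λ i →
        0≤* (0≤* (0≤expTerm (double n) 0≤y) (0≤expTerm (double i) 0≤y)) (0≤* (0≤⟦⟧ n) (0≤rec (n ℕ.+ i)))))
      (trans (cong₂ (λ u v → u * v + 2ℚ * I n) (exp≡C+S n) (exp-neg≡C-S n))
        (trans (solve 3 (λ c s i → (c :+ s) :* (c :- s) :+ i := c :* c :- s :* s :+ i) refl (C n) (S′ n) (2ℚ * I n))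
          (C²-S² m)))
      where n = suc m

  1≤exp : ∀ {y} k → 0ℚ ≤ y → 1ℚ ≤ exp y (suc k)
  1≤exp {y} k 0≤y = subst (1ℚ ≤_) (sym (∑-head k (expTerm y)))
    (≤-by (∑ k (λ i → expTerm y (suc i))) (∑-nonNeg k λ i → 0≤expTerm (suc i) 0≤y) refl)

  -- The truncated series at y is at least 1, so a value above 1 at -y would push their product
  -- above 1. The even length matters: 1 - y + y²/2 exceeds 1 for y > 2.
  exp-neg≤1 : ∀ {y} m → 0ℚ ≤ y → exp (- y) (double (suc m)) ≤ 1ℚ
  exp-neg≤1 {y} m 0≤y with exp (- y) (double (suc m)) ≤? 1ℚ
  ... | yes h = h
  ... | no h = contradiction (exp*exp-neg≤1 y 0≤y m) (<⇒≱ (<-≤-trans (≰⇒> h)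
    (subst (_≤ exp y (double (suc m)) * e) (*-identityˡ e)
      (*-monoʳ-≤ e (≤-trans 0≤1 (<⇒≤ (≰⇒> h))) (1≤exp (suc (double m)) 0≤y)))))
    where
    e = exp (- y) (double (suc m))
    <⇒≱ : ∀ {p q} → p < q → ¬ q ≤ p
    <⇒≱ p<q q≤p = <-irrefl refl (<-≤-trans p<q q≤p)

  -- To be applied to rational approximations of log X, which may be negative; hence the two cases.
  exp-≤-below-G : ∀ {x} n m → x ≤ G (suc n) → exp x (double (suc m)) ≤ ⟦ suc n ⟧
  exp-≤-below-G {x} n m x≤G with ≤-total 0ℚ x
  ... | inj₁ 0≤x = ≤-trans (exp-mono (double (suc m)) 0≤x x≤G) (exp-G n (double (suc m)))
  ... | inj₂ x≤0 = ≤-trans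
    (subst (λ z → exp z (double (suc m)) ≤ 1ℚ) (solve 1 (λ x → :- (:- x) := x) refl x)
      (exp-neg≤1 m (neg-antimono-≤ x≤0)))
    (subst (_≤ ⟦ suc n ⟧) ⟦1⟧ (⟦⟧-mono-≤ (s≤s z≤n)))

-- The sum of (p - 1)(q - 1) over coprime pairs, and bounds for harmonic numbers.

module RootCount where

  open import Data.Nat.Coprimality using (coprime?)
  open import Data.Rational.Base
  open ℚₚ
  open ≡ using (refl; sym; trans; cong; cong₂; subst; subst₂)
  open RationalOrder
  open FiniteSums
  open CoprimeSums

  open ℚ-Solver.+-*-Solver using (solve; _:=_; _:+_; _:*_; _:-_; :-_; con)

  ∑ℕ : ℕ → (ℕ → ℕ) → ℕ
  ∑ℕ zero    f = 0
  ∑ℕ (suc n) f = ∑ℕ n f ℕ.+ f n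

  ⟦∑ℕ⟧ : ∀ n f → ⟦ ∑ℕ n f ⟧ ≡ ∑ n (λ i → ⟦ f i ⟧)
  ⟦∑ℕ⟧ zero    f = ⟦0⟧
  ⟦∑ℕ⟧ (suc n) f = trans (⟦⟧-+ (∑ℕ n f) (f n)) (cong (_+ ⟦ f n ⟧) (⟦∑ℕ⟧ n f))

  weightIf : ∀ {A : Set} → Dec A → ℕ → ℕ → ℕ
  weightIf (yes _) p q = (p ℕ.∸ 1) ℕ.* (q ℕ.∸ 1)
  weightIf (no _)  p q = 0

  -- For coprime p, q > 0 the degree of the Alexander polynomial, and otherwise 0.
  weight : ℕ → ℕ → ℕ
  weight p q = weightIf (coprime? p q) p q

  W : ℕ → ℕ
  W n = ∑ℕ (suc n) λ p → ∑ℕ (suc n) λ q → weight p q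

  -- For positive p and q the gap is p + q - 1, which lies between 0 and 2 n. When p or q is 0, both
  -- the product and the weight with its truncated subtraction are 0.
  weight-gap : ∀ {A : Set} (d : Dec A) {p q n} → p ℕ.≤ n → q ℕ.≤ n →
    let t = 𝟙 d * (⟦ p ⟧ * ⟦ q ⟧); w = ⟦ weightIf d p q ⟧ in w ≤ t × t ≤ w + 2ℚ * ⟦ n ⟧
  weight-gap (no _) {p} {q} {n} _ _ =
    ≤-reflexive (trans ⟦0⟧ (sym (*-zeroˡ (⟦ p ⟧ * ⟦ q ⟧)))) ,
    subst₂ _≤_ (sym (*-zeroˡ (⟦ p ⟧ * ⟦ q ⟧))) refl (0≤+ (0≤⟦⟧ 0) (0≤* 0≤2 (0≤⟦⟧ n)))
  weight-gap (yes _) {zero} {q} {n} _ _ =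
    subst₂ _≤_ (sym ⟦0⟧) refl (0≤* 0≤1 (0≤* (0≤⟦⟧ 0) (0≤⟦⟧ q))) ,
    subst (λ z → 1ℚ * (z * ⟦ q ⟧) ≤ z + 2ℚ * ⟦ n ⟧) (sym ⟦0⟧)
      (subst₂ _≤_ (solve 1 (λ q → con 0ℚ := con 1ℚ :* (con 0ℚ :* q)) refl ⟦ q ⟧) refl
        (0≤+ ≤-refl (0≤* 0≤2 (0≤⟦⟧ n))))
  weight-gap (yes _) {suc p} {zero} {n} _ _ =
    subst (λ w → ⟦ w ⟧ ≤ 1ℚ * (⟦ suc p ⟧ * ⟦ 0 ⟧)) (sym (ℕₚ.*-zeroʳ p))
      (subst₂ _≤_ (sym ⟦0⟧) refl (0≤* 0≤1 (0≤* (0≤⟦⟧ (suc p)) (0≤⟦⟧ 0)))) ,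
    subst (_≤ ⟦ p ℕ.* 0 ⟧ + 2ℚ * ⟦ n ⟧)
      (subst (λ z → 0ℚ ≡ 1ℚ * (⟦ suc p ⟧ * z)) (sym ⟦0⟧)
        (solve 1 (λ p → con 0ℚ := con 1ℚ :* (p :* con 0ℚ)) refl ⟦ suc p ⟧))
      (0≤+ (0≤⟦⟧ (p ℕ.* 0)) (0≤* 0≤2 (0≤⟦⟧ n)))
  weight-gap (yes _) {suc p} {suc q} {n} p<n q<n =
    ≤-by (1ℚ + P + Q) (0≤+ (0≤+ 0≤1 0≤P) 0≤Q) equation ,
    ≤-trans (≤-reflexive (sym equation)) (+-monoʳ-≤ ⟦ p ℕ.* q ⟧
      (≤-by (1ℚ + ((N - (1ℚ + P)) + (N - (1ℚ + Q))))
        (0≤+ 0≤1 (0≤+ (0≤-diff (bound p<n)) (0≤-diff (bound q<n))))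
        (solve 3 (λ p q n → con 1ℚ :+ p :+ q :+ (con 1ℚ :+ ((n :- (con 1ℚ :+ p)) :+ (n :- (con 1ℚ :+ q))))
          := con 2ℚ :* n) refl P Q N)))
    where
    P Q N : ℚ
    P = ⟦ p ⟧
    Q = ⟦ q ⟧
    N = ⟦ n ⟧
    0≤P = 0≤⟦⟧ p
    0≤Q = 0≤⟦⟧ q
    bound : ∀ {k} → suc k ℕ.≤ n → 1ℚ + ⟦ k ⟧ ≤ N
    bound {k} k<n = subst (_≤ N) (⟦⟧-suc k) (⟦⟧-mono-≤ k<n)
    equation : ⟦ p ℕ.* q ⟧ + (1ℚ + P + Q) ≡ 1ℚ * (⟦ suc p ⟧ * ⟦ suc q ⟧)
    equation = trans (cong (_+ (1ℚ + P + Q)) (⟦⟧-* p q)) (trans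
      (solve 2 (λ p q → p :* q :+ (con 1ℚ :+ p :+ q) := con 1ℚ :* ((con 1ℚ :+ p) :* (con 1ℚ :+ q))) refl P Q)
      (sym (cong₂ (λ a b → 1ℚ * (a * b)) (⟦⟧-suc p) (⟦⟧-suc q))))

  ⟦W⟧ : ∀ n → ⟦ W n ⟧ ≡ ∑ (suc n) (λ p → ∑ (suc n) (λ q → ⟦ weight p q ⟧))
  ⟦W⟧ n = trans (⟦∑ℕ⟧ (suc n) _) (∑-cong (suc n) λ p _ → ⟦∑ℕ⟧ (suc n) (weight p))

  W≤S : ∀ n → ⟦ W n ⟧ ≤ S n
  W≤S n = subst (_≤ S n) (sym (⟦W⟧ n)) (∑-mono (suc n) λ p p≤n → ∑-mono (suc n) λ q q≤n →
    proj₁ (weight-gap (coprime? p q) (ℕₚ.≤-pred p≤n) (ℕₚ.≤-pred q≤n)))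

  -- Each of the (n + 1)² pairs loses at most 2 n, and n + 1 ≤ 2 n gives 8 n³.
  S≤W+ : ∀ {n} → 1 ℕ.≤ n → let N = ⟦ n ⟧ in S n ≤ ⟦ W n ⟧ + 8ℚ * (N * N * N)
  S≤W+ {n} 1≤n = begin
    S n
      ≤⟨ ∑-mono (suc n) (λ p p≤n → ∑-mono (suc n) λ q q≤n →
           proj₂ (weight-gap (coprime? p q) (ℕₚ.≤-pred p≤n) (ℕₚ.≤-pred q≤n))) ⟩
    ∑ (suc n) (λ p → ∑ (suc n) (λ q → ⟦ weight p q ⟧ + 2ℚ * N))
      ≡⟨ ∑-cong (suc n) (λ p _ → trans (∑-+ (suc n) _ (λ _ → 2ℚ * N))
           (cong (∑ (suc n) (λ q → ⟦ weight p q ⟧) +_) (∑-const (suc n) (2ℚ * N)))) ⟩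
    ∑ (suc n) (λ p → ∑ (suc n) (λ q → ⟦ weight p q ⟧) + N+1 * (2ℚ * N))
      ≡⟨ trans (∑-+ (suc n) _ (λ _ → N+1 * (2ℚ * N)))
           (cong₂ _+_ (sym (⟦W⟧ n)) (∑-const (suc n) (N+1 * (2ℚ * N)))) ⟩
    ⟦ W n ⟧ + N+1 * (N+1 * (2ℚ * N))
      ≤⟨ +-monoʳ-≤ ⟦ W n ⟧ (*-mono-≤ 0≤N+1 N+1≤2N (0≤* 0≤N+1 0≤2N) (*-monoʳ-≤ (2ℚ * N) 0≤2N N+1≤2N)) ⟩
    ⟦ W n ⟧ + 2ℚ * N * (2ℚ * N * (2ℚ * N))
      ≡⟨ cong (⟦ W n ⟧ +_) (solve 1 (λ n → con 2ℚ :* n :* (con 2ℚ :* n :* (con 2ℚ :* n)) :=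
           con 8ℚ :* (n :* n :* n)) refl N) ⟩
    ⟦ W n ⟧ + 8ℚ * (N * N * N) ∎
    where
    open ≤-Reasoning
    N N+1 : ℚ
    N = ⟦ n ⟧
    N+1 = ⟦ suc n ⟧
    0≤N+1 = 0≤⟦⟧ (suc n)
    0≤2N = 0≤* 0≤2 (0≤⟦⟧ n)
    N+1≤2N : N+1 ≤ 2ℚ * N
    N+1≤2N = subst₂ _≤_ (sym (⟦⟧-suc n)) (solve 1 (λ n → n :+ n := con 2ℚ :* n) refl N)
      (+-monoˡ-≤ N (subst (_≤ N) ⟦1⟧ (⟦⟧-mono-≤ 1≤n)))

  1≤H : ∀ {n} → 1 ℕ.≤ n → 1ℚ ≤ H n
  1≤H {n} 1≤n = subst (_≤ H n) (trans (+-identityˡ (rec 1)) rec-1) (∑-monoⁿ {2} {suc n} 0≤rec (s≤s 1≤n))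

  72ℚ : ℚ
  72ℚ = ℤ.+ 72 / 1

  -- Passing from S to W costs at most 4 Z · 8 N³ ≤ 64 N³, and `S-approx` adds 8 N³ H; since H ≥ 1,
  -- the total constant is 72.
  W-approx : ∀ {n m} → 1 ℕ.≤ n → n ℕ.≤ m → let N = ⟦ n ⟧ in
    ∣ 4ℚ * Z m * ⟦ W n ⟧ - N * N * N * N ∣ ≤ 72ℚ * (N * N * N) * H n
  W-approx {n} {m} 1≤n n≤m = begin
    ∣ 4Z * ⟦ W n ⟧ - N⁴ ∣                ≤⟨ triangle (4Z * ⟦ W n ⟧) (4Z * S n) N⁴ ⟩
    ∣ 4Z * ⟦ W n ⟧ - 4Z * S n ∣ + ∣ 4Z * S n - N⁴ ∣
      ≤⟨ +-mono-≤ (∣p-q∣≤ (4Z * ⟦ W n ⟧) (4Z * S n)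
            (≤-trans (*-monoˡ-≤ 4Z 0≤4Z (W≤S n)) (≤-by (4Z * (8ℚ * N³)) (0≤* 0≤4Z 0≤8N³) refl))
            (≤-trans (*-monoˡ-≤ 4Z 0≤4Z (S≤W+ 1≤n)) (≤-reflexive (*-distribˡ-+ 4Z ⟦ W n ⟧ (8ℚ * N³)))))
          (S-approx 1≤n n≤m) ⟩
    4Z * (8ℚ * N³) + 8ℚ * N³ * H n
      ≤⟨ +-monoˡ-≤ (8ℚ * N³ * H n) (*-mono-≤ 0≤4Z
           (*-monoˡ-≤ 4ℚ (nonNegative⁻¹ 4ℚ) (Z≤2 (ℕₚ.≤-trans 1≤n n≤m))) 0≤8N³
           (subst (_≤ 8ℚ * N³ * H n) (*-identityʳ (8ℚ * N³)) (*-monoˡ-≤ (8ℚ * N³) 0≤8N³ (1≤H 1≤n)))) ⟩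
    4ℚ * 2ℚ * (8ℚ * N³ * H n) + 8ℚ * N³ * H n
      ≡⟨ solve 2 (λ n h → con 4ℚ :* con 2ℚ :* (con 8ℚ :* n :* h) :+ con 8ℚ :* n :* h := con 72ℚ :* n :* h)
           refl N³ (H n) ⟩
    72ℚ * N³ * H n                       ∎
    where
    open ≤-Reasoning
    N N³ N⁴ 4Z : ℚ
    N = ⟦ n ⟧
    N³ = N * N * N
    N⁴ = N * N * N * N
    4Z = 4ℚ * Z m
    0≤N = 0≤⟦⟧ n
    0≤8N³ = 0≤* (nonNegative⁻¹ 8ℚ) (0≤* (0≤* 0≤N 0≤N) 0≤N)
    0≤4Z = 0≤* (nonNegative⁻¹ 4ℚ) (∑-nonNeg (suc m) 0≤rec²)

  rec≤1 : ∀ n → rec (suc n) ≤ 1ℚ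
  rec≤1 zero    = ≤-reflexive rec-1
  rec≤1 (suc n) = ≤-trans (rec-antitone n) (rec≤1 n)

  H≤ : ∀ n → H n ≤ ⟦ n ⟧
  H≤ zero    = ≤-reflexive (sym ⟦0⟧)
  H≤ (suc n) = ≤-trans (+-mono-≤ (H≤ n) (rec≤1 n))
    (≤-reflexive (trans (+-comm ⟦ n ⟧ 1ℚ) (sym (⟦⟧-suc n))))

  0≤H : ∀ n → 0ℚ ≤ H n
  0≤H n = ∑-nonNeg (suc n) 0≤rec

  -- A bound of order √n without logarithms. It makes N³ H negligible against N⁴ in the proof of
  -- `∼`, where no logarithm of X is given. The step uses h r ≤ 1 and r ≤ 1, so the square grows by
  -- at most 3.
  H²≤4n : ∀ n → H n * H n ≤ 4ℚ * ⟦ n ⟧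
  H²≤4n zero    = ≤-reflexive (sym (trans (cong (4ℚ *_) ⟦0⟧) refl))
  H²≤4n (suc n) = begin
    (h + r) * (h + r)         ≡⟨ solve 2 (λ h r → (h :+ r) :* (h :+ r) := h :* h :+ (con 2ℚ :* (h :* r) :+ r :* r)) refl h r ⟩
    h * h + (2ℚ * (h * r) + r * r)
      ≤⟨ +-mono-≤ (H²≤4n n) (+-mono-≤ (*-monoˡ-≤ 2ℚ 0≤2 hr≤1) (*-mono-≤ 0≤r (rec≤1 n) 0≤r (rec≤1 n))) ⟩
    4ℚ * ⟦ n ⟧ + (2ℚ * 1ℚ + 1ℚ * 1ℚ)
      ≤⟨ ≤-by 1ℚ 0≤1 (solve 1 (λ n → con 4ℚ :* n :+ (con 2ℚ :* con 1ℚ :+ con 1ℚ :* con 1ℚ) :+ con 1ℚ :=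
           con 4ℚ :* (con 1ℚ :+ n)) refl ⟦ n ⟧) ⟩
    4ℚ * (1ℚ + ⟦ n ⟧)         ≡⟨ cong (4ℚ *_) (⟦⟧-suc n) ⟨
    4ℚ * ⟦ suc n ⟧            ∎
    where
    open ≤-Reasoning
    h = H n
    r = rec (suc n)
    0≤r = 0≤rec (suc n)
    hr≤1 : h * r ≤ 1ℚ
    hr≤1 = ≤-trans (*-monoʳ-≤ r 0≤r (≤-trans (H≤ n) (⟦⟧-mono-≤ (ℕₚ.n≤1+n n)))) (≤-reflexive (1/+1-* n))

-- Stability and congruence for Cauchy reals, and the ring ℂ.

module RealNumbers where

  open import Algebra.Bundles using (CommutativeRing)
  open import Defs
  open ≡ using (refl; sym; trans; cong; subst; subst₂)
  open RationalOrder

  open ℚ-Solver.+-*-Solver using (solve; _:=_; _:+_; _:*_; _:-_; :-_; con)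

  infixl 1 _>>=_

  _>>=_ : ∀ {a b} {A : Set a} {B : Set b} → ¬ ¬ A → (A → ¬ ¬ B) → ¬ ¬ B
  (m >>= f) ¬b = m λ a → f a ¬b

  return : ∀ {a} {A : Set a} → A → ¬ ¬ A
  return a ¬a = ¬a a

  Eventually : (ℕ → Set) → Set
  Eventually P = ∃[ N ] ∀ n → N ℕ.≤ n → P n

  ev-map : ∀ {P Q : ℕ → Set} → (∀ n → P n → Q n) → Eventually P → Eventually Q
  ev-map f (N , p) = N , λ n N≤n → f n (p n N≤n)

  ev-× : ∀ {P Q : ℕ → Set} → Eventually P → Eventually Q → Eventually (λ n → P n × Q n)
  ev-× (M , p) (N , q) = M ℕ.⊔ N , λ n K≤n →
    p n (ℕₚ.m⊔n≤o⇒m≤o M N K≤n) , q n (ℕₚ.m⊔n≤o⇒n≤o M N K≤n)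

  ev-witness : ∀ {P : ℕ → Set} → Eventually P → ∃[ n ] P n
  ev-witness (N , p) = N , p N ℕₚ.≤-refl

  -- x ≤ y amounts to Small (x - y), and x ≈ y is Small ∣ x - y ∣.
  Small : ℝ → Set
  Small x = ∀ ε → 0ℚ ℚ.< ε → Eventually λ n → seq x n ℚ.< ε

  -- One term, taken after the sequence varies by less than ε/4, is compared with ε/2. Below ε/2,
  -- all later terms stay below 3ε/4. Otherwise they stay above ε/4, which refutes `Small x`
  -- outright.
  Small-stable : ∀ x → ¬ ¬ Small x → Small x
  Small-stable x ¬¬small ε 0<ε with cauchy x (ε ℚ.* ½ ℚ.* ½) (½-pos (½-pos 0<ε))
  ... | N , close with seq x N ℚₚ.<? ε ℚ.* ½
  ...   | yes xN<ε½ = N , λ n N≤n → <-by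
          ((ε ℚ.* ½ ℚ.* ½ ℚ.- (seq x n ℚ.- seq x N)) ℚ.+ (ε ℚ.* ½ ℚ.- seq x N) ℚ.+ ε ℚ.* ½ ℚ.* ½)
          (0<+ (0<+ (0<-diff (ℚₚ.≤-<-trans (p≤∣p∣ (seq x n ℚ.- seq x N)) (close n N N≤n ℕₚ.≤-refl)))
            (0<-diff xN<ε½)) (½-pos (½-pos 0<ε)))
          (solve 3 (λ x y e → x :+ ((e :* con ½ :* con ½ :- (x :- y)) :+ (e :* con ½ :- y) :+
             e :* con ½ :* con ½) := e) refl (seq x n) (seq x N) ε)
  ...   | no xN≮ε½ = contradiction {A = ¬ Small x} (λ small →
          let M , h = small (ε ℚ.* ½ ℚ.* ½) (½-pos (½-pos 0<ε))
              n = M ℕ.⊔ N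
          in ℚₚ.<-irrefl refl (ℚₚ.<-trans (h n (ℕₚ.m≤m⊔n M N)) (<-by
            ((ε ℚ.* ½ ℚ.* ½ ℚ.- (seq x N ℚ.- seq x n)) ℚ.+ (seq x N ℚ.- ε ℚ.* ½))
            (ℚₚ.+-mono-<-≤ (0<-diff (ℚₚ.≤-<-trans (p≤∣p∣ (seq x N ℚ.- seq x n))
                (close N n ℕₚ.≤-refl (ℕₚ.m≤n⊔m M N)))) (0≤-diff (ℚₚ.≮⇒≥ xN≮ε½)))
            (solve 3 (λ e y x → e :* con ½ :* con ½ :+ ((e :* con ½ :* con ½ :- (y :- x)) :+ (y :- e :* con ½))
               := x) refl ε (seq x N) (seq x n))))) ¬¬small

  ≤-stable : ∀ {x y} → ¬ ¬ x ≤ y → x ≤ y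
  ≤-stable {x} {y} ¬¬x≤y ε 0<ε = ev-map (λ n → back (seq x n) (seq y n))
    (Small-stable (x - y) (λ ¬small → ¬¬x≤y λ x≤y → ¬small λ ε 0<ε →
      ev-map (λ n → forth (seq x n) (seq y n)) (x≤y ε 0<ε)) ε 0<ε)
    where
    forth : ∀ {ε} a b → a ℚ.< b ℚ.+ ε → a ℚ.- b ℚ.< ε
    forth {ε} a b h = <-by (b ℚ.+ ε ℚ.- a) (0<-diff h)
      (solve 3 (λ a b e → a :- b :+ (b :+ e :- a) := e) refl a b ε)
    back : ∀ {ε} a b → a ℚ.- b ℚ.< ε → a ℚ.< b ℚ.+ ε
    back {ε} a b h = <-by (ε ℚ.- (a ℚ.- b)) (0<-diff h)
      (solve 3 (λ a b e → a :+ (e :- (a :- b)) := b :+ e) refl a b ε)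

  ≈-pointwise : ∀ {x y} → (∀ n → seq x n ≡ seq y n) → x ≈ y
  ≈-pointwise {x} {y} eq ε 0<ε = 0 , λ n _ → subst (ℚ._< ε)
    (sym (trans (cong (λ z → ℚ.∣ z ℚ.- seq y n ∣) (eq n)) (cong ℚ.∣_∣ (ℚₚ.+-inverseʳ (seq y n))))) 0<ε

  ≈-eventually : ∀ {x y} → Eventually (λ n → seq x n ≡ seq y n) → x ≈ y
  ≈-eventually {x} {y} ev ε 0<ε = ev-map (λ n eq → subst (ℚ._< ε)
    (sym (trans (cong (λ z → ℚ.∣ z ℚ.- seq y n ∣) eq) (cong ℚ.∣_∣ (ℚₚ.+-inverseʳ (seq y n))))) 0<ε) ev

  ≈-bound : ∀ {x y} B → 0ℚ ℚ.< B →
    (∀ η → 0ℚ ℚ.< η → Eventually λ n → ℚ.∣ seq x n ℚ.- seq y n ∣ ℚ.≤ B ℚ.* η) → x ≈ y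
  ≈-bound {x} {y} B 0<B h ε 0<ε =
    let r , 0<r , Br≡1 = reciprocal 0<B
        η = ε ℚ.* ½ ℚ.* r
    in ev-map (λ n le → ℚₚ.≤-<-trans le (subst₂ ℚ._<_
         (trans (solve 1 (λ e → e :* con ½ := con 1ℚ :* (e :* con ½)) refl ε)
           (trans (cong (ℚ._* (ε ℚ.* ½)) (sym Br≡1))
             (solve 3 (λ b r e → b :* r :* e := b :* (e :* r)) refl B r (ε ℚ.* ½)))) refl
         (<-by (ε ℚ.* ½) (½-pos 0<ε) (solve 1 (λ e → e :* con ½ :+ e :* con ½ := e) refl ε))))
       (h η (0<* (½-pos 0<ε) 0<r))

  bounded : ∀ x → ∃[ B ] 0ℚ ℚ.< B × Eventually λ n → ℚ.∣ seq x n ∣ ℚ.≤ B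
  bounded x with cauchy x 1ℚ 0<1
  ... | N , h = ℚ.∣ seq x N ∣ ℚ.+ 1ℚ , ℚₚ.+-mono-≤-< (ℚₚ.0≤∣p∣ (seq x N)) 0<1 , N , λ n N≤n →
    subst (ℚ._≤ ℚ.∣ seq x N ∣ ℚ.+ 1ℚ)
      (cong ℚ.∣_∣ (solve 2 (λ y x → y :+ (x :- y) := x) refl (seq x N) (seq x n)))
      (ℚₚ.≤-trans (ℚₚ.∣p+q∣≤∣p∣+∣q∣ (seq x N) (seq x n ℚ.- seq x N))
        (ℚₚ.+-monoʳ-≤ ℚ.∣ seq x N ∣ (ℚₚ.<⇒≤ (h n N N≤n ℕₚ.≤-refl))))

  +-cong : ∀ {x x′ y y′} → x ≈ x′ → y ≈ y′ → x + y ≈ x′ + y′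
  +-cong {x} {x′} {y} {y′} p q = ≈-bound {x + y} {x′ + y′} (1ℚ ℚ.+ 1ℚ) (0<+ 0<1 0<1) λ η 0<η →
    ev-map (λ n (a , b) → ℚₚ.≤-trans
        (subst (ℚ._≤ ℚ.∣ seq x n ℚ.- seq x′ n ∣ ℚ.+ ℚ.∣ seq y n ℚ.- seq y′ n ∣)
          (cong ℚ.∣_∣ (solve 4 (λ a b c d → (a :- b) :+ (c :- d) := (a :+ c) :- (b :+ d)) refl
            (seq x n) (seq x′ n) (seq y n) (seq y′ n)))
          (ℚₚ.∣p+q∣≤∣p∣+∣q∣ (seq x n ℚ.- seq x′ n) (seq y n ℚ.- seq y′ n)))
        (ℚₚ.≤-trans (ℚₚ.+-mono-≤ (ℚₚ.<⇒≤ a) (ℚₚ.<⇒≤ b))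
          (ℚₚ.≤-reflexive (solve 1 (λ e → e :+ e := (con 1ℚ :+ con 1ℚ) :* e) refl η))))
      (ev-× (p η 0<η) (q η 0<η))

  neg-cong : ∀ {x y} → x ≈ y → - x ≈ - y
  neg-cong {x} {y} p ε 0<ε = ev-map (λ n → subst (ℚ._< ε)
    (trans (∣p-q∣-comm (seq x n) (seq y n)) (cong ℚ.∣_∣
      (solve 2 (λ a b → b :- a := :- a :- :- b) refl (seq x n) (seq y n))))) (p ε 0<ε)

  *-cong : ∀ {x x′ y y′} → x ≈ x′ → y ≈ y′ → x * y ≈ x′ * y′
  *-cong {x} {x′} {y} {y′} p q =
    let A , 0<A , a = bounded x
        B , 0<B , b = bounded y′
    in ≈-bound {x * y} {x′ * y′} (A ℚ.+ B) (0<+ 0<A 0<B) λ η 0<η →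
      ev-map (λ n ((u , v) , (w , z)) → ℚₚ.≤-trans
          (subst (ℚ._≤ ℚ.∣ seq x n ℚ.* (seq y n ℚ.- seq y′ n) ∣ ℚ.+ ℚ.∣ seq y′ n ℚ.* (seq x n ℚ.- seq x′ n) ∣)
            (cong ℚ.∣_∣ (solve 4 (λ a b c d → a :* (c :- d) :+ d :* (a :- b) := a :* c :- b :* d) refl
              (seq x n) (seq x′ n) (seq y n) (seq y′ n)))
            (ℚₚ.∣p+q∣≤∣p∣+∣q∣ (seq x n ℚ.* (seq y n ℚ.- seq y′ n)) (seq y′ n ℚ.* (seq x n ℚ.- seq x′ n))))
          (ℚₚ.≤-trans (ℚₚ.+-mono-≤
              (subst (ℚ._≤ A ℚ.* η) (sym (ℚₚ.∣p*q∣≡∣p∣*∣q∣ (seq x n) (seq y n ℚ.- seq y′ n)))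
                (*-mono-≤ (ℚₚ.0≤∣p∣ (seq x n)) w (ℚₚ.0≤∣p∣ (seq y n ℚ.- seq y′ n)) (ℚₚ.<⇒≤ v)))
              (subst (ℚ._≤ B ℚ.* η) (sym (ℚₚ.∣p*q∣≡∣p∣*∣q∣ (seq y′ n) (seq x n ℚ.- seq x′ n)))
                (*-mono-≤ (ℚₚ.0≤∣p∣ (seq y′ n)) z (ℚₚ.0≤∣p∣ (seq x n ℚ.- seq x′ n)) (ℚₚ.<⇒≤ u))))
            (ℚₚ.≤-reflexive (sym (ℚₚ.*-distribʳ-+ η A B)))))
        (ev-× (ev-× (p η 0<η) (q η 0<η)) (ev-× a b))

  invℚ-inverseʳ : ∀ {δ} q → 0ℚ ℚ.< δ → δ ℚ.≤ ℚ.∣ q ∣ → q ℚ.* invℚ q ≡ 1ℚ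
  invℚ-inverseʳ q 0<δ δ≤∣q∣ with q ℚₚ.≟ 0ℚ
  ... | yes refl = contradiction (ℚₚ.<-≤-trans 0<δ δ≤∣q∣) (ℚₚ.<-irrefl refl)
  ... | no q≢0   = ℚₚ.*-inverseʳ q {{ℚ.≢-nonZero q≢0}}

  *-inverseʳ : ∀ x (x#0 : x #0) → x * x ⁻¹[ x#0 ] ≈ 1ℝ
  *-inverseʳ x x#0@(δ , 0<δ , apart) = ≈-eventually {x * x ⁻¹[ x#0 ]} {1ℝ}
    (ev-map (λ n → invℚ-inverseʳ (seq x n) 0<δ) apart)

  positive⇒#0 : ∀ {x} δ → 0ℚ ℚ.< δ → Eventually (λ n → δ ℚ.≤ seq x n) → x #0
  positive⇒#0 {x} δ 0<δ ev = δ , 0<δ , ev-map (λ n h → ℚₚ.≤-trans h (p≤∣p∣ (seq x n))) ev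

  ℂ-commutativeRing : CommutativeRing 0ℓ 0ℓ
  ℂ-commutativeRing = record
    { Carrier = ℂ ; _≈_ = _≈ᶜ_ ; _+_ = _+ᶜ_ ; _*_ = _*ᶜ_ ; -_ = λ z → (- re z) +i (- im z)
    ; 0# = 0ᶜ ; 1# = ℤ→ℂ (ℤ.+ 1)
    ; isCommutativeRing = record
      { isRing = record
        { +-isAbelianGroup = record
          { isGroup = record
            { isMonoid = record
              { isSemigroup = record
                { isMagma = record
                  { isEquivalence = record
                    { refl = λ {x} → ≈-refl {re x} , ≈-refl {im x}
                    ; sym = λ {x} {y} (a , b) → ≈-sym {re x} {re y} a , ≈-sym {im x} {im y} b
                    ; trans = λ {x} {y} {z} (a , b) (c , d) →
                        ≈-trans {re x} {re y} {re z} a c , ≈-trans {im x} {im y} {im z} b d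
                    }
                  ; ∙-cong = λ {x} {x′} {y} {y′} (a , b) (c , d) →
                      +-cong {re x} {re x′} {re y} {re y′} a c , +-cong {im x} {im x′} {im y} {im y′} b d
                  }
                ; assoc = λ x y z → pointwise ((x +ᶜ y) +ᶜ z) (x +ᶜ (y +ᶜ z))
                    (λ n → ℚₚ.+-assoc (seq (re x) n) (seq (re y) n) (seq (re z) n))
                    (λ n → ℚₚ.+-assoc (seq (im x) n) (seq (im y) n) (seq (im z) n))
                }
              ; identity = (λ x → pointwise (0ᶜ +ᶜ x) x (λ n → ℚₚ.+-identityˡ (seq (re x) n)) (λ n → ℚₚ.+-identityˡ (seq (im x) n)))
                         , (λ x → pointwise (x +ᶜ 0ᶜ) x (λ n → ℚₚ.+-identityʳ (seq (re x) n)) (λ n → ℚₚ.+-identityʳ (seq (im x) n)))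
              }
            ; inverse = (λ x → pointwise (((- re x) +i (- im x)) +ᶜ x) 0ᶜ (λ n → ℚₚ.+-inverseˡ (seq (re x) n)) (λ n → ℚₚ.+-inverseˡ (seq (im x) n)))
                      , (λ x → pointwise (x +ᶜ ((- re x) +i (- im x))) 0ᶜ (λ n → ℚₚ.+-inverseʳ (seq (re x) n)) (λ n → ℚₚ.+-inverseʳ (seq (im x) n)))
            ; ⁻¹-cong = λ {x} {y} (a , b) → neg-cong {re x} {re y} a , neg-cong {im x} {im y} b
            }
          ; comm = λ x y → pointwise (x +ᶜ y) (y +ᶜ x)
              (λ n → ℚₚ.+-comm (seq (re x) n) (seq (re y) n))
              (λ n → ℚₚ.+-comm (seq (im x) n) (seq (im y) n))
          }
        ; *-cong = λ {x} {x′} {y} {y′} → *ᶜ-cong {x} {x′} {y} {y′}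
        ; *-assoc = λ x y z → pointwise ((x *ᶜ y) *ᶜ z) (x *ᶜ (y *ᶜ z))
            (λ n → solve 6 (λ a b c d e f →
                (a :* c :- b :* d) :* e :- (a :* d :+ b :* c) :* f :=
                a :* (c :* e :- d :* f) :- b :* (c :* f :+ d :* e)) refl
              (seq (re x) n) (seq (im x) n) (seq (re y) n) (seq (im y) n) (seq (re z) n) (seq (im z) n))
            (λ n → solve 6 (λ a b c d e f →
                (a :* c :- b :* d) :* f :+ (a :* d :+ b :* c) :* e :=
                a :* (c :* f :+ d :* e) :+ b :* (c :* e :- d :* f)) refl
              (seq (re x) n) (seq (im x) n) (seq (re y) n) (seq (im y) n) (seq (re z) n) (seq (im z) n))
        ; *-identity =
            (λ x → pointwise ((ℤ→ℂ (ℤ.+ 1)) *ᶜ x) x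
              (λ n → solve 2 (λ a b → con 1ℚ :* a :- con 0ℚ :* b := a) refl (seq (re x) n) (seq (im x) n))
              (λ n → solve 2 (λ a b → con 1ℚ :* b :+ con 0ℚ :* a := b) refl (seq (re x) n) (seq (im x) n)))
          , (λ x → pointwise (x *ᶜ (ℤ→ℂ (ℤ.+ 1))) x
              (λ n → solve 2 (λ a b → a :* con 1ℚ :- b :* con 0ℚ := a) refl (seq (re x) n) (seq (im x) n))
              (λ n → solve 2 (λ a b → a :* con 0ℚ :+ b :* con 1ℚ := b) refl (seq (re x) n) (seq (im x) n)))
        ; distrib =
            (λ x y z → pointwise (x *ᶜ (y +ᶜ z)) ((x *ᶜ y) +ᶜ (x *ᶜ z))
              (λ n → solve 6 (λ a b c d e f →
                  a :* (c :+ e) :- b :* (d :+ f) := (a :* c :- b :* d) :+ (a :* e :- b :* f)) refl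
                (seq (re x) n) (seq (im x) n) (seq (re y) n) (seq (im y) n) (seq (re z) n) (seq (im z) n))
              (λ n → solve 6 (λ a b c d e f →
                  a :* (d :+ f) :+ b :* (c :+ e) := (a :* d :+ b :* c) :+ (a :* f :+ b :* e)) refl
                (seq (re x) n) (seq (im x) n) (seq (re y) n) (seq (im y) n) (seq (re z) n) (seq (im z) n)))
          , (λ x y z → pointwise ((y +ᶜ z) *ᶜ x) ((y *ᶜ x) +ᶜ (z *ᶜ x))
              (λ n → solve 6 (λ a b c d e f →
                  (c :+ e) :* a :- (d :+ f) :* b := (c :* a :- d :* b) :+ (e :* a :- f :* b)) refl
                (seq (re x) n) (seq (im x) n) (seq (re y) n) (seq (im y) n) (seq (re z) n) (seq (im z) n))
              (λ n → solve 6 (λ a b c d e f →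
                  (c :+ e) :* b :+ (d :+ f) :* a := (c :* b :+ d :* a) :+ (e :* b :+ f :* a)) refl
                (seq (re x) n) (seq (im x) n) (seq (re y) n) (seq (im y) n) (seq (re z) n) (seq (im z) n)))
        }
      ; *-comm = λ x y → pointwise (x *ᶜ y) (y *ᶜ x)
          (λ n → solve 4 (λ a b c d → a :* c :- b :* d := c :* a :- d :* b) refl
            (seq (re x) n) (seq (im x) n) (seq (re y) n) (seq (im y) n))
          (λ n → solve 4 (λ a b c d → a :* d :+ b :* c := c :* b :+ d :* a) refl
            (seq (re x) n) (seq (im x) n) (seq (re y) n) (seq (im y) n))
      }
    }
    where
    pointwise : ∀ (z w : ℂ) → (∀ n → seq (re z) n ≡ seq (re w) n) →
      (∀ n → seq (im z) n ≡ seq (im w) n) → z ≈ᶜ w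
    pointwise z w p q = ≈-pointwise {re z} {re w} p , ≈-pointwise {im z} {im w} q

    *ᶜ-cong : ∀ {x x′ y y′} → x ≈ᶜ x′ → y ≈ᶜ y′ → x *ᶜ y ≈ᶜ x′ *ᶜ y′
    *ᶜ-cong {x} {x′} {y} {y′} (a , b) (c , d) =
      +-cong {re x * re y} {re x′ * re y′} { - (im x * im y)} { - (im x′ * im y′)}
        (*-cong {re x} {re x′} {re y} {re y′} a c)
        (neg-cong {im x * im y} {im x′ * im y′} (*-cong {im x} {im x′} {im y} {im y′} b d)) ,
      +-cong {re x * im y} {re x′ * im y′} {im x * re y} {im x′ * re y′}
        (*-cong {re x} {re x′} {im y} {im y′} a d) (*-cong {im x} {im x′} {re y} {re y′} b c)

-- The ring of integer polynomials.

module Polynomials where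

  open import Algebra.Bundles using (CommutativeRing)
  open import Data.Integer.Base using (+_; -_; _+_; _*_)
  import Data.Integer.Solver as ℤ-Solver
  open import Data.List.Base using ([]; _∷_; map; replicate; _++_)
  open import Defs using (Poly; coeff; _≈ᵖ_; _+ᵖ_; _*ᵖ_; tⁿ-1)
  open ≡ using (refl; sym; trans; cong; cong₂)

  open ℤ-Solver.+-*-Solver using (solve; _:=_; _:+_; _:*_)

  negᵖ : Poly → Poly
  negᵖ = map -_

  coeff-+ : ∀ f g n → coeff (f +ᵖ g) n ≡ coeff f n + coeff g n
  coeff-+ []      g       n       = sym (ℤₚ.+-identityˡ (coeff g n))
  coeff-+ (a ∷ f) []      n       = sym (ℤₚ.+-identityʳ (coeff (a ∷ f) n))
  coeff-+ (a ∷ f) (b ∷ g) zero    = refl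
  coeff-+ (a ∷ f) (b ∷ g) (suc n) = coeff-+ f g n

  coeff-scale : ∀ a g n → coeff (map (a *_) g) n ≡ a * coeff g n
  coeff-scale a []      n       = sym (ℤₚ.*-zeroʳ a)
  coeff-scale a (b ∷ g) zero    = refl
  coeff-scale a (b ∷ g) (suc n) = coeff-scale a g n

  coeff-neg : ∀ f n → coeff (negᵖ f) n ≡ - coeff f n
  coeff-neg []      n       = refl
  coeff-neg (a ∷ f) zero    = refl
  coeff-neg (a ∷ f) (suc n) = coeff-neg f n

  coeff-*-zero : ∀ a f g → coeff ((a ∷ f) *ᵖ g) 0 ≡ a * coeff g 0
  coeff-*-zero a f g = trans (coeff-+ (map (a *_) g) _ 0) (trans
    (ℤₚ.+-identityʳ (coeff (map (a *_) g) 0)) (coeff-scale a g 0))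

  coeff-*-suc : ∀ a f g n → coeff ((a ∷ f) *ᵖ g) (suc n) ≡ a * coeff g (suc n) + coeff (f *ᵖ g) n
  coeff-*-suc a f g n = trans (coeff-+ (map (a *_) g) _ (suc n))
    (cong (_+ coeff (f *ᵖ g) n) (coeff-scale a g (suc n)))

  *-zeroʳ : ∀ f → f *ᵖ [] ≈ᵖ []
  *-zeroʳ []      n       = refl
  *-zeroʳ (a ∷ f) zero    = refl
  *-zeroʳ (a ∷ f) (suc n) = *-zeroʳ f n

  coeff-*∷-zero : ∀ f b g → coeff (f *ᵖ (b ∷ g)) 0 ≡ b * coeff f 0
  coeff-*∷-zero []      b g = sym (ℤₚ.*-zeroʳ b)
  coeff-*∷-zero (a ∷ f) b g = trans (coeff-*-zero a f (b ∷ g)) (ℤₚ.*-comm a b)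

  coeff-*∷-suc : ∀ f b g n → coeff (f *ᵖ (b ∷ g)) (suc n) ≡ b * coeff f (suc n) + coeff (f *ᵖ g) n
  coeff-*∷-suc []      b g n = sym (trans (ℤₚ.+-identityʳ (b * + 0)) (ℤₚ.*-zeroʳ b))
  coeff-*∷-suc (a ∷ f) b g zero = trans (coeff-*-suc a f (b ∷ g) 0) (trans
    (cong (λ z → a * coeff g 0 + z) (coeff-*∷-zero f b g)) (trans
    (ℤₚ.+-comm (a * coeff g 0) (b * coeff f 0))
    (cong (λ z → b * coeff f 0 + z) (sym (coeff-*-zero a f g)))))
  coeff-*∷-suc (a ∷ f) b g (suc n) = trans (coeff-*-suc a f (b ∷ g) (suc n)) (trans
    (cong (λ z → a * coeff g (suc n) + z) (coeff-*∷-suc f b g n)) (trans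
    (solve 3 (λ x y z → x :+ (y :+ z) := y :+ (x :+ z)) refl
      (a * coeff g (suc n)) (b * coeff f (suc n)) (coeff (f *ᵖ g) n))
    (cong (λ z → b * coeff f (suc n) + z) (sym (coeff-*-suc a f g n)))))

  *-comm : ∀ f g → f *ᵖ g ≈ᵖ g *ᵖ f
  *-comm []      g n       = sym (*-zeroʳ g n)
  *-comm (a ∷ f) g zero    = trans (coeff-*-zero a f g) (sym (coeff-*∷-zero g a f))
  *-comm (a ∷ f) g (suc n) = trans (coeff-*-suc a f g n) (trans
    (cong (λ z → a * coeff g (suc n) + z) (*-comm f g n)) (sym (coeff-*∷-suc g a f n)))

  *-congˡ : ∀ f {g h} → g ≈ᵖ h → f *ᵖ g ≈ᵖ f *ᵖ h
  *-congˡ []      eq n       = refl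
  *-congˡ (a ∷ f) {g} {h} eq zero = trans (coeff-*-zero a f g) (trans
    (cong (a *_) (eq 0)) (sym (coeff-*-zero a f h)))
  *-congˡ (a ∷ f) {g} {h} eq (suc n) = trans (coeff-*-suc a f g n) (trans
    (cong₂ (λ u v → a * u + v) (eq (suc n)) (*-congˡ f eq n)) (sym (coeff-*-suc a f h n)))

  *-cong : ∀ {f f′ g g′} → f ≈ᵖ f′ → g ≈ᵖ g′ → f *ᵖ g ≈ᵖ f′ *ᵖ g′
  *-cong {f} {f′} {g} {g′} p q n = trans (*-congˡ f q n) (trans (*-comm f g′ n)
    (trans (*-congˡ g′ p n) (*-comm g′ f′ n)))

  distribˡ : ∀ f g h → f *ᵖ (g +ᵖ h) ≈ᵖ (f *ᵖ g) +ᵖ (f *ᵖ h)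
  distribˡ []      g h n = refl
  distribˡ (a ∷ f) g h zero = trans (coeff-*-zero a f (g +ᵖ h)) (trans
    (cong (a *_) (coeff-+ g h 0)) (trans
    (ℤₚ.*-distribˡ-+ a (coeff g 0) (coeff h 0)) (trans
    (cong₂ _+_ (sym (coeff-*-zero a f g)) (sym (coeff-*-zero a f h)))
    (sym (coeff-+ ((a ∷ f) *ᵖ g) ((a ∷ f) *ᵖ h) 0)))))
  distribˡ (a ∷ f) g h (suc n) = trans (coeff-*-suc a f (g +ᵖ h) n) (trans
    (cong₂ (λ u v → a * u + v) (coeff-+ g h (suc n)) (trans (distribˡ f g h n) (coeff-+ (f *ᵖ g) (f *ᵖ h) n))) (trans
    (solve 5 (λ a u v x y → a :* (u :+ v) :+ (x :+ y) := (a :* u :+ x) :+ (a :* v :+ y)) refl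
      a (coeff g (suc n)) (coeff h (suc n)) (coeff (f *ᵖ g) n) (coeff (f *ᵖ h) n)) (trans
    (cong₂ _+_ (sym (coeff-*-suc a f g n)) (sym (coeff-*-suc a f h n)))
    (sym (coeff-+ ((a ∷ f) *ᵖ g) ((a ∷ f) *ᵖ h) (suc n))))))

  +-cong : ∀ {f f′ g g′} → f ≈ᵖ f′ → g ≈ᵖ g′ → f +ᵖ g ≈ᵖ f′ +ᵖ g′
  +-cong {f} {f′} {g} {g′} p q n = trans (coeff-+ f g n) (trans
    (cong₂ _+_ (p n) (q n)) (sym (coeff-+ f′ g′ n)))

  distribʳ : ∀ f g h → (g +ᵖ h) *ᵖ f ≈ᵖ (g *ᵖ f) +ᵖ (h *ᵖ f)
  distribʳ f g h n = trans (*-comm (g +ᵖ h) f n) (trans (distribˡ f g h n)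
    (+-cong {f *ᵖ g} {g *ᵖ f} {f *ᵖ h} {h *ᵖ f} (*-comm f g) (*-comm f h) n))

  scale-* : ∀ a g h → map (a *_) g *ᵖ h ≈ᵖ map (a *_) (g *ᵖ h)
  scale-* a []      h n = refl
  scale-* a (b ∷ g) h zero = trans (coeff-*-zero (a * b) (map (a *_) g) h) (trans
    (ℤₚ.*-assoc a b (coeff h 0)) (trans (cong (a *_) (sym (coeff-*-zero b g h)))
    (sym (coeff-scale a ((b ∷ g) *ᵖ h) 0))))
  scale-* a (b ∷ g) h (suc n) = trans (coeff-*-suc (a * b) (map (a *_) g) h n) (trans
    (cong (λ z → a * b * coeff h (suc n) + z) (trans (scale-* a g h n) (coeff-scale a (g *ᵖ h) n))) (trans
    (solve 4 (λ a b u v → a :* b :* u :+ a :* v := a :* (b :* u :+ v)) refl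
      a b (coeff h (suc n)) (coeff (g *ᵖ h) n)) (trans
    (cong (a *_) (sym (coeff-*-suc b g h n))) (sym (coeff-scale a ((b ∷ g) *ᵖ h) (suc n))))))

  *-assoc : ∀ f g h → (f *ᵖ g) *ᵖ h ≈ᵖ f *ᵖ (g *ᵖ h)
  *-assoc []      g h n = refl
  *-assoc (a ∷ f) g h n = trans (distribʳ h (map (a *_) g) (+ 0 ∷ (f *ᵖ g)) n)
    (+-cong {map (a *_) g *ᵖ h} {map (a *_) (g *ᵖ h)} {(+ 0 ∷ (f *ᵖ g)) *ᵖ h} {+ 0 ∷ (f *ᵖ (g *ᵖ h))}
      (scale-* a g h) shift n)
    where
    shift : (+ 0 ∷ (f *ᵖ g)) *ᵖ h ≈ᵖ + 0 ∷ (f *ᵖ (g *ᵖ h))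
    shift zero    = coeff-*-zero (+ 0) (f *ᵖ g) h
    shift (suc n) = trans (coeff-*-suc (+ 0) (f *ᵖ g) h n)
      (trans (ℤₚ.+-identityˡ (coeff ((f *ᵖ g) *ᵖ h) n)) (*-assoc f g h n))

  *-identityˡ : ∀ f → (+ 1 ∷ []) *ᵖ f ≈ᵖ f
  *-identityˡ f zero    = trans (coeff-*-zero (+ 1) [] f) (ℤₚ.*-identityˡ (coeff f 0))
  *-identityˡ f (suc n) = trans (coeff-*-suc (+ 1) [] f n) (trans
    (ℤₚ.+-identityʳ (+ 1 * coeff f (suc n))) (ℤₚ.*-identityˡ (coeff f (suc n))))

  Poly-commutativeRing : CommutativeRing 0ℓ 0ℓ
  Poly-commutativeRing = record
    { Carrier = Poly ; _≈_ = _≈ᵖ_ ; _+_ = _+ᵖ_ ; _*_ = _*ᵖ_ ; -_ = negᵖ ; 0# = [] ; 1# = + 1 ∷ []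
    ; isCommutativeRing = record
      { isRing = record
        { +-isAbelianGroup = record
          { isGroup = record
            { isMonoid = record
              { isSemigroup = record
                { isMagma = record
                  { isEquivalence = record
                    { refl = λ n → refl ; sym = λ p n → sym (p n) ; trans = λ p q n → trans (p n) (q n) }
                  ; ∙-cong = λ {f} {f′} {g} {g′} → +-cong {f} {f′} {g} {g′}
                  }
                ; assoc = λ f g h n → trans (trans (coeff-+ (f +ᵖ g) h n) (cong (_+ coeff h n) (coeff-+ f g n)))
                    (trans (ℤₚ.+-assoc (coeff f n) (coeff g n) (coeff h n))
                    (sym (trans (coeff-+ f (g +ᵖ h) n) (cong (λ z → coeff f n + z) (coeff-+ g h n)))))
                }
              ; identity = (λ f n → refl)
                         , (λ f n → trans (coeff-+ f [] n) (ℤₚ.+-identityʳ (coeff f n)))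
              }
            ; inverse =
                (λ f n → trans (coeff-+ (negᵖ f) f n) (trans (cong (_+ coeff f n) (coeff-neg f n)) (ℤₚ.+-inverseˡ (coeff f n))))
              , (λ f n → trans (coeff-+ f (negᵖ f) n) (trans (cong (λ z → coeff f n + z) (coeff-neg f n)) (ℤₚ.+-inverseʳ (coeff f n))))
            ; ⁻¹-cong = λ {f} {g} p n → trans (coeff-neg f n) (trans (cong -_ (p n)) (sym (coeff-neg g n)))
            }
          ; comm = λ f g n → trans (coeff-+ f g n) (trans (ℤₚ.+-comm (coeff f n) (coeff g n)) (sym (coeff-+ g f n)))
          }
        ; *-cong = λ {f} {f′} {g} {g′} → *-cong {f} {f′} {g} {g′}
        ; *-assoc = *-assoc
        ; *-identity = *-identityˡ , (λ f n → trans (*-comm f (+ 1 ∷ []) n) (*-identityˡ f n))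
        ; distrib = distribˡ , distribʳ
        }
      ; *-comm = *-comm
      }
    }

  open CommutativeRing Poly-commutativeRing public using () renaming (semiring to Poly-semiring)
  open import Algebra.Properties.Semiring.Exp Poly-semiring public using () renaming (_^_ to _^ᵖ_)

  t : Poly
  t = + 0 ∷ + 1 ∷ []

  coeff-t*-zero : ∀ f → coeff (t *ᵖ f) 0 ≡ + 0
  coeff-t*-zero f = coeff-*-zero (+ 0) (+ 1 ∷ []) f

  coeff-t*-suc : ∀ f n → coeff (t *ᵖ f) (suc n) ≡ coeff f n
  coeff-t*-suc f n = trans (coeff-*-suc (+ 0) (+ 1 ∷ []) f n)
    (trans (ℤₚ.+-identityˡ (coeff ((+ 1 ∷ []) *ᵖ f) n)) (*-identityˡ f n))

  monomial : ∀ n → replicate n (+ 0) ++ (+ 1 ∷ []) ≈ᵖ t ^ᵖ n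
  monomial zero    k       = refl
  monomial (suc n) zero    = sym (coeff-t*-zero (t ^ᵖ n))
  monomial (suc n) (suc k) = trans (monomial n k) (sym (coeff-t*-suc (t ^ᵖ n) k))

  tⁿ-1≈ : ∀ n → tⁿ-1 n ≈ᵖ (t ^ᵖ n) +ᵖ negᵖ (+ 1 ∷ [])
  tⁿ-1≈ n = +-cong {replicate n (+ 0) ++ (+ 1 ∷ [])} {t ^ᵖ n} {negᵖ (+ 1 ∷ [])} {negᵖ (+ 1 ∷ [])}
    (monomial n) (λ k → refl)

  coeff-t^*-vanish : ∀ m f k → (∀ j → j ℕ.≤ k → coeff f j ≡ + 0) → coeff (t ^ᵖ m *ᵖ f) k ≡ + 0
  coeff-t^*-vanish zero    f k       h = trans (*-identityˡ f k) (h k ℕₚ.≤-refl)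
  coeff-t^*-vanish (suc m) f zero    h = trans (*-assoc t (t ^ᵖ m) f 0) (coeff-t*-zero (t ^ᵖ m *ᵖ f))
  coeff-t^*-vanish (suc m) f (suc k) h = trans (*-assoc t (t ^ᵖ m) f (suc k))
    (trans (coeff-t*-suc (t ^ᵖ m *ᵖ f) k) (coeff-t^*-vanish m f k λ j j≤k → h j (ℕₚ.m≤n⇒m≤1+n j≤k)))

  -- Multiplication by a positive power of t makes each coefficient depend on strictly lower ones,
  -- so strong induction applies. As f (t^n - 1) = 0 says f = t^n f, this makes t^n - 1 cancellable.
  t^-fixed⇒0 : ∀ m f → f ≈ᵖ t ^ᵖ suc m *ᵖ f → f ≈ᵖ []
  t^-fixed⇒0 m f eq k = below (suc k) k ℕₚ.≤-refl
    where
    below : ∀ b j → j ℕ.< b → coeff f j ≡ + 0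
    below (suc b) zero    _ = trans (eq 0) (trans (*-assoc t (t ^ᵖ m) f 0) (coeff-t*-zero (t ^ᵖ m *ᵖ f)))
    below (suc b) (suc j) (s≤s j<b) = trans (eq (suc j)) (trans (*-assoc t (t ^ᵖ m) f (suc j))
      (trans (coeff-t*-suc (t ^ᵖ m *ᵖ f) j) (coeff-t^*-vanish m f j λ i i≤j → below b i (ℕₚ.≤-<-trans i≤j j<b))))

-- Geometric sums, evaluation, and the Alexander polynomial over commutative rings.

module IntegerAlgebra where

  open import Algebra.Bundles using (CommutativeRing)
  import Algebra.Solver.Ring
  import Algebra.Solver.Ring.AlmostCommutativeRing as ACR
  open import Data.List.Base using ([]; _∷_; map)
  open import Data.Maybe.Base using (Maybe; just; nothing)
  open import Defs using (Poly; coeff; _≈ᵖ_; _+ᵖ_; _*ᵖ_; tⁿ-1; IsAlexander)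
  open Polynomials using (Poly-commutativeRing; _^ᵖ_; t; tⁿ-1≈; t^-fixed⇒0; negᵖ)

  -- Abstracts over integer polynomials and ℂ: the same identities of geometric sums construct the
  -- Alexander polynomial in the former and compute its values in the latter.
  record ℤ-Algebra : Set₁ where
    field
      ring : CommutativeRing 0ℓ 0ℓ
    open CommutativeRing ring
    field
      ι     : ℤ → Carrier
      ι-+   : ∀ a b → ι (a ℤ.+ b) ≈ ι a + ι b
      ι-*   : ∀ a b → ι (a ℤ.* b) ≈ ι a * ι b
      ι-neg : ∀ a → ι (ℤ.- a) ≈ - ι a
      ι-0   : ι (ℤ.+ 0) ≈ 0#
      ι-1   : ι (ℤ.+ 1) ≈ 1#

  Poly-algebra : ℤ-Algebra
  Poly-algebra = record
    { ring = Poly-commutativeRing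
    ; ι = λ a → a ∷ []
    ; ι-+ = λ a b n → ≡.refl
    ; ι-* = λ { a b zero → ≡.sym (ℤₚ.+-identityʳ (a ℤ.* b)) ; a b (suc n) → ≡.refl }
    ; ι-neg = λ a n → ≡.refl
    ; ι-0 = λ { zero → ≡.refl ; (suc n) → ≡.refl }
    ; ι-1 = λ n → ≡.refl
    }

  module Geometric (A : ℤ-Algebra) where
    open ℤ-Algebra A public
    open CommutativeRing ring public hiding (zero; ring)
    open import Algebra.Properties.CommutativeSemiring.Exp commutativeSemiring public
    open import Relation.Binary.Reasoning.Setoid setoid public

    private
      almost = ACR.fromCommutativeRing ring

      morphism : ℤ.+-*-rawRing ACR.-Raw-AlmostCommutative⟶ almost
      morphism = record
        { ⟦_⟧ = ι ; +-homo = ι-+ ; *-homo = ι-* ; -‿homo = ι-neg ; 0-homo = ι-0 ; 1-homo = ι-1 }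

      ι-≟ : ∀ a b → Maybe (ι a ≈ ι b)
      ι-≟ a b with a ℤₚ.≟ b
      ... | yes ≡.refl = just refl
      ... | no _       = nothing

    -- con (+ 1) evaluates to ι (+ 1), so 1# is passed to the solver as a variable.
    module Solver = Algebra.Solver.Ring ℤ.+-*-rawRing almost morphism ι-≟
    open Solver public using (solve; _:=_; _:+_; _:*_; _:-_; :-_; con)

    geo : Carrier → ℕ → Carrier
    geo x zero    = 0#
    geo x (suc n) = 1# + x * geo x n

    geo-cong : ∀ {x y} n → x ≈ y → geo x n ≈ geo y n
    geo-cong zero    x≈y = refl
    geo-cong (suc n) x≈y = +-congˡ (*-cong x≈y (geo-cong n x≈y))

    x≈y⇒x-y≈0 : ∀ {x y} → x ≈ y → x - y ≈ 0#
    x≈y⇒x-y≈0 {x} {y} x≈y = trans (+-congʳ x≈y) (-‿inverseʳ y)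

    x-y≈0⇒x≈y : ∀ {x y} → x - y ≈ 0# → x ≈ y
    x-y≈0⇒x≈y {x} {y} eq = begin
      x             ≈⟨ solve 2 (λ x y → x := (x :- y) :+ y) refl x y ⟩
      (x - y) + y   ≈⟨ +-congʳ eq ⟩
      0# + y        ≈⟨ +-identityˡ y ⟩
      y             ∎

    *[x-1]≈0⇒fixed : ∀ {x y} → y * (x - 1#) ≈ 0# → y ≈ x * y
    *[x-1]≈0⇒fixed {x} {y} eq = sym (x-y≈0⇒x≈y (begin
      x * y - y             ≈⟨ +-congˡ (-‿cong (sym (*-identityʳ y))) ⟩
      x * y - y * 1#        ≈⟨ solve 3 (λ x y o → x :* y :- y :* o := y :* (x :- o)) refl x y 1# ⟩
      y * (x - 1#)          ≈⟨ eq ⟩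
      0#                    ∎))

    geo-telescope : ∀ x n → (x - 1#) * geo x n ≈ x ^ n - 1#
    geo-telescope x zero    = trans (zeroʳ (x - 1#)) (sym (-‿inverseʳ 1#))
    geo-telescope x (suc n) = begin
      (x - 1#) * (1# + x * geo x n)
        ≈⟨ solve 3 (λ x o g → (x :- o) :* (o :+ x :* g) := x :* ((x :- o) :* g) :+ (x :* o :- o :* o)) refl x 1# (geo x n) ⟩
      x * ((x - 1#) * geo x n) + (x * 1# - 1# * 1#)
        ≈⟨ +-cong (*-congˡ (geo-telescope x n)) (+-congˡ (-‿cong (*-identityˡ 1#))) ⟩
      x * (x ^ n - 1#) + (x * 1# - 1#)
        ≈⟨ solve 3 (λ x p o → x :* (p :- o) :+ (x :* o :- o) := x :* p :- o) refl x (x ^ n) 1# ⟩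
      x * x ^ n - 1# ∎

    geo-snoc : ∀ x n → geo x (suc n) ≈ geo x n + x ^ n
    geo-snoc x zero    = trans (+-congˡ (zeroʳ x)) (+-comm 1# 0#)
    geo-snoc x (suc n) = begin
      1# + x * geo x (suc n)          ≈⟨ +-congˡ (*-congˡ (geo-snoc x n)) ⟩
      1# + x * (geo x n + x ^ n)      ≈⟨ solve 4 (λ o x g p → o :+ x :* (g :+ p) := (o :+ x :* g) :+ x :* p) refl 1# x (geo x n) (x ^ n) ⟩
      geo x (suc n) + x ^ suc n       ∎

    geo-+ : ∀ x m n → geo x (m ℕ.+ n) ≈ geo x m + x ^ m * geo x n
    geo-+ x zero    n = sym (trans (+-identityˡ _) (*-identityˡ (geo x n)))
    geo-+ x (suc m) n = begin
      1# + x * geo x (m ℕ.+ n)                    ≈⟨ +-congˡ (*-congˡ (geo-+ x m n)) ⟩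
      1# + x * (geo x m + x ^ m * geo x n)
        ≈⟨ solve 5 (λ o x g p h → o :+ x :* (g :+ p :* h) := (o :+ x :* g) :+ (x :* p) :* h) refl
             1# x (geo x m) (x ^ m) (geo x n) ⟩
      geo x (suc m) + x ^ suc m * geo x n         ∎

    geo-* : ∀ x m n → geo x (m ℕ.* n) ≈ geo x n * geo (x ^ n) m
    geo-* x zero    n = sym (zeroʳ (geo x n))
    geo-* x (suc m) n = begin
      geo x (n ℕ.+ m ℕ.* n)                       ≈⟨ geo-+ x n (m ℕ.* n) ⟩
      geo x n + x ^ n * geo x (m ℕ.* n)           ≈⟨ +-cong (sym (*-identityʳ (geo x n))) (*-congˡ (geo-* x m n)) ⟩
      geo x n * 1# + x ^ n * (geo x n * geo (x ^ n) m)
        ≈⟨ solve 4 (λ g o p h → g :* o :+ p :* (g :* h) := g :* (o :+ p :* h)) refl (geo x n) 1# (x ^ n) (geo (x ^ n) m) ⟩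
      geo x n * geo (x ^ n) (suc m)               ∎

    geo-1 : ∀ n → geo 1# n ≈ ι (ℤ.+ n)
    geo-1 zero    = sym ι-0
    geo-1 (suc n) = trans (+-cong (sym ι-1) (trans (*-identityˡ (geo 1# n)) (geo-1 n))) (sym (ι-+ (ℤ.+ 1) (ℤ.+ n)))

  module Evaluation (A : ℤ-Algebra) where
    open Geometric A
    private
      module P = Geometric Poly-algebra

    eval : Poly → Carrier → Carrier
    eval []      x = ι (ℤ.+ 0)
    eval (a ∷ f) x = ι a + x * eval f x

    eval-zero : ∀ f x → (∀ n → coeff f n ≡ ℤ.+ 0) → eval f x ≈ 0#
    eval-zero []      x h = ι-0
    eval-zero (a ∷ f) x h = begin
      ι a + x * eval f x  ≈⟨ +-cong (trans (reflexive (≡.cong ι (h 0))) ι-0) (*-congˡ (eval-zero f x λ n → h (suc n))) ⟩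
      0# + x * 0#         ≈⟨ trans (+-identityˡ _) (zeroʳ x) ⟩
      0#                  ∎

    eval-cong : ∀ f g x → f ≈ᵖ g → eval f x ≈ eval g x
    eval-cong []      g       x h = trans ι-0 (sym (eval-zero g x λ n → ≡.sym (h n)))
    eval-cong (a ∷ f) []      x h = trans (eval-zero (a ∷ f) x h) (sym ι-0)
    eval-cong (a ∷ f) (b ∷ g) x h =
      +-cong (reflexive (≡.cong ι (h 0))) (*-congˡ (eval-cong f g x λ n → h (suc n)))

    eval-+ : ∀ f g x → eval (f +ᵖ g) x ≈ eval f x + eval g x
    eval-+ []      g       x = sym (trans (+-congʳ ι-0) (+-identityˡ (eval g x)))
    eval-+ (a ∷ f) []      x = sym (trans (+-congˡ ι-0) (+-identityʳ (eval (a ∷ f) x)))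
    eval-+ (a ∷ f) (b ∷ g) x = begin
      ι (a ℤ.+ b) + x * eval (f +ᵖ g) x          ≈⟨ +-cong (ι-+ a b) (*-congˡ (eval-+ f g x)) ⟩
      (ι a + ι b) + x * (eval f x + eval g x)
        ≈⟨ solve 5 (λ a b x u v → (a :+ b) :+ x :* (u :+ v) := (a :+ x :* u) :+ (b :+ x :* v)) refl
             (ι a) (ι b) x (eval f x) (eval g x) ⟩
      eval (a ∷ f) x + eval (b ∷ g) x            ∎

    eval-scale : ∀ a g x → eval (map (a ℤ.*_) g) x ≈ ι a * eval g x
    eval-scale a []      x = trans ι-0 (sym (trans (*-congˡ ι-0) (zeroʳ (ι a))))
    eval-scale a (b ∷ g) x = begin
      ι (a ℤ.* b) + x * eval (map (a ℤ.*_) g) x  ≈⟨ +-cong (ι-* a b) (*-congˡ (eval-scale a g x)) ⟩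
      ι a * ι b + x * (ι a * eval g x)
        ≈⟨ solve 4 (λ a b x u → a :* b :+ x :* (a :* u) := a :* (b :+ x :* u)) refl (ι a) (ι b) x (eval g x) ⟩
      ι a * eval (b ∷ g) x                       ∎

    eval-* : ∀ f g x → eval (f *ᵖ g) x ≈ eval f x * eval g x
    eval-* []      g x = trans ι-0 (sym (trans (*-congʳ ι-0) (zeroˡ (eval g x))))
    eval-* (a ∷ f) g x = begin
      eval (map (a ℤ.*_) g +ᵖ (ℤ.+ 0 ∷ (f *ᵖ g))) x
        ≈⟨ eval-+ (map (a ℤ.*_) g) (ℤ.+ 0 ∷ (f *ᵖ g)) x ⟩
      eval (map (a ℤ.*_) g) x + (ι (ℤ.+ 0) + x * eval (f *ᵖ g) x)
        ≈⟨ +-cong (eval-scale a g x) (+-cong ι-0 (*-congˡ (eval-* f g x))) ⟩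
      ι a * eval g x + (0# + x * (eval f x * eval g x))
        ≈⟨ +-congˡ (+-identityˡ _) ⟩
      ι a * eval g x + x * (eval f x * eval g x)
        ≈⟨ solve 4 (λ a u x v → a :* v :+ x :* (u :* v) := (a :+ x :* u) :* v) refl (ι a) (eval f x) x (eval g x) ⟩
      eval (a ∷ f) x * eval g x                  ∎

    eval-1 : ∀ x → eval (ℤ.+ 1 ∷ []) x ≈ 1#
    eval-1 x = trans (+-cong ι-1 (trans (*-congˡ ι-0) (zeroʳ x))) (+-identityʳ 1#)

    eval-t : ∀ x → eval t x ≈ x
    eval-t x = trans (+-cong ι-0 (trans (*-congˡ (eval-1 x)) (*-identityʳ x))) (+-identityˡ x)

    eval-^ : ∀ f n x → eval (f ^ᵖ n) x ≈ eval f x ^ n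
    eval-^ f zero    x = eval-1 x
    eval-^ f (suc n) x = trans (eval-* f (f ^ᵖ n) x) (*-congˡ (eval-^ f n x))

    eval-t^ : ∀ n x → eval (t ^ᵖ n) x ≈ x ^ n
    eval-t^ n x = trans (eval-^ t n x) (^-congˡ n (eval-t x))

    eval-geo : ∀ f n x → eval (P.geo f n) x ≈ geo (eval f x) n
    eval-geo f zero    x = ι-0
    eval-geo f (suc n) x = trans (eval-+ (ℤ.+ 1 ∷ []) (f *ᵖ P.geo f n) x)
      (+-cong (eval-1 x) (trans (eval-* f (P.geo f n) x) (*-congˡ (eval-geo f n x))))

    eval-tⁿ-1 : ∀ n x → eval (tⁿ-1 n) x ≈ x ^ n - 1#
    eval-tⁿ-1 n x = trans (eval-cong (tⁿ-1 n) (t ^ᵖ n +ᵖ negᵖ (ℤ.+ 1 ∷ [])) x (tⁿ-1≈ n))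
      (trans (eval-+ (t ^ᵖ n) (negᵖ (ℤ.+ 1 ∷ [])) x) (+-cong (eval-t^ n x)
      (trans (+-cong (trans (ι-neg (ℤ.+ 1)) (-‿cong ι-1)) (trans (*-congˡ ι-0) (zeroʳ x))) (+-identityʳ (- 1#)))))

  -- u q + v p = 1 + c (p q) is a Bézout identity free of subtraction.
  Bézout⁺ : ℕ → ℕ → Set
  Bézout⁺ p q = ∃[ u ] ∃[ v ] ∃[ c ] u ℕ.* q ℕ.+ v ℕ.* p ≡ 1 ℕ.+ c ℕ.* (p ℕ.* q)

  module AlexanderQuotient (A : ℤ-Algebra) (t : CommutativeRing.Carrier (ℤ-Algebra.ring A)) where
    open Geometric A

    IsQuotient : ℕ → ℕ → Carrier → Set
    IsQuotient p q D = D * ((t ^ p - 1#) * (t ^ q - 1#)) ≈ (t ^ (p ℕ.* q) - 1#) * (t - 1#)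

    IsQuotient-swap : ∀ p q {D} → IsQuotient p q D → IsQuotient q p D
    IsQuotient-swap p q {D} eq = begin
      D * ((t ^ q - 1#) * (t ^ p - 1#))   ≈⟨ *-congˡ (*-comm _ _) ⟩
      D * ((t ^ p - 1#) * (t ^ q - 1#))   ≈⟨ eq ⟩
      (t ^ (p ℕ.* q) - 1#) * (t - 1#)     ≈⟨ *-congʳ (+-congʳ (^-congʳ t (ℕₚ.*-comm p q))) ⟩
      (t ^ (q ℕ.* p) - 1#) * (t - 1#)     ∎

    -- With 1 = a A′ + b B - g C, g = a b′ = b a′ and a = [q], b = [p], g = [pq]:
    -- g = g (a A′ + b B - g C) = a b (a′ A′ + b′ B - C a′ b′).
    quotient : ∀ p q → Bézout⁺ p q → ∃[ D ] IsQuotient p q D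
    quotient p q (u , v , c , bezout) = D , (begin
      D * ((t ^ p - 1#) * (t ^ q - 1#))
        ≈⟨ *-congˡ (*-cong (sym (geo-telescope t p)) (sym (geo-telescope t q))) ⟩
      D * (((t - 1#) * b) * ((t - 1#) * a))
        ≈⟨ solve 8 (λ a A b B C a′ b′ s → (a′ :* A :+ b′ :* B :- C :* (a′ :* b′)) :* ((s :* b) :* (s :* a)) :=
             s :* s :* ((b :* a′) :* (a :* A) :+ (a :* b′) :* (b :* B) :- C :* ((b :* a′) :* (a :* b′))))
             refl a A′ b B C a′ b′ s ⟩
      s * s * ((b * a′) * (a * A′) + (a * b′) * (b * B) - C * ((b * a′) * (a * b′)))
        ≈⟨ *-congˡ (+-cong (+-cong (*-congʳ (sym g≈ba′)) (*-congʳ (sym g≈ab′)))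
             (-‿cong (*-congˡ (*-cong (sym g≈ba′) (sym g≈ab′))))) ⟩
      s * s * (g * (a * A′) + g * (b * B) - C * (g * g))
        ≈⟨ solve 5 (λ s g x y C → s :* s :* (g :* x :+ g :* y :- C :* (g :* g)) :=
             s :* s :* (g :* ((x :+ y) :- g :* C))) refl s g (a * A′) (b * B) C ⟩
      s * s * (g * ((a * A′ + b * B) - g * C))
        ≈⟨ *-congˡ (*-congˡ (trans (+-congʳ combination)
             (solve 2 (λ o x → (o :+ x) :- x := o) refl 1# (g * C)))) ⟩
      s * s * (g * 1#)
        ≈⟨ trans (*-congˡ (*-identityʳ g)) (solve 2 (λ s g → s :* s :* g := (s :* g) :* s) refl s g) ⟩
      (s * g) * s
        ≈⟨ *-congʳ (geo-telescope t (p ℕ.* q)) ⟩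
      (t ^ (p ℕ.* q) - 1#) * (t - 1#)     ∎)
      where
      s a b g A′ B C a′ b′ D : Carrier
      s = t - 1#
      a = geo t q
      b = geo t p
      g = geo t (p ℕ.* q)
      A′ = geo (t ^ q) u
      B = t ^ (u ℕ.* q) * geo (t ^ p) v
      C = t * geo (t ^ (p ℕ.* q)) c
      a′ = geo (t ^ p) q
      b′ = geo (t ^ q) p
      D = a′ * A′ + b′ * B - C * (a′ * b′)
      g≈ab′ : g ≈ a * b′
      g≈ab′ = geo-* t p q
      g≈ba′ : g ≈ b * a′
      g≈ba′ = trans (reflexive (≡.cong (geo t) (ℕₚ.*-comm p q))) (geo-* t q p)
      combination : a * A′ + b * B ≈ 1# + g * C
      combination = begin
        a * A′ + b * B
          ≈⟨ +-cong (sym (geo-* t u q)) (trans (solve 3 (λ b x y → b :* (x :* y) := x :* (b :* y)) refl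
               b (t ^ (u ℕ.* q)) (geo (t ^ p) v)) (*-congˡ (sym (geo-* t v p)))) ⟩
        geo t (u ℕ.* q) + t ^ (u ℕ.* q) * geo t (v ℕ.* p)   ≈⟨ geo-+ t (u ℕ.* q) (v ℕ.* p) ⟨
        geo t (u ℕ.* q ℕ.+ v ℕ.* p)                         ≈⟨ reflexive (≡.cong (geo t) bezout) ⟩
        1# + t * geo t (c ℕ.* (p ℕ.* q))                    ≈⟨ +-congˡ (*-congˡ (geo-* t c (p ℕ.* q))) ⟩
        1# + t * (g * geo (t ^ (p ℕ.* q)) c)
          ≈⟨ +-congˡ (solve 3 (λ t g h → t :* (g :* h) := g :* (t :* h)) refl t g (geo (t ^ (p ℕ.* q)) c)) ⟩
        1# + g * C                                          ∎

    module _ (cancel : ∀ m f → f * (t ^ suc m - 1#) ≈ 0# → f ≈ 0#) where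

      -- The defining equation with t^p - 1 and t - 1 cancelled, where p stands for the successor.
      -- Unlike the defining equation, it still says something at α^p = 1: its right side there is
      -- q, so α cannot be a root.
      quotient-geo : ∀ p q {D} → IsQuotient (suc p) q D → D * geo t q ≈ geo (t ^ suc p) q
      quotient-geo p′ q {D} eq = x-y≈0⇒x≈y (cancel p′ _ (cancel 0 _ (begin
        (D * geo t q - geo (t ^ p) q) * (t ^ p - 1#) * (t * 1# - 1#)
          ≈⟨ *-congˡ (+-congʳ (*-identityʳ t)) ⟩
        (D * geo t q - geo (t ^ p) q) * (t ^ p - 1#) * (t - 1#)
          ≈⟨ solve 5 (λ D a h x y → (D :* a :- h) :* x :* y := D :* (x :* (y :* a)) :- (x :* h) :* y) refl
               D (geo t q) (geo (t ^ p) q) (t ^ p - 1#) (t - 1#) ⟩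
        D * ((t ^ p - 1#) * ((t - 1#) * geo t q)) - ((t ^ p - 1#) * geo (t ^ p) q) * (t - 1#)
          ≈⟨ +-cong (*-congˡ (*-congˡ (geo-telescope t q))) (-‿cong (*-congʳ (geo-telescope (t ^ p) q))) ⟩
        D * ((t ^ p - 1#) * (t ^ q - 1#)) - ((t ^ p) ^ q - 1#) * (t - 1#)
          ≈⟨ +-cong eq (-‿cong (*-congʳ (+-congʳ (^-assocʳ t p q)))) ⟩
        (t ^ (p ℕ.* q) - 1#) * (t - 1#) - (t ^ (p ℕ.* q) - 1#) * (t - 1#)
          ≈⟨ -‿inverseʳ _ ⟩
        0# ∎)))
        where p = suc p′

  module Alexander where
    private
      module P = Geometric Poly-algebra
      module Q = AlexanderQuotient Poly-algebra t

    t^-1-cancel : ∀ m f → f P.* (t P.^ suc m P.- P.1#) P.≈ P.0# → f P.≈ P.0#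
    t^-1-cancel m f eq = t^-fixed⇒0 m f (P.*[x-1]≈0⇒fixed {t P.^ suc m} {f} eq)

    tⁿ-1*tⁿ-1≈ : ∀ m n → tⁿ-1 m *ᵖ tⁿ-1 n ≈ᵖ (t P.^ m P.- P.1#) P.* (t P.^ n P.- P.1#)
    tⁿ-1*tⁿ-1≈ m n = P.*-cong {tⁿ-1 m} {t P.^ m P.- P.1#} {tⁿ-1 n} {t P.^ n P.- P.1#} (tⁿ-1≈ m) (tⁿ-1≈ n)

    tᵐ-1*t-1≈ : ∀ m → tⁿ-1 m *ᵖ tⁿ-1 1 ≈ᵖ (t P.^ m P.- P.1#) P.* (t P.- P.1#)
    tᵐ-1*t-1≈ m = P.trans {tⁿ-1 m *ᵖ tⁿ-1 1} {x P.* (t P.^ 1 P.- P.1#)} {x P.* (t P.- P.1#)} (tⁿ-1*tⁿ-1≈ m 1)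
      (P.*-congˡ {x} {t P.^ 1 P.- P.1#} {t P.- P.1#}
        (P.+-congʳ { P.- P.1#} {t P.^ 1} {t} (P.*-identityʳ t)))
      where x = t P.^ m P.- P.1#

    module _ (p q : ℕ) (D : Poly) where
      private
        denominator = tⁿ-1 p *ᵖ tⁿ-1 q
        denominator′ = (t P.^ p P.- P.1#) P.* (t P.^ q P.- P.1#)
        numerator = tⁿ-1 (p ℕ.* q) *ᵖ tⁿ-1 1
        numerator′ = (t P.^ (p ℕ.* q) P.- P.1#) P.* (t P.- P.1#)

      fromIsAlexander : IsAlexander p q D → Q.IsQuotient p q D
      fromIsAlexander eq = P.trans {D P.* denominator′} {D P.* denominator} {numerator′}
        (P.*-congˡ {D} {denominator′} {denominator} (P.sym {denominator} {denominator′} (tⁿ-1*tⁿ-1≈ p q)))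
        (P.trans {D P.* denominator} {numerator} {numerator′} eq (tᵐ-1*t-1≈ (p ℕ.* q)))

      toIsAlexander : Q.IsQuotient p q D → IsAlexander p q D
      toIsAlexander eq = P.trans {D P.* denominator} {D P.* denominator′} {numerator}
        (P.*-congˡ {D} {denominator} {denominator′} (tⁿ-1*tⁿ-1≈ p q))
        (P.trans {D P.* denominator′} {numerator′} {numerator} eq
          (P.sym {numerator} {numerator′} (tᵐ-1*t-1≈ (p ℕ.* q))))

    alexander : ∀ p q → Bézout⁺ p q → ∃[ D ] IsAlexander p q D
    alexander p q bezout = let D , eq = Q.quotient p q bezout in D , toIsAlexander p q D eq

    alexander-geo : ∀ p q D → IsAlexander (suc p) q D → D *ᵖ P.geo t q ≈ᵖ P.geo (t ^ᵖ suc p) q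
    alexander-geo p q D eq = Q.quotient-geo t^-1-cancel p q {D} (fromIsAlexander (suc p) q D eq)

    alexander-swap : ∀ p q D → IsAlexander p q D → IsAlexander q p D
    alexander-swap p q D eq = toIsAlexander q p D (Q.IsQuotient-swap p q {D} (fromIsAlexander p q D eq))

-- Roots of the Alexander polynomial from primitive roots of unity.

module AlexanderRoots where

  import Data.Nat.Solver as ℕ-Solver
  open import Data.Nat.Divisibility using (_∣_; _∤_; m%n≡0⇒n∣m; >⇒∤)
  open import Data.Nat.DivMod using (m≡m%n+[m/n]*n; m%n<n)
  open import Data.Nat.Coprimality using (Coprime; coprime-Bézout; coprime-divisor)
  open import Data.Nat.GCD using (module Bézout)
  open import Relation.Binary.Definitions using (tri<; tri≈; tri>)
  open import Defs using (_*ᵖ_; tⁿ-1; IsAlexander)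
  open Polynomials using (t; _^ᵖ_)
  open IntegerAlgebra

  -- A one-sided relation 1 + y q = x p becomes symmetric when y (p - 1) q is added to both sides,
  -- since y q then grows to y p q; the other orientation is treated alike.
  coprime⇒Bézout⁺ : ∀ {p q} → 1 ℕ.≤ p → 1 ℕ.≤ q → Coprime p q → Bézout⁺ p q
  coprime⇒Bézout⁺ {suc p} {suc q} _ _ cop with coprime-Bézout cop
  ... | Bézout.+- x y eq = y ℕ.* p , x , y , ≡.trans
          (≡.cong (y ℕ.* p ℕ.* suc q ℕ.+_) (≡.sym eq))
          (solve 3 (λ y p q → y :* p :* (con 1 :+ q) :+ (con 1 :+ y :* (con 1 :+ q)) :=
            con 1 :+ y :* ((con 1 :+ p) :* (con 1 :+ q))) ≡.refl y p q)
    where open ℕ-Solver.+-*-Solver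
  ... | Bézout.-+ x y eq = y , x ℕ.* q , x , ≡.trans
          (≡.cong (ℕ._+ x ℕ.* q ℕ.* suc p) (≡.sym eq))
          (solve 3 (λ x p q → (con 1 :+ x :* (con 1 :+ p)) :+ x :* q :* (con 1 :+ p) :=
            con 1 :+ x :* ((con 1 :+ p) :* (con 1 :+ q))) ≡.refl x p q)
    where open ℕ-Solver.+-*-Solver

  module LocalRing (A : ℤ-Algebra) where
    open Geometric A
    open Evaluation A

    -- The positive form of nonvanishing: unlike a negated equation, it permits cancellation.
    Unit : Carrier → Set
    Unit z = ∃[ w ] z * w ≈ 1#

    Unit-cong : ∀ {x y} → x ≈ y → Unit x → Unit y
    Unit-cong x≈y (w , eq) = w , trans (*-congʳ (sym x≈y)) eq

    Unit-* : ∀ {x y} → Unit x → Unit y → Unit (x * y)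
    Unit-* {x} {y} (v , p) (w , q) = v * w , (begin
      (x * y) * (v * w)   ≈⟨ solve 4 (λ x y v w → (x :* y) :* (v :* w) := (x :* v) :* (y :* w)) refl x y v w ⟩
      (x * v) * (y * w)   ≈⟨ *-cong p q ⟩
      1# * 1#             ≈⟨ *-identityˡ 1# ⟩
      1#                  ∎)

    Unit-factorˡ : ∀ {x y} → Unit (x * y) → Unit x
    Unit-factorˡ {x} {y} (w , eq) = y * w , trans (sym (*-assoc x y w)) eq

    Unit-1 : Unit 1#
    Unit-1 = 1# , *-identityˡ 1#

    Unit-^ : ∀ {x} n → Unit x → Unit (x ^ n)
    Unit-^ zero    u = Unit-1
    Unit-^ (suc n) u = Unit-* u (Unit-^ n u)

    Unit-cancel : ∀ {x y} → Unit x → x * y ≈ 0# → y ≈ 0#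
    Unit-cancel {x} {y} (w , xw≈1) xy≈0 = begin
      y             ≈⟨ *-identityˡ y ⟨
      1# * y        ≈⟨ *-congʳ xw≈1 ⟨
      x * w * y     ≈⟨ solve 3 (λ x w y → x :* w :* y := w :* (x :* y)) refl x w y ⟩
      w * (x * y)   ≈⟨ *-congˡ xy≈0 ⟩
      w * 0#        ≈⟨ zeroʳ w ⟩
      0#            ∎

    1^ : ∀ n → 1# ^ n ≈ 1#
    1^ zero    = refl
    1^ (suc n) = trans (*-identityˡ (1# ^ n)) (1^ n)

    root-^*ˡ : ∀ {x n} k → x ^ n ≈ 1# → x ^ (k ℕ.* n) ≈ 1#
    root-^*ˡ {x} {n} k eq = trans (^-congʳ x (ℕₚ.*-comm k n))
      (trans (sym (^-assocʳ x n k)) (trans (^-congˡ k eq) (1^ k)))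

    root-of-^ : ∀ {x} m n → x ^ (m ℕ.* n) ≈ 1# → (x ^ m) ^ n ≈ 1#
    root-of-^ {x} m n eq = trans (^-assocʳ x m n) eq

    PrimitiveRoot : ℕ → Carrier → Set
    PrimitiveRoot n z = z ^ n ≈ 1# × (∀ k → 1 ℕ.≤ k → k ℕ.< n → Unit (z ^ k - 1#))

    primitive-unit : ∀ {n z} → PrimitiveRoot (suc n) z → ∀ m → suc n ∤ m → Unit (z ^ m - 1#)
    primitive-unit {n} {z} (zⁿ≈1 , units) m n∤m = Unit-cong (+-congʳ (begin
        z ^ r                               ≈⟨ *-identityʳ (z ^ r) ⟨
        z ^ r * 1#                          ≈⟨ *-congˡ (root-^*ˡ {z} {suc n} (m ℕ./ suc n) zⁿ≈1) ⟨
        z ^ r * z ^ (m ℕ./ suc n ℕ.* suc n) ≈⟨ ^-homo-* z r _ ⟨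
        z ^ (r ℕ.+ m ℕ./ suc n ℕ.* suc n)   ≈⟨ ^-congʳ z (m≡m%n+[m/n]*n m (suc n)) ⟨
        z ^ m                               ∎))
      (units r (ℕₚ.n≢0⇒n>0 λ r≡0 → n∤m (m%n≡0⇒n∣m m (suc n) r≡0)) (m%n<n m (suc n)))
      where r = m ℕ.% suc n

    IsRoot : ℕ → ℕ → Carrier → Set
    IsRoot p q α = ∃[ D ] IsAlexander p q D × eval D α ≈ 0#

    record RootSystem (p′ q′ : ℕ) : Set where
      field
        rootAt     : ℕ → ℕ → Carrier
        isRoot     : ∀ i j → i ℕ.< p′ → j ℕ.< q′ → IsRoot (suc p′) (suc q′) (rootAt i j)
        injective  : ∀ {i j k l} → i ℕ.< p′ → j ℕ.< q′ → k ℕ.< p′ → l ℕ.< q′ →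
                     rootAt i j ≈ rootAt k l → i ≡ k × j ≡ l
        surjective : ∀ α → IsRoot (suc p′) (suc q′) α →
                     ∃[ i ] ∃[ j ] i ℕ.< p′ × j ℕ.< q′ × rootAt i j ≈ α

    sum : ℕ → (ℕ → Carrier) → Carrier
    sum zero    f = 0#
    sum (suc n) f = sum n f + f n

    sum-cong : ∀ n {f g} → (∀ i → f i ≈ g i) → sum n f ≈ sum n g
    sum-cong zero    h = refl
    sum-cong (suc n) h = +-cong (sum-cong n h) (h n)

    sum-+ : ∀ n f g → sum n (λ i → f i + g i) ≈ sum n f + sum n g
    sum-+ zero    f g = sym (+-identityˡ 0#)
    sum-+ (suc n) f g = trans (+-congʳ (sum-+ n f g))
      (solve 4 (λ a b c d → (a :+ b) :+ (c :+ d) := (a :+ c) :+ (b :+ d)) refl (sum n f) (sum n g) (f n) (g n))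

    sum-*ˡ : ∀ n c f → sum n (λ i → c * f i) ≈ c * sum n f
    sum-*ˡ zero    c f = sym (zeroʳ c)
    sum-*ˡ (suc n) c f = trans (+-congʳ (sum-*ˡ n c f)) (sym (distribˡ c (sum n f) (f n)))

    sum-powers : ∀ x n → sum n (x ^_) ≈ geo x n
    sum-powers x zero    = refl
    sum-powers x (suc n) = trans (+-congʳ (sum-powers x n)) (sym (geo-snoc x n))

    -- Orthogonality of characters: Σ_k z^(k m) = 0 unless m = 0.
    sum-geo : ∀ {n z} w → PrimitiveRoot (suc n) z → ∀ m → m ℕ.≤ n →
      sum (suc n) (λ k → geo (w * z ^ k) (suc m)) ≈ ι (ℤ.+ suc n)
    sum-geo {n} {z} w prim zero _ = begin
      sum (suc n) (λ k → 1# + w * z ^ k * 0#)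
        ≈⟨ sum-cong (suc n) (λ k → trans (+-congˡ (zeroʳ (w * z ^ k))) (trans (+-identityʳ 1#) (sym (1^ k)))) ⟩
      sum (suc n) (1# ^_)    ≈⟨ sum-powers 1# (suc n) ⟩
      geo 1# (suc n)         ≈⟨ geo-1 (suc n) ⟩
      ι (ℤ.+ suc n)          ∎
    sum-geo {n} {z} w prim (suc m) m<n = begin
      sum (suc n) (λ k → geo (w * z ^ k) (suc (suc m)))
        ≈⟨ sum-cong (suc n) (λ k → geo-snoc (w * z ^ k) (suc m)) ⟩
      sum (suc n) (λ k → geo (w * z ^ k) (suc m) + (w * z ^ k) ^ suc m)
        ≈⟨ sum-+ (suc n) _ _ ⟩
      sum (suc n) (λ k → geo (w * z ^ k) (suc m)) + sum (suc n) (λ k → (w * z ^ k) ^ suc m)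
        ≈⟨ +-cong (sum-geo w prim m (ℕₚ.<⇒≤ m<n)) (sum-cong (suc n) power) ⟩
      ι (ℤ.+ suc n) + sum (suc n) (λ k → w ^ suc m * (z ^ suc m) ^ k)
        ≈⟨ +-congˡ (trans (sum-*ˡ (suc n) (w ^ suc m) ((z ^ suc m) ^_)) (*-congˡ (sum-powers (z ^ suc m) (suc n)))) ⟩
      ι (ℤ.+ suc n) + w ^ suc m * geo (z ^ suc m) (suc n)
        ≈⟨ +-congˡ (trans (*-congˡ vanish) (zeroʳ _)) ⟩
      ι (ℤ.+ suc n) + 0#     ≈⟨ +-identityʳ _ ⟩
      ι (ℤ.+ suc n)          ∎
      where
      power : ∀ k → (w * z ^ k) ^ suc m ≈ w ^ suc m * (z ^ suc m) ^ k
      power k = trans (^-distrib-* w (z ^ k) (suc m)) (*-congˡ (trans (^-assocʳ z k (suc m))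
        (trans (^-congʳ z (ℕₚ.*-comm k (suc m))) (sym (^-assocʳ z (suc m) k)))))
      vanish : geo (z ^ suc m) (suc n) ≈ 0#
      vanish = Unit-cancel (proj₂ prim (suc m) (s≤s z≤n) (s≤s m<n)) (begin
        (z ^ suc m - 1#) * geo (z ^ suc m) (suc n)   ≈⟨ geo-telescope (z ^ suc m) (suc n) ⟩
        (z ^ suc m) ^ suc n - 1#
          ≈⟨ x≈y⇒x-y≈0 (trans (^-assocʳ z (suc m) (suc n)) (root-^*ˡ {z} {suc n} (suc m) (proj₁ prim))) ⟩
        0#                                           ∎)

    module _
      (nontrivial : ¬ 1# ≈ 0#)
      (local : ∀ a b → a + b ≈ 1# → Unit a ⊎ Unit b)
      (char0 : ∀ n → Unit (ι (ℤ.+ suc n)))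
      where

      Unit⇒≉0 : ∀ {x} → Unit x → ¬ x ≈ 0#
      Unit⇒≉0 {x} (w , eq) x≈0 = nontrivial (trans (sym eq) (trans (*-congʳ x≈0) (zeroˡ w)))

      local-sum : ∀ n f → Unit (sum n f) → ∃[ k ] k ℕ.< n × Unit (f k)
      local-sum zero f u = contradiction refl (Unit⇒≉0 u)
      local-sum (suc n) f (w , eq) with local (sum n f * w) (f n * w) (trans (sym (distribʳ w (sum n f) (f n))) eq)
      ... | inj₂ u = n , ℕₚ.≤-refl , Unit-factorˡ u
      ... | inj₁ u = let k , k<n , v = local-sum n f (Unit-factorˡ u) in k , ℕₚ.m<n⇒m<1+n k<n , v

      -- By `sum-geo` the geometric sums in w z^k add up to n + 1, which is invertible, so one of
      -- them is a unit. Times w z^k - 1 it gives (w z^k)^(n + 1) - 1 = 0; hence w z^k = 1.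
      roots-of-unity : ∀ {n z} → PrimitiveRoot (suc n) z → ∀ w → w ^ suc n ≈ 1# →
        ∃[ k ] k ℕ.< suc n × w ≈ z ^ k
      roots-of-unity {n} {z} prim w wⁿ≈1
        with local-sum (suc n) (λ k → geo (w * z ^ k) (suc n)) (Unit-cong (sym (sum-geo w prim n ℕₚ.≤-refl)) (char0 n))
      ... | k , k<n , u = inverse k k<n (x-y≈0⇒x≈y (Unit-cancel u (begin
        geo (w * z ^ k) (suc n) * (w * z ^ k - 1#)   ≈⟨ *-comm _ _ ⟩
        (w * z ^ k - 1#) * geo (w * z ^ k) (suc n)   ≈⟨ geo-telescope (w * z ^ k) (suc n) ⟩
        (w * z ^ k) ^ suc n - 1#
          ≈⟨ x≈y⇒x-y≈0 (begin
               (w * z ^ k) ^ suc n          ≈⟨ ^-distrib-* w (z ^ k) (suc n) ⟩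
               w ^ suc n * (z ^ k) ^ suc n  ≈⟨ *-cong wⁿ≈1 (trans (^-assocʳ z k (suc n)) (root-^*ˡ {z} {suc n} k (proj₁ prim))) ⟩
               1# * 1#                      ≈⟨ *-identityˡ 1# ⟩
               1#                           ∎) ⟩
        0#                                           ∎)))
        where
        inverse : ∀ k → k ℕ.< suc n → w * z ^ k ≈ 1# → ∃[ j ] j ℕ.< suc n × w ≈ z ^ j
        -- The exponent 0 is treated apart, as its complement n + 1 would be out of range.
        inverse zero    _   eq = 0 , s≤s z≤n , trans (sym (*-identityʳ w)) eq
        inverse (suc k) k<n eq = suc n ℕ.∸ suc k , s≤s (ℕₚ.m∸n≤m n k) , (begin
          w                                          ≈⟨ *-identityʳ w ⟨
          w * 1#                                     ≈⟨ *-congˡ (proj₁ prim) ⟨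
          w * z ^ suc n                              ≈⟨ *-congˡ (^-congʳ z (ℕₚ.m+[n∸m]≡n (ℕₚ.<⇒≤ k<n))) ⟨
          w * z ^ (suc k ℕ.+ (suc n ℕ.∸ suc k))      ≈⟨ *-congˡ (^-homo-* z (suc k) _) ⟩
          w * (z ^ suc k * z ^ (suc n ℕ.∸ suc k))    ≈⟨ *-assoc w _ _ ⟨
          w * z ^ suc k * z ^ (suc n ℕ.∸ suc k)      ≈⟨ *-congʳ eq ⟩
          1# * z ^ (suc n ℕ.∸ suc k)                 ≈⟨ *-identityˡ _ ⟩
          z ^ (suc n ℕ.∸ suc k)                      ∎)

      primitive-distinct : ∀ {n z} → PrimitiveRoot n z → ∀ i j → i ℕ.< j → j ℕ.< n → ¬ z ^ i ≈ z ^ j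
      primitive-distinct {n} {z} (zⁿ≈1 , units) i j i<j j<n eq = Unit⇒≉0
        (units d (ℕₚ.m<n⇒0<n∸m i<j) (ℕₚ.≤-<-trans (ℕₚ.m∸n≤m j i) j<n))
        (Unit-cancel {z ^ i} zⁱ-unit (begin
          z ^ i * (z ^ d - 1#)         ≈⟨ solve 3 (λ a b o → a :* (b :- o) := a :* b :- a :* o) refl (z ^ i) (z ^ d) 1# ⟩
          z ^ i * z ^ d - z ^ i * 1#   ≈⟨ +-cong (sym (^-homo-* z i d)) (-‿cong (*-identityʳ (z ^ i))) ⟩
          z ^ (i ℕ.+ d) - z ^ i        ≈⟨ +-cong (^-congʳ z (ℕₚ.m+[n∸m]≡n (ℕₚ.<⇒≤ i<j))) (-‿cong eq) ⟩
          z ^ j - z ^ j                ≈⟨ -‿inverseʳ (z ^ j) ⟩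
          0#                           ∎))
        where
        d = j ℕ.∸ i
        zⁱ-unit : Unit (z ^ i)
        zⁱ-unit = z ^ (n ℕ.∸ i) , trans (sym (^-homo-* z i (n ℕ.∸ i)))
          (trans (^-congʳ z (ℕₚ.m+[n∸m]≡n (ℕₚ.<⇒≤ (ℕₚ.<-trans i<j j<n)))) zⁿ≈1)

      primitive-injective : ∀ {n z} → PrimitiveRoot n z → ∀ i j → i ℕ.< n → j ℕ.< n → z ^ i ≈ z ^ j → i ≡ j
      primitive-injective prim i j i<n j<n eq with ℕₚ.<-cmp i j
      ... | tri< i<j _ _ = contradiction eq (primitive-distinct prim i j i<j j<n)
      ... | tri≈ _ i≡j _ = i≡j
      ... | tri> _ _ j<i = contradiction (sym eq) (primitive-distinct prim j i j<i i<n)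

      module _ {p′ q′ : ℕ} (coprime : Coprime (suc p′) (suc q′)) {x y : Carrier}
               (x-primitive : PrimitiveRoot (suc p′) x) (y-primitive : PrimitiveRoot (suc q′) y) where
        private
          p q : ℕ
          p = suc p′
          q = suc q′

        private
          bezout = coprime⇒Bézout⁺ {p} {q} (s≤s z≤n) (s≤s z≤n) coprime
          u = proj₁ bezout
          v = proj₁ (proj₂ bezout)
          c = proj₁ (proj₂ (proj₂ bezout))
          uq+vp : u ℕ.* q ℕ.+ v ℕ.* p ≡ 1 ℕ.+ c ℕ.* (p ℕ.* q)
          uq+vp = proj₂ (proj₂ (proj₂ bezout))

          -- u q and v p act as the complementary idempotents modulo p q: the powers z^(u q) and
          -- z^(v p) are the components of z among the p-th and the q-th roots of unity.
          split : ∀ {z} → z ^ (p ℕ.* q) ≈ 1# → z ^ (u ℕ.* q) * z ^ (v ℕ.* p) ≈ z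
          split {z} eq = begin
            z ^ (u ℕ.* q) * z ^ (v ℕ.* p)    ≈⟨ ^-homo-* z (u ℕ.* q) (v ℕ.* p) ⟨
            z ^ (u ℕ.* q ℕ.+ v ℕ.* p)        ≈⟨ ^-congʳ z uq+vp ⟩
            z * z ^ (c ℕ.* (p ℕ.* q))        ≈⟨ *-congˡ (root-^*ˡ {z} {p ℕ.* q} c eq) ⟩
            z * 1#                           ≈⟨ *-identityʳ z ⟩
            z                                ∎

          root-pq : ∀ {z} → z ^ p ≈ 1# → z ^ (p ℕ.* q) ≈ 1#
          root-pq {z} eq = trans (^-congʳ z (ℕₚ.*-comm p q)) (root-^*ˡ {z} {p} q eq)

          p-part : ∀ {z} → z ^ p ≈ 1# → z ^ (u ℕ.* q) ≈ z
          p-part {z} eq = trans (sym (*-identityʳ _)) (trans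
            (*-congˡ (sym (root-^*ˡ {z} {p} v eq))) (split (root-pq eq)))

          q-part : ∀ {z} → z ^ q ≈ 1# → z ^ (v ℕ.* p) ≈ z
          q-part {z} eq = trans (sym (*-identityˡ _)) (trans
            (*-congʳ (sym (root-^*ˡ {z} {q} u eq))) (split (root-^*ˡ {z} {q} p eq)))

        root : ℕ → ℕ → Carrier
        root i j = x ^ i * y ^ j

        private
          xⁱ-root : ∀ i → (x ^ i) ^ p ≈ 1#
          xⁱ-root i = root-of-^ i p (root-^*ˡ {x} {p} i (proj₁ x-primitive))

          yʲ-root : ∀ j → (y ^ j) ^ q ≈ 1#
          yʲ-root j = root-of-^ j q (root-^*ˡ {y} {q} j (proj₁ y-primitive))

          root-p-part : ∀ i j → root i j ^ (u ℕ.* q) ≈ x ^ i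
          root-p-part i j = trans (^-distrib-* (x ^ i) (y ^ j) (u ℕ.* q)) (trans
            (*-cong (p-part (xⁱ-root i)) (root-^*ˡ {y ^ j} {q} u (yʲ-root j))) (*-identityʳ (x ^ i)))

          root-q-part : ∀ i j → root i j ^ (v ℕ.* p) ≈ y ^ j
          root-q-part i j = trans (^-distrib-* (x ^ i) (y ^ j) (v ℕ.* p)) (trans
            (*-cong (root-^*ˡ {x ^ i} {p} v (xⁱ-root i)) (q-part (yʲ-root j))) (*-identityˡ (y ^ j)))

        root-injective : ∀ {i j k l} → i ℕ.< p → j ℕ.< q → k ℕ.< p → l ℕ.< q →
          root i j ≈ root k l → i ≡ k × j ≡ l
        root-injective {i} {j} {k} {l} i<p j<q k<p l<q eq =
          primitive-injective x-primitive i k i<p k<p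
            (trans (sym (root-p-part i j)) (trans (^-congˡ (u ℕ.* q) eq) (root-p-part k l))) ,
          primitive-injective y-primitive j l j<q l<q
            (trans (sym (root-q-part i j)) (trans (^-congˡ (v ℕ.* p) eq) (root-q-part k l)))

        -- α^(p q) = 1 annihilates the right side of the defining equation. On the left, α^p - 1 and
        -- α^q - 1 are units, because coprimality keeps p (j + 1) from being a multiple of q and q
        -- (i + 1) from being a multiple of p.
        root-isRoot : ∀ i j → suc i ℕ.< p → suc j ℕ.< q → IsRoot p q (root (suc i) (suc j))
        root-isRoot i j i<p j<q = D , isD , Unit-cancel (Unit-* αᵖ-1-unit α^q-1-unit) (begin
          (α ^ p - 1#) * (α ^ q - 1#) * eval D α
            ≈⟨ trans (*-comm _ _) (*-congˡ (*-cong (sym (eval-tⁿ-1 p α)) (sym (eval-tⁿ-1 q α)))) ⟩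
          eval D α * (eval (tⁿ-1 p) α * eval (tⁿ-1 q) α)
            ≈⟨ trans (*-congˡ (sym (eval-* (tⁿ-1 p) (tⁿ-1 q) α))) (sym (eval-* D (tⁿ-1 p *ᵖ tⁿ-1 q) α)) ⟩
          eval (D *ᵖ (tⁿ-1 p *ᵖ tⁿ-1 q)) α
            ≈⟨ eval-cong (D *ᵖ (tⁿ-1 p *ᵖ tⁿ-1 q)) (tⁿ-1 (p ℕ.* q) *ᵖ tⁿ-1 1) α isD ⟩
          eval (tⁿ-1 (p ℕ.* q) *ᵖ tⁿ-1 1) α
            ≈⟨ trans (eval-* (tⁿ-1 (p ℕ.* q)) (tⁿ-1 1) α) (*-congʳ (eval-tⁿ-1 (p ℕ.* q) α)) ⟩
          (α ^ (p ℕ.* q) - 1#) * eval (tⁿ-1 1) α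
            ≈⟨ trans (*-congʳ (x≈y⇒x-y≈0 αᵖᑫ≈1)) (zeroˡ _) ⟩
          0# ∎)
          where
          α = root (suc i) (suc j)
          D = proj₁ (Alexander.alexander p q bezout)
          isD : IsAlexander p q D
          isD = proj₂ (Alexander.alexander p q bezout)
          αᵖ≈ : α ^ p ≈ y ^ (suc j ℕ.* p)
          αᵖ≈ = trans (^-distrib-* (x ^ suc i) (y ^ suc j) p) (trans
            (*-cong (xⁱ-root (suc i)) (^-assocʳ y (suc j) p)) (*-identityˡ _))
          α^q≈ : α ^ q ≈ x ^ (suc i ℕ.* q)
          α^q≈ = trans (^-distrib-* (x ^ suc i) (y ^ suc j) q) (trans
            (*-cong (^-assocʳ x (suc i) q) (yʲ-root (suc j))) (*-identityʳ _))
          αᵖᑫ≈1 : α ^ (p ℕ.* q) ≈ 1#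
          αᵖᑫ≈1 = trans (^-distrib-* (x ^ suc i) (y ^ suc j) (p ℕ.* q)) (trans
            (*-cong (root-pq (xⁱ-root (suc i))) (root-^*ˡ {y ^ suc j} {q} p (yʲ-root (suc j)))) (*-identityˡ 1#))
          αᵖ-1-unit : Unit (α ^ p - 1#)
          αᵖ-1-unit = Unit-cong (+-congʳ (sym αᵖ≈)) (primitive-unit y-primitive _ λ q∣jp →
            >⇒∤ j<q (coprime-divisor (λ (a , b) → coprime (b , a)) (≡.subst (q ∣_) (ℕₚ.*-comm (suc j) p) q∣jp)))
          α^q-1-unit : Unit (α ^ q - 1#)
          α^q-1-unit = Unit-cong (+-congʳ (sym α^q≈)) (primitive-unit x-primitive _ λ p∣iq →
            >⇒∤ i<p (coprime-divisor coprime (≡.subst (p ∣_) (ℕₚ.*-comm (suc i) q) p∣iq)))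

        private
          module P = Geometric Poly-algebra

          geo-vanish : ∀ m n {D α} → IsAlexander (suc m) n D → eval D α ≈ 0# → geo (α ^ suc m) n ≈ 0#
          geo-vanish m n {D} {α} isD Dα≈0 = begin
            geo (α ^ suc m) n                   ≈⟨ geo-cong n (eval-t^ (suc m) α) ⟨
            geo (eval (t ^ᵖ suc m) α) n         ≈⟨ eval-geo (t ^ᵖ suc m) n α ⟨
            eval (P.geo (t ^ᵖ suc m) n) α
              ≈⟨ eval-cong (D *ᵖ P.geo t n) (P.geo (t ^ᵖ suc m) n) α (Alexander.alexander-geo m n D isD) ⟨
            eval (D *ᵖ P.geo t n) α             ≈⟨ eval-* D (P.geo t n) α ⟩
            eval D α * eval (P.geo t n) α       ≈⟨ trans (*-congʳ Dα≈0) (zeroˡ _) ⟩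
            0#                                  ∎

          geo-1≉0 : ∀ n {a} → a ≈ 1# → ¬ geo a (suc n) ≈ 0#
          geo-1≉0 n a≈1 eq = Unit⇒≉0 (char0 n) (trans (sym (geo-1 (suc n))) (trans (geo-cong (suc n) (sym a≈1)) eq))

        -- Both components of α are powers of the primitive roots. A zero exponent would give α^q =
        -- 1 or α^p = 1, where the geometric sum that has to vanish with D α equals p or q.
        root-surjective : ∀ {α} → IsRoot p q α →
          ∃[ i ] ∃[ j ] suc i ℕ.< p × suc j ℕ.< q × α ≈ root (suc i) (suc j)
        root-surjective {α} (D , isD , Dα≈0) =
          let i , i<p , xi = roots-of-unity x-primitive (α ^ (u ℕ.* q)) p-part-root
              j , j<q , yj = roots-of-unity y-primitive (α ^ (v ℕ.* p)) q-part-root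
          in locate i j i<p j<q (trans (sym (split αᵖᑫ≈1)) (*-cong xi yj))
          where
          αᵖᑫ≈1 : α ^ (p ℕ.* q) ≈ 1#
          αᵖᑫ≈1 = trans (sym (^-assocʳ α p q)) (x-y≈0⇒x≈y (trans (sym (geo-telescope (α ^ p) q))
            (trans (*-congˡ (geo-vanish p′ q {D} {α} isD Dα≈0)) (zeroʳ _))))
          p-part-root : (α ^ (u ℕ.* q)) ^ p ≈ 1#
          p-part-root = root-of-^ (u ℕ.* q) p (trans
            (^-congʳ α (≡.trans (ℕₚ.*-assoc u q p) (≡.cong (u ℕ.*_) (ℕₚ.*-comm q p))))
            (root-^*ˡ {α} {p ℕ.* q} u αᵖᑫ≈1))
          q-part-root : (α ^ (v ℕ.* p)) ^ q ≈ 1#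
          q-part-root = root-of-^ (v ℕ.* p) q (trans (^-congʳ α (ℕₚ.*-assoc v p q)) (root-^*ˡ {α} {p ℕ.* q} v αᵖᑫ≈1))
          locate : ∀ i j → i ℕ.< p → j ℕ.< q → α ≈ root i j →
            ∃[ i ] ∃[ j ] suc i ℕ.< p × suc j ℕ.< q × α ≈ root (suc i) (suc j)
          locate zero j _ _ eq = contradiction
            (geo-vanish q′ p {D} {α} (Alexander.alexander-swap p q D isD) Dα≈0)
            (geo-1≉0 p′ (trans (^-congˡ q (trans eq (*-identityˡ (y ^ j)))) (yʲ-root j)))
          locate (suc i) zero _ _ eq = contradiction (geo-vanish p′ q {D} {α} isD Dα≈0)
            (geo-1≉0 q′ (trans (^-congˡ p (trans eq (*-identityʳ (x ^ suc i)))) (xⁱ-root (suc i))))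
          locate (suc i) (suc j) i<p j<q eq = i , j , i<p , j<q , eq

        rootSystem : RootSystem p′ q′
        rootSystem = record
          { rootAt = λ i j → root (suc i) (suc j)
          ; isRoot = λ i j i<p j<q → root-isRoot i j (s≤s i<p) (s≤s j<q)
          ; injective = λ i<p j<q k<p l<q eq →
              let i≡k , j≡l = root-injective (s≤s i<p) (s≤s j<q) (s≤s k<p) (s≤s l<q) eq
              in ℕₚ.suc-injective i≡k , ℕₚ.suc-injective j≡l
          ; surjective = λ α isRoot →
              let i , j , i<p , j<q , α≈ = root-surjective isRoot
              in i , j , ℕₚ.≤-pred i<p , ℕₚ.≤-pred j<q , sym α≈
          }

-- Lucas sequences and the order of a quotient w / w̄.

module LucasSequences where

  open IntegerAlgebra using (ℤ-Algebra; module Geometric)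
  open AlexanderRoots using (module LocalRing)

  module Lucas (A : ℤ-Algebra) where
    open Geometric A
    open LocalRing A

    module _ (w w̄ : Carrier) (B : ℕ → Carrier) (B₀ : B 0 ≈ 0#) (B₁ : B 1 ≈ 1#)
      (B₂ : ∀ k → B (suc (suc k)) ≈ (w + w̄) * B (suc k) - (w * w̄) * B k) where

      -- Both sides satisfy the linear recursion with characteristic roots w and w̄. It has order
      -- two, so the induction carries two consecutive indices.
      lucas : ∀ k → (w ^ k - w̄ ^ k ≈ (w - w̄) * B k) × (w ^ suc k - w̄ ^ suc k ≈ (w - w̄) * B (suc k))
      lucas zero =
        trans (-‿inverseʳ 1#) (sym (trans (*-congˡ B₀) (zeroʳ (w - w̄)))) ,
        trans (+-cong (*-identityʳ w) (-‿cong (*-identityʳ w̄)))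
          (sym (trans (*-congˡ B₁) (*-identityʳ (w - w̄))))
      lucas (suc k) = let p , q = lucas k in q , (begin
        w * (w * w ^ k) - w̄ * (w̄ * w̄ ^ k)
          ≈⟨ solve 4 (λ w v p q → w :* (w :* p) :- v :* (v :* q) :=
               (w :+ v) :* (w :* p :- v :* q) :- (w :* v) :* (p :- q)) refl w w̄ (w ^ k) (w̄ ^ k) ⟩
        (w + w̄) * (w ^ suc k - w̄ ^ suc k) - (w * w̄) * (w ^ k - w̄ ^ k)
          ≈⟨ +-cong (*-congˡ q) (-‿cong (*-congˡ p)) ⟩
        (w + w̄) * ((w - w̄) * B (suc k)) - (w * w̄) * ((w - w̄) * B k)
          ≈⟨ solve 5 (λ s m d x y → s :* (d :* x) :- m :* (d :* y) :=
               d :* (s :* x :- m :* y)) refl (w + w̄) (w * w̄) (w - w̄) (B (suc k)) (B k) ⟩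
        (w - w̄) * ((w + w̄) * B (suc k) - (w * w̄) * B k)   ≈⟨ *-congˡ (sym (B₂ k)) ⟩
        (w - w̄) * B (suc (suc k))                          ∎)

      -- With v = 1 / w̄, the difference (w v)^k - 1 is (w - w̄) B k v^k, so zeros and units of B
      -- translate directly.
      lucas-primitive : ∀ {n v} → w̄ * v ≈ 1# → Unit (w - w̄) → B n ≈ 0# →
        (∀ k → 1 ℕ.≤ k → k ℕ.< n → Unit (B k)) → PrimitiveRoot n (w * v)
      lucas-primitive {n} {v} w̄v≈1 w-w̄-unit Bn≈0 B-unit =
        x-y≈0⇒x≈y (trans (power n) (trans (*-congʳ (trans (*-congˡ Bn≈0) (zeroʳ (w - w̄)))) (zeroˡ (v ^ n)))) ,
        λ k 1≤k k<n → Unit-cong (sym (power k)) (Unit-* (Unit-* w-w̄-unit (B-unit k 1≤k k<n))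
          (Unit-^ k (w̄ , trans (*-comm v w̄) w̄v≈1)))
        where
        power : ∀ k → (w * v) ^ k - 1# ≈ (w - w̄) * B k * v ^ k
        power k = begin
          (w * v) ^ k - 1#
            ≈⟨ +-cong (^-distrib-* w v k) (-‿cong (trans (sym (1^ k))
                 (trans (^-congˡ k (sym w̄v≈1)) (^-distrib-* w̄ v k)))) ⟩
          w ^ k * v ^ k - w̄ ^ k * v ^ k
            ≈⟨ solve 3 (λ a b c → a :* c :- b :* c := (a :- b) :* c) refl (w ^ k) (w̄ ^ k) (v ^ k) ⟩
          (w ^ k - w̄ ^ k) * v ^ k     ≈⟨ *-congʳ (proj₁ (lucas k)) ⟩
          (w - w̄) * B k * v ^ k       ∎

-- Bisection for a decidable property of rationals.

module Bisection where

  open import Data.Rational.Base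
  open import Defs using (ℝ; mkℝ; _≈_)
  open ℚₚ
  open ≡ using (refl; trans; cong; cong₂; subst)
  open RationalOrder

  open ℚ-Solver.+-*-Solver using (solve; _:=_; _:+_; _:*_; _:-_; :-_; con)

  -- The limit is a point where `Q` changes: `lo` reaches it through points with `Q`, and `hi`
  -- through points without. Both sequences are kept, because each carries one half of this
  -- information.
  module Bisect {Q : ℚ → Set} (Q? : Decidable Q) {a b : ℚ} (a≤b : a ≤ b) (Qa : Q a) (¬Qb : ¬ Q b) where

    record Bracket : Set where
      field
        left right : ℚ
        left≤right : left ≤ right
        Q-left     : Q left
        ¬Q-right   : ¬ Q right

      width : ℚ
      width = right - left

    open Bracket

    halve : (s : Bracket) → ∃[ s′ ] width s′ ≡ width s * ½ × left s ≤ left s′ × right s′ ≤ right s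
    halve s with Q? ((left s + right s) * ½)
    ... | yes q = record { left = m ; right = r ; left≤right = m≤r ; Q-left = q ; ¬Q-right = ¬Q-right s } ,
        solve 2 (λ l r → r :- (l :+ r) :* con ½ := (r :- l) :* con ½) refl l r , l≤m , ≤-refl
      where
      l = left s
      r = right s
      m = (l + r) * ½
      0≤w/2 = 0≤* (0≤-diff (left≤right s)) (<⇒≤ 0<½)
      l≤m = ≤-by ((r - l) * ½) 0≤w/2 (solve 2 (λ l r → l :+ (r :- l) :* con ½ := (l :+ r) :* con ½) refl l r)
      m≤r = ≤-by ((r - l) * ½) 0≤w/2 (solve 2 (λ l r → (l :+ r) :* con ½ :+ (r :- l) :* con ½ := r) refl l r)
    ... | no ¬q = record { left = l ; right = m ; left≤right = l≤m ; Q-left = Q-left s ; ¬Q-right = ¬q } ,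
        solve 2 (λ l r → (l :+ r) :* con ½ :- l := (r :- l) :* con ½) refl l r , ≤-refl , m≤r
      where
      l = left s
      r = right s
      m = (l + r) * ½
      0≤w/2 = 0≤* (0≤-diff (left≤right s)) (<⇒≤ 0<½)
      l≤m = ≤-by ((r - l) * ½) 0≤w/2 (solve 2 (λ l r → l :+ (r :- l) :* con ½ := (l :+ r) :* con ½) refl l r)
      m≤r = ≤-by ((r - l) * ½) 0≤w/2 (solve 2 (λ l r → (l :+ r) :* con ½ :+ (r :- l) :* con ½ := r) refl l r)

    bracket : ℕ → Bracket
    bracket zero    = record { left = a ; right = b ; left≤right = a≤b ; Q-left = Qa ; ¬Q-right = ¬Qb }
    bracket (suc n) = proj₁ (halve (bracket n))

    lo hi w : ℕ → ℚ
    lo n = left (bracket n)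
    hi n = right (bracket n)
    w n = width (bracket n)

    lo-mono : ∀ j n → lo n ≤ lo (j ℕ.+ n)
    lo-mono zero    n = ≤-refl
    lo-mono (suc j) n = ≤-trans (lo-mono j n) (proj₁ (proj₂ (proj₂ (halve (bracket (j ℕ.+ n))))))

    hi-mono : ∀ j n → hi (j ℕ.+ n) ≤ hi n
    hi-mono zero    n = ≤-refl
    hi-mono (suc j) n = ≤-trans (proj₂ (proj₂ (proj₂ (halve (bracket (j ℕ.+ n)))))) (hi-mono j n)

    0≤w : ∀ n → 0ℚ ≤ w n
    0≤w n = 0≤-diff (left≤right (bracket n))

    -- A linear rate in place of the true 2^(-n), by n + 2 ≤ 2 (n + 1); it feeds directly into
    -- `archimedean`.
    w-bound : ∀ n → ⟦ suc n ⟧ * w n ≤ w 0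
    w-bound zero = ≤-reflexive (trans (cong (_* w 0) ⟦1⟧) (*-identityˡ (w 0)))
    w-bound (suc n) = begin
      ⟦ suc (suc n) ⟧ * w (suc n)      ≡⟨ cong₂ _*_ (⟦⟧-suc (suc n)) (proj₁ (proj₂ (halve (bracket n)))) ⟩
      (1ℚ + ⟦ suc n ⟧) * (w n * ½)
        ≤⟨ *-monoʳ-≤ (w n * ½) (0≤* (0≤w n) (<⇒≤ 0<½))
             (+-monoˡ-≤ ⟦ suc n ⟧ (subst (_≤ ⟦ suc n ⟧) ⟦1⟧ (⟦⟧-mono-≤ (s≤s z≤n)))) ⟩
      (⟦ suc n ⟧ + ⟦ suc n ⟧) * (w n * ½)
        ≡⟨ solve 2 (λ n w → (n :+ n) :* (w :* con ½) := n :* w) refl ⟦ suc n ⟧ (w n) ⟩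
      ⟦ suc n ⟧ * w n                  ≤⟨ w-bound n ⟩
      w 0                              ∎
      where open ≤-Reasoning

    w-small : ∀ ε → 0ℚ < ε → ∃[ N ] w N < ε
    w-small ε 0<ε =
      let r , 0<r , εr≡1 = reciprocal 0<ε
          N , wr<N = archimedean (w 0 * r)
      in N , ≰⇒> λ ε≤wN → <-irrefl refl (begin-strict
        ⟦ N ⟧                      ≤⟨ ⟦⟧-mono-≤ (ℕₚ.n≤1+n N) ⟩
        ⟦ suc N ⟧                  ≡⟨ trans (cong (⟦ suc N ⟧ *_) εr≡1) (*-identityʳ ⟦ suc N ⟧) ⟨
        ⟦ suc N ⟧ * (ε * r)        ≡⟨ *-assoc ⟦ suc N ⟧ ε r ⟨
        ⟦ suc N ⟧ * ε * r          ≤⟨ *-monoʳ-≤ r (<⇒≤ 0<r) (*-monoˡ-≤ ⟦ suc N ⟧ (0≤⟦⟧ (suc N)) ε≤wN) ⟩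
        ⟦ suc N ⟧ * w N * r        ≤⟨ *-monoʳ-≤ r (<⇒≤ 0<r) (w-bound N) ⟩
        w 0 * r                    <⟨ wr<N ⟩
        ⟦ N ⟧                      ∎)
      where open ≤-Reasoning

    within : ∀ {N m} → N ℕ.≤ m → lo N ≤ lo m × lo m ≤ hi m × hi m ≤ hi N
    within {N} {m} N≤m =
      subst (λ k → lo N ≤ lo k) (ℕₚ.m∸n+n≡m N≤m) (lo-mono (m ℕ.∸ N) N) ,
      left≤right (bracket m) ,
      subst (λ k → hi k ≤ hi N) (ℕₚ.m∸n+n≡m N≤m) (hi-mono (m ℕ.∸ N) N)

    close : ∀ {N x y} → lo N ≤ x → x ≤ hi N → lo N ≤ y → y ≤ hi N → ∣ x - y ∣ ≤ w N
    close {N} {x} {y} lo≤x x≤hi lo≤y y≤hi = ∣p-q∣≤ x y (bound x≤hi lo≤y) (bound y≤hi lo≤x)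
      where
      bound : ∀ {u v} → u ≤ hi N → lo N ≤ v → u ≤ v + w N
      bound {u} {v} u≤hi lo≤v = ≤-by ((hi N - u) + (v - lo N)) (0≤+ (0≤-diff u≤hi) (0≤-diff lo≤v))
        (solve 4 (λ u v l h → u :+ ((h :- u) :+ (v :- l)) := v :+ (h :- l)) refl u v (lo N) (hi N))

    infimum supremum : ℝ
    infimum = mkℝ hi λ ε 0<ε → let N , wN<ε = w-small ε 0<ε in N , λ m n N≤m N≤n →
      let a , b , c = within N≤m ; a′ , b′ , c′ = within N≤n in
      ≤-<-trans (close {N} (≤-trans a b) c (≤-trans a′ b′) c′) wN<ε
    supremum = mkℝ lo λ ε 0<ε → let N , wN<ε = w-small ε 0<ε in N , λ m n N≤m N≤n →
      let a , b , c = within N≤m ; a′ , b′ , c′ = within N≤n in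
      ≤-<-trans (close {N} a (≤-trans b c) a′ (≤-trans b′ c′)) wN<ε

    supremum≈infimum : supremum ≈ infimum
    supremum≈infimum ε 0<ε = let N , wN<ε = w-small ε 0<ε in N , λ n N≤n →
      let a , b , c = within N≤n in
      ≤-<-trans (close {N} a (≤-trans b c) (≤-trans a b) c) wN<ε

    Q-lo : ∀ n → Q (lo n)
    Q-lo n = Q-left (bracket n)

    ¬Q-hi : ∀ n → ¬ Q (hi n)
    ¬Q-hi n = ¬Q-right (bracket n)

    a≤lo : ∀ n → a ≤ lo n
    a≤lo n = proj₁ (within {0} {n} z≤n)

-- ℂ as a local ring of characteristic 0.

module ComplexField where

  open import Data.List.Base using ([]; _∷_)
  open import Defs
  open ≡ using (refl; sym; trans; cong; subst)
  open RationalOrder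
  open RealNumbers
  open IntegerAlgebra using (ℤ-Algebra; module Geometric; module Evaluation)
  open AlexanderRoots using (module LocalRing)

  open ℚ-Solver.+-*-Solver using (solve; _:=_; _:+_; _:*_; _:-_; :-_; con)

  ≈ᶜ-pointwise : ∀ z w → (∀ n → seq (re z) n ≡ seq (re w) n) →
    (∀ n → seq (im z) n ≡ seq (im w) n) → z ≈ᶜ w
  ≈ᶜ-pointwise z w p q = ≈-pointwise {re z} {re w} p , ≈-pointwise {im z} {im w} q

  /1-homo-neg : ∀ a → (ℤ.- a) ℚ./ 1 ≡ ℚ.- (a ℚ./ 1)
  /1-homo-neg a = trans
    (solve 2 (λ x y → y := (y :+ x) :- x) refl (a ℚ./ 1) ((ℤ.- a) ℚ./ 1))
    (trans (cong (ℚ._- (a ℚ./ 1)) (trans (sym (/1-homo-+ (ℤ.- a) a)) (cong (ℚ._/ 1) (ℤₚ.+-inverseˡ a))))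
      (ℚₚ.+-identityˡ (ℚ.- (a ℚ./ 1))))

  ℂ-algebra : ℤ-Algebra
  ℂ-algebra = record
    { ring = ℂ-commutativeRing
    ; ι = ℤ→ℂ
    ; ι-+ = λ a b → ≈ᶜ-pointwise (ℤ→ℂ (a ℤ.+ b)) (ℤ→ℂ a +ᶜ ℤ→ℂ b) (λ _ → /1-homo-+ a b) (λ _ → refl)
    ; ι-* = λ a b → ≈ᶜ-pointwise (ℤ→ℂ (a ℤ.* b)) (ℤ→ℂ a *ᶜ ℤ→ℂ b)
        (λ _ → trans (/1-homo-* a b) (solve 1 (λ x → x := x :- con 0ℚ :* con 0ℚ) refl ((a ℚ./ 1) ℚ.* (b ℚ./ 1))))
        (λ _ → solve 2 (λ x y → con 0ℚ := x :* con 0ℚ :+ con 0ℚ :* y) refl (a ℚ./ 1) (b ℚ./ 1))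
    ; ι-neg = λ a → ≈ᶜ-pointwise (ℤ→ℂ (ℤ.- a)) ((- fromℤ a) +i (- 0ℝ)) (λ _ → /1-homo-neg a) (λ _ → refl)
    ; ι-0 = ≈-refl {0ℝ} , ≈-refl {0ℝ}
    ; ι-1 = ≈-refl {1ℝ} , ≈-refl {0ℝ}
    }

  open LocalRing ℂ-algebra public
  open Evaluation ℂ-algebra public using (eval)
  private module R = Geometric ℂ-algebra

  eval-unique : ∀ f z → evalᶜ f z ≈ᶜ eval f z
  eval-unique []      z = R.refl {0ᶜ}
  eval-unique (a ∷ f) z = R.trans {evalᶜ (a ∷ f) z} {ℤ→ℂ a R.+ z R.* evalᶜ f z} {eval (a ∷ f) z}
    (≈ᶜ-pointwise (evalᶜ (a ∷ f) z) (ℤ→ℂ a R.+ z R.* evalᶜ f z) (λ n → refl) (λ n → refl))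
    (R.+-congˡ {ℤ→ℂ a} {z R.* evalᶜ f z} {z R.* eval f z} (R.*-congˡ {z} {evalᶜ f z} {eval f z} (eval-unique f z)))

  1≉0 : ¬ ℤ→ℂ (ℤ.+ 1) ≈ᶜ 0ᶜ
  1≉0 (eq , _) = ℚₚ.<-irrefl refl (proj₂ (ev-witness (eq 1ℚ 0<1)))

  ι-unit : ∀ n → Unit (ℤ→ℂ (ℤ.+ suc n))
  ι-unit n = fromℚ (1/ n +1) +i 0ℝ , ≈ᶜ-pointwise (ℤ→ℂ (ℤ.+ suc n) *ᶜ (fromℚ (1/ n +1) +i 0ℝ)) (ℤ→ℂ (ℤ.+ 1))
    (λ _ → trans (solve 1 (λ x → x :- con 0ℚ :* con 0ℚ := x) refl ((ℤ.+ suc n ℚ./ 1) ℚ.* 1/ n +1))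
      (subst (λ q → q ℚ.* 1/ n +1 ≡ 1ℚ) (⟦⟧-def (suc n)) (1/+1-* n)))
    (λ _ → solve 2 (λ x y → x :* con 0ℚ :+ con 0ℚ :* y := con 0ℚ) refl (ℤ.+ suc n ℚ./ 1) (1/ n +1))

  norm² : ℂ → ℝ
  norm² z = re z * re z + im z * im z

  norm²#0⇒Unit : ∀ z → norm² z #0 → Unit z
  norm²#0⇒Unit z z#0 = (re z * v) +i (- (im z * v)) ,
    ≈-trans {re (z *ᶜ w)} {norm² z * v} {1ℝ}
      (≈-pointwise {re (z *ᶜ w)} {norm² z * v} λ n →
        solve 3 (λ a b v → a :* (a :* v) :- b :* (:- (b :* v)) := (a :* a :+ b :* b) :* v) refl
          (seq (re z) n) (seq (im z) n) (seq v n))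
      (*-inverseʳ (norm² z) z#0) ,
    ≈-pointwise {im (z *ᶜ w)} {0ℝ} λ n →
      solve 3 (λ a b v → a :* (:- (b :* v)) :+ b :* (a :* v) := con 0ℚ) refl
        (seq (re z) n) (seq (im z) n) (seq v n)
    where
    v = norm² z ⁻¹[ z#0 ]
    w = (re z * v) +i (- (im z * v))

  -- The index comes from the Cauchy modulus alone, so it is known before any term is tested; a
  -- single rational comparison then yields apartness from 0.
  stays-large : ∀ x δ → 0ℚ ℚ.< δ → ∃[ N ] ∀ m → N ℕ.≤ m → δ ℚ.+ δ ℚ.≤ seq x m → x #0
  stays-large x δ 0<δ with cauchy x δ 0<δ
  ... | N , close = N , λ m N≤m large → positive⇒#0 {x} δ 0<δ (N , λ n N≤n →
    ≤-by ((seq x m ℚ.- (δ ℚ.+ δ)) ℚ.+ (δ ℚ.- (seq x m ℚ.- seq x n)))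
      (0≤+ (0≤-diff large) (0≤-diff (ℚₚ.<⇒≤ (ℚₚ.≤-<-trans (p≤∣p∣ (seq x m ℚ.- seq x n)) (close m n N≤m N≤n)))))
      (solve 3 (λ d x y → d :+ ((x :- (d :+ d)) :+ (d :- (x :- y))) := y) refl δ (seq x m) (seq x n)))

  -- (Re z)² + (Re w)² ≥ (Re z + Re w)² / 2, so |z|² and |w|² cannot both be small.
  ℂ-local : ∀ z w → z +ᶜ w ≈ᶜ ℤ→ℂ (ℤ.+ 1) → Unit z ⊎ Unit w
  ℂ-local z w (eq , _) = decide (seq (norm² z) m ℚₚ.<? 1/16) (seq (norm² w) m ℚₚ.<? 1/16)
    where
    -- If both squared norms were below 1/16, then (Re z + Re w)² < 4/16 = 1/4, against Re z + Re w
    -- > ½. Half of 1/16 is given up to the variation of the sequence.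
    1/32 1/16 : ℚ
    1/32 = ½ ℚ.* ½ ℚ.* ½ ℚ.* ½ ℚ.* ½
    1/16 = 1/32 ℚ.+ 1/32
    0<1/32 : 0ℚ ℚ.< 1/32
    0<1/32 = ℚₚ.positive⁻¹ 1/32
    zN = stays-large (norm² z) 1/32 0<1/32
    wN = stays-large (norm² w) 1/32 0<1/32
    sN = eq ½ 0<½
    m = proj₁ zN ℕ.⊔ (proj₁ wN ℕ.⊔ proj₁ sN)
    a b c d : ℚ
    a = seq (re z) m
    b = seq (im z) m
    c = seq (re w) m
    d = seq (im w) m
    ½<a+c : ½ ℚ.< a ℚ.+ c
    ½<a+c = <-by (½ ℚ.- (1ℚ ℚ.- (a ℚ.+ c))) (0<-diff (ℚₚ.≤-<-trans
        (ℚₚ.≤-trans (p≤∣p∣ (1ℚ ℚ.- (a ℚ.+ c))) (ℚₚ.≤-reflexive (∣p-q∣-comm 1ℚ (a ℚ.+ c))))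
        (proj₂ sN m (ℕₚ.≤-trans (ℕₚ.m≤n⊔m (proj₁ wN) (proj₁ sN)) (ℕₚ.m≤n⊔m (proj₁ zN) _)))))
      (solve 1 (λ s → con ½ :+ (con ½ :- (con 1ℚ :- s)) := s) refl (a ℚ.+ c))
    impossible : seq (norm² z) m ℚ.< 1/16 → seq (norm² w) m ℚ.< 1/16 → ¬ ½ ℚ.< a ℚ.+ c
    impossible z<1/16 w<1/16 h = ℚₚ.<-irrefl {½ ℚ.* ½} refl (begin-strict
      ½ ℚ.* ½                            <⟨ ℚₚ.*-monoʳ-<-pos ½ h ⟩
      ½ ℚ.* (a ℚ.+ c)                    <⟨ ℚₚ.*-monoˡ-<-pos (a ℚ.+ c) {{ℚ.positive (ℚₚ.<-trans 0<½ h)}} h ⟩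
      (a ℚ.+ c) ℚ.* (a ℚ.+ c)
        ≤⟨ ≤-by ((a ℚ.- c) ℚ.* (a ℚ.- c) ℚ.+ ((b ℚ.* b ℚ.+ d ℚ.* d) ℚ.+ (b ℚ.* b ℚ.+ d ℚ.* d)))
            (0≤+ (0≤² (a ℚ.- c)) (0≤+ (0≤+ (0≤² b) (0≤² d)) (0≤+ (0≤² b) (0≤² d))))
            (solve 4 (λ a b c d → (a :+ c) :* (a :+ c) :+ ((a :- c) :* (a :- c) :+
                ((b :* b :+ d :* d) :+ (b :* b :+ d :* d))) :=
                ((a :* a :+ b :* b) :+ (c :* c :+ d :* d)) :+ ((a :* a :+ b :* b) :+ (c :* c :+ d :* d)))
              refl a b c d) ⟩
      (seq (norm² z) m ℚ.+ seq (norm² w) m) ℚ.+ (seq (norm² z) m ℚ.+ seq (norm² w) m)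
        <⟨ ℚₚ.+-mono-< (ℚₚ.+-mono-< z<1/16 w<1/16) (ℚₚ.+-mono-< z<1/16 w<1/16) ⟩
      (1/16 ℚ.+ 1/16) ℚ.+ (1/16 ℚ.+ 1/16)    ≡⟨ refl ⟩
      ½ ℚ.* ½                            ∎)
      where open ℚₚ.≤-Reasoning
    decide : Dec (seq (norm² z) m ℚ.< 1/16) → Dec (seq (norm² w) m ℚ.< 1/16) → Unit z ⊎ Unit w
    decide (no z≮) _ = inj₁ (norm²#0⇒Unit z (proj₂ zN m (ℕₚ.m≤m⊔n (proj₁ zN) _) (ℚₚ.≮⇒≥ z≮)))
    decide (yes _) (no w≮) = inj₂ (norm²#0⇒Unit w (proj₂ wN m
      (ℕₚ.≤-trans (ℕₚ.m≤m⊔n (proj₁ wN) (proj₁ sN)) (ℕₚ.m≤n⊔m (proj₁ zN) _)) (ℚₚ.≮⇒≥ w≮)))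
    decide (yes z<) (yes w<) = contradiction ½<a+c (impossible z< w<)

-- Primitive roots of unity from tan(π/N).

module PrimitiveRoots where

  open import Relation.Nullary using (¬¬-excluded-middle)
  open import Defs
  open ≡ using (refl; sym; trans; cong; cong₂; subst)
  open RationalOrder
  open CoprimeSums using (2ℚ)
  open RealNumbers
  open IntegerAlgebra
  open LucasSequences
  open Bisection
  open ComplexField

  open ℚ-Solver.+-*-Solver using (solve; _:=_; _:+_; _:*_; _:-_; :-_; con)

  -- (1 + it)^k = a + i t (β t k) for real t.
  β : ℝ → ℕ → ℝ
  β t 0             = 0ℝ
  β t 1             = 1ℝ
  β t (suc (suc k)) = fromℕ 2 * β t (suc k) - (1ℝ + t * t) * β t k

  b : ℚ → ℕ → ℚ
  b x 0             = 0ℚ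
  b x 1             = 1ℚ
  b x (suc (suc k)) = 2ℚ ℚ.* b x (suc k) ℚ.- (1ℚ ℚ.+ x ℚ.* x) ℚ.* b x k

  seq-β : ∀ t k n → seq (β t k) n ≡ b (seq t n) k
  seq-β t 0 n = refl
  seq-β t 1 n = refl
  seq-β t (suc (suc k)) n = cong₂ (λ u v → 2ℚ ℚ.* u ℚ.- (1ℚ ℚ.+ seq t n ℚ.* seq t n) ℚ.* v)
    (seq-β t (suc k) n) (seq-β t k n)

  β-cong : ∀ {s t} → s ≈ t → ∀ k → β s k ≈ β t k
  β-cong s≈t 0 = ≈-refl {0ℝ}
  β-cong s≈t 1 = ≈-refl {1ℝ}
  β-cong {s} {t} s≈t (suc (suc k)) = +-cong {fromℕ 2 * β s (suc k)} {fromℕ 2 * β t (suc k)}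
      { - ((1ℝ + s * s) * β s k)} { - ((1ℝ + t * t) * β t k)}
    (*-cong {fromℕ 2} {fromℕ 2} {β s (suc k)} {β t (suc k)} (≈-refl {fromℕ 2}) (β-cong s≈t (suc k)))
    (neg-cong {(1ℝ + s * s) * β s k} {(1ℝ + t * t) * β t k}
      (*-cong {1ℝ + s * s} {1ℝ + t * t} {β s k} {β t k}
        (+-cong {1ℝ} {1ℝ} {s * s} {t * t} (≈-refl {1ℝ}) (*-cong {s} {t} {s} {t} s≈t s≈t)) (β-cong s≈t k)))

  b-0 : ∀ k → b 0ℚ k ≡ ⟦ k ⟧
  b-0 0 = sym ⟦0⟧
  b-0 1 = sym ⟦1⟧
  b-0 (suc (suc k)) = trans
    (cong₂ (λ u v → 2ℚ ℚ.* u ℚ.- (1ℚ ℚ.+ 0ℚ ℚ.* 0ℚ) ℚ.* v) (trans (b-0 (suc k)) (⟦⟧-suc k)) (b-0 k))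
    (trans (solve 1 (λ k → con 2ℚ :* (con 1ℚ :+ k) :- (con 1ℚ :+ con 0ℚ :* con 0ℚ) :* k :=
        con 1ℚ :+ (con 1ℚ :+ k)) refl ⟦ k ⟧)
      (sym (trans (⟦⟧-suc (suc k)) (cong (1ℚ ℚ.+_) (⟦⟧-suc k)))))

  Pos : ℝ → Set
  Pos x = ∃[ ε ] 0ℚ ℚ.< ε × Eventually λ n → ε ℚ.≤ seq x n

  Pos-cong : ∀ {x y} → x ≈ y → Pos x → Pos y
  Pos-cong {x} {y} x≈y (ε , 0<ε , ev) = ε ℚ.* ½ , ½-pos 0<ε ,
    ev-map (λ n (ε≤x , close) → ≤-by ((seq x n ℚ.- ε) ℚ.+ (ε ℚ.* ½ ℚ.- (seq x n ℚ.- seq y n)))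
        (0≤+ (0≤-diff ε≤x) (0≤-diff (ℚₚ.<⇒≤ (ℚₚ.≤-<-trans (p≤∣p∣ (seq x n ℚ.- seq y n)) close))))
        (solve 3 (λ e x y → e :* con ½ :+ ((x :- e) :+ (e :* con ½ :- (x :- y))) := y) refl ε (seq x n) (seq y n)))
      (ev-× ev (x≈y (ε ℚ.* ½) (½-pos 0<ε)))

  nonNegative∧¬Pos⇒≈0 : ∀ {x} → (∀ n → 0ℚ ℚ.≤ seq x n) → ¬ Pos x → x ≈ 0ℝ
  nonNegative∧¬Pos⇒≈0 {x} 0≤x ¬pos ε 0<ε with cauchy x (ε ℚ.* ½ ℚ.* ½) (½-pos (½-pos 0<ε))
  ... | N , close with seq x N ℚₚ.<? ε ℚ.* ½
  ...   | yes xN<ε½ = N , λ n N≤n → subst (ℚ._< ε)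
          (sym (trans (cong ℚ.∣_∣ (ℚₚ.+-identityʳ (seq x n))) (ℚₚ.0≤p⇒∣p∣≡p (0≤x n))))
          (<-by ((ε ℚ.* ½ ℚ.* ½ ℚ.- (seq x n ℚ.- seq x N)) ℚ.+ (ε ℚ.* ½ ℚ.- seq x N) ℚ.+ ε ℚ.* ½ ℚ.* ½)
            (0<+ (0<+ (0<-diff (ℚₚ.≤-<-trans (p≤∣p∣ (seq x n ℚ.- seq x N)) (close n N N≤n ℕₚ.≤-refl)))
              (0<-diff xN<ε½)) (½-pos (½-pos 0<ε)))
            (solve 3 (λ x y e → x :+ ((e :* con ½ :* con ½ :- (x :- y)) :+ (e :* con ½ :- y) :+
               e :* con ½ :* con ½) := e) refl (seq x n) (seq x N) ε))
  ...   | no xN≮ε½ = contradiction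
          (ε ℚ.* ½ ℚ.* ½ , ½-pos (½-pos 0<ε) , N , λ n N≤n →
            ≤-by ((ε ℚ.* ½ ℚ.* ½ ℚ.- (seq x N ℚ.- seq x n)) ℚ.+ (seq x N ℚ.- ε ℚ.* ½))
              (0≤+ (0≤-diff (ℚₚ.<⇒≤ (ℚₚ.≤-<-trans (p≤∣p∣ (seq x N ℚ.- seq x n)) (close N n ℕₚ.≤-refl N≤n))))
                (0≤-diff (ℚₚ.≮⇒≥ xN≮ε½)))
              (solve 3 (λ e y x → e :* con ½ :* con ½ :+ ((e :* con ½ :* con ½ :- (y :- x)) :+ (y :- e :* con ½))
                 := x) refl ε (seq x N) (seq x n)))
          ¬pos

  ev-all : ∀ N {P : ℕ → ℕ → Set} → (∀ k → k ℕ.< N → Eventually (P k)) →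
    Eventually (λ n → ∀ {k} → k ℕ.< N → P k n)
  ev-all zero    h = 0 , λ n _ ()
  ev-all (suc N) {P} h = ev-map (λ n (all , last) {k} k<1+N → pick n all last (ℕₚ.m≤n⇒m<n∨m≡n (ℕₚ.≤-pred k<1+N)))
    (ev-× (ev-all N λ k k<N → h k (ℕₚ.m<n⇒m<1+n k<N)) (h N ℕₚ.≤-refl))
    where
    pick : ∀ n {k} → (∀ {k} → k ℕ.< N → P k n) → P N n → k ℕ.< N ⊎ k ≡ N → P k n
    pick n all last (inj₁ k<N)  = all k<N
    pick n all last (inj₂ refl) = last

  -- `P` is undecidable in the applications, so the search uses excluded middle, which the double
  -- negation of the conclusion admits.
  first-failure : ∀ N {P : ℕ → Set} → ¬ (∀ k → k ℕ.< N → P k) →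
    ¬ ¬ (∃[ k ] k ℕ.< N × ¬ P k × (∀ j → j ℕ.< k → P j))
  first-failure zero    ¬all = λ _ → ¬all λ _ ()
  first-failure (suc N) {P} ¬all = ¬¬-excluded-middle {A = ∀ k → k ℕ.< N → P k} >>= λ
    { (yes all) → return (N , ℕₚ.≤-refl , (λ last → ¬all λ k k<1+N → pick all last (ℕₚ.m≤n⇒m<n∨m≡n (ℕₚ.≤-pred k<1+N))) , all)
    ; (no ¬below) → first-failure N ¬below >>= λ (k , k<N , rest) → return (k , ℕₚ.m<n⇒m<1+n k<N , rest)
    }
    where
    pick : ∀ {k} → (∀ k → k ℕ.< N → P k) → P N → k ℕ.< N ⊎ k ≡ N → P k
    pick all last (inj₁ k<N)  = all _ k<N
    pick all last (inj₂ refl) = last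

  -- t is to become tan(π/N), the first point where one of β t 1, …, β t N vanishes.
  record IsFirstZero (N : ℕ) (t : ℝ) : Set where
    field
      nonNegative : ∀ n → 0ℚ ℚ.≤ seq t n
      β-positive  : ∀ k → k ℕ.< N → ∀ n → 0ℚ ℚ.< b (seq t n) (suc k)
      ¬all-Pos    : ¬ (∀ k → k ℕ.< N → Pos (β t (suc k)))

  module FirstZero (N : ℕ) (3≤N : 3 ℕ.≤ N) where
    private
      Q : ℚ → Set
      Q x = ∀ {k} → k ℕ.< N → 0ℚ ℚ.< b x (suc k)

      Q? : Decidable Q
      Q? x = ℕₚ.allUpTo? (λ k → 0ℚ ℚₚ.<? b x (suc k)) N

      Q-0 : Q 0ℚ
      Q-0 {k} _ = subst (0ℚ ℚ.<_) (sym (b-0 (suc k))) (0<⟦suc⟧ k)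

      b-2-3 : b 2ℚ 3 ≡ ℚ.- 1ℚ
      b-2-3 = refl

      -- `b x 3` is 3 - x², with zero √3 = tan(π/3) below 2; so 2 is a right end for every N ≥ 3.
      ¬Q-2 : ¬ Q 2ℚ
      ¬Q-2 q = ℚₚ.<-asym (subst (0ℚ ℚ.<_) b-2-3 (q {2} 3≤N)) (ℚₚ.negative⁻¹ (ℚ.- 1ℚ))

      open Bisect Q? {0ℚ} {2ℚ} (ℚₚ.nonNegative⁻¹ 2ℚ) Q-0 ¬Q-2
        using (supremum; infimum; supremum≈infimum; Q-lo; ¬Q-hi; a≤lo)

    firstZero : ∃[ t ] IsFirstZero N t
    firstZero = supremum , record
      { nonNegative = a≤lo
      ; β-positive = λ k k<N n → Q-lo n k<N
      -- Positivity with a margin is an open condition: at the limit it would pass to late points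
      -- `hi n`, where `Q` fails.
      ; ¬all-Pos = λ all →
          let n , q = ev-witness (ev-all N {λ k n → 0ℚ ℚ.< b (seq infimum n) (suc k)} λ k k<N →
                let ε , 0<ε , ev = Pos-cong {β supremum (suc k)} {β infimum (suc k)}
                                     (β-cong supremum≈infimum (suc k)) (all k k<N)
                in ev-map (λ n ε≤ → subst (0ℚ ℚ.<_) (seq-β infimum (suc k) n) (ℚₚ.<-≤-trans 0<ε ε≤)) ev)
          in ¬Q-hi n q
      }

  -- At a zero of β t k the recursion makes β t (k+1) negative, so the first of
  -- β t 1, …, β t N to vanish is β t N.
  module Tangent {N : ℕ} (3≤N : 3 ℕ.≤ N) {t : ℝ} (isFirstZero : IsFirstZero N t) where
    open IsFirstZero isFirstZero

    Solution : Set
    Solution = β t N ≈ 0ℝ × (∀ k → 1 ℕ.≤ k → k ℕ.< N → Pos (β t k))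

    solution : ¬ ¬ Solution
    solution = first-failure N {λ k → Pos (β t (suc k))} ¬all-Pos >>= λ (k , k<N , ¬pos , pos) →
      last-is-N k k<N (nonNegative∧¬Pos⇒≈0 {β t (suc k)} (λ n → subst (0ℚ ℚ.≤_) (sym (seq-β t (suc k) n)) (ℚₚ.<⇒≤ (β-positive k k<N n))) ¬pos) ¬pos pos
      where
      overshoot : ∀ k → suc (suc k) ℕ.< N → Pos (β t (suc k)) → ¬ β t (suc (suc k)) ≈ 0ℝ
      overshoot k k<N (ε , 0<ε , ev) β≈0 =
        let n , (ε≤β , small) = ev-witness (ev-× ev (β≈0 (ε ℚ.* ½) (½-pos 0<ε)))
        in negative (seq t n) (seq-β t (suc k) n) (seq-β t (suc (suc k)) n) (β-positive (suc (suc k)) k<N n) ε≤β small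
        where
        negative : ∀ x {u v u′ v′} → u ≡ u′ → v ≡ v′ → 0ℚ ℚ.< 2ℚ ℚ.* v′ ℚ.- (1ℚ ℚ.+ x ℚ.* x) ℚ.* u′ →
          ε ℚ.≤ u → ¬ ℚ.∣ v ℚ.- 0ℚ ∣ ℚ.< ε ℚ.* ½
        negative x {u} {v} refl refl positive ε≤u small = ℚₚ.<-irrefl refl (ℚₚ.<-≤-trans positive
          (≤-by (2ℚ ℚ.* (ε ℚ.* ½ ℚ.- (v ℚ.- 0ℚ)) ℚ.+ (u ℚ.- ε) ℚ.+ x ℚ.* x ℚ.* u)
            (0≤+ (0≤+ (0≤* (ℚₚ.nonNegative⁻¹ 2ℚ) (0≤-diff (ℚₚ.≤-trans (p≤∣p∣ (v ℚ.- 0ℚ)) (ℚₚ.<⇒≤ small))))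
                      (0≤-diff ε≤u))
              (0≤* (0≤² x) (ℚₚ.≤-trans (ℚₚ.<⇒≤ 0<ε) ε≤u)))
            (solve 4 (λ e u v x → con 2ℚ :* v :- (con 1ℚ :+ x :* x) :* u :+
                (con 2ℚ :* (e :* con ½ :- (v :- con 0ℚ)) :+ (u :- e) :+ x :* x :* u) := con 0ℚ) refl ε u v x)))
      last-is-N : ∀ k → k ℕ.< N → β t (suc k) ≈ 0ℝ → ¬ Pos (β t (suc k)) →
        (∀ j → j ℕ.< k → Pos (β t (suc j))) → ¬ ¬ Solution
      last-is-N zero k<N _ ¬pos _ = contradiction (1ℚ , 0<1 , 0 , λ _ _ → ℚₚ.≤-refl) ¬pos
      last-is-N (suc k) k<N β≈0 ¬pos pos with ℕₚ.m≤n⇒m<n∨m≡n k<N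
      ... | inj₁ 2+k<N = contradiction β≈0 (overshoot k 2+k<N (pos k ℕₚ.≤-refl))
      ... | inj₂ refl = return (β≈0 , λ { (suc j) _ (s≤s j<k) → pos j j<k })

    -- At t = 0 the value of β with index N is N, so t ≈ 0 is incompatible with the vanishing of β t
    -- N.
    t-Pos : Solution → ¬ ¬ Pos t
    t-Pos (βN≈0 , _) ¬pos = ℚₚ.<-irrefl refl (ℚₚ.<-trans
        (proj₂ (ev-witness (β0≈0 1ℚ 0<1)))
        (subst (1ℚ ℚ.<_) (sym (trans (cong ℚ.∣_∣ (trans (ℚₚ.+-identityʳ (seq (β 0ℝ N) _)) (trans (seq-β 0ℝ N _) (b-0 N))))
            (ℚₚ.0≤p⇒∣p∣≡p (0≤⟦⟧ N))))
          (subst (ℚ._< ⟦ N ⟧) ⟦1⟧ (⟦⟧-mono-< (ℕₚ.<-≤-trans (s≤s (s≤s z≤n)) 3≤N)))))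
      where
      t≈0 : t ≈ 0ℝ
      t≈0 = nonNegative∧¬Pos⇒≈0 {t} nonNegative ¬pos
      β0≈0 : β 0ℝ N ≈ 0ℝ
      β0≈0 = ≈-trans {β 0ℝ N} {β t N} {0ℝ} (≈-sym {β t N} {β 0ℝ N} (β-cong {t} {0ℝ} t≈0 N)) βN≈0

    -- The quotient w / w̄ has modulus 1 and twice the argument of 1 + i tan(π/N), that is 2π/N.
    w w̄ : ℂ
    w = 1ℝ +i t
    w̄ = 1ℝ +i (- t)

    embed : ℝ → ℂ
    embed x = x +i 0ℝ

    Pos⇒Unit : ∀ x → Pos x → Unit (embed x)
    Pos⇒Unit x (ε , 0<ε , ev) = norm²#0⇒Unit (embed x) (positive⇒#0 {norm² (embed x)} (ε ℚ.* ε) (0<* 0<ε 0<ε)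
      (ev-map (λ n ε≤x → ℚₚ.≤-trans (*-mono-≤ (ℚₚ.<⇒≤ 0<ε) ε≤x (ℚₚ.<⇒≤ 0<ε) ε≤x)
        (ℚₚ.≤-reflexive (solve 1 (λ x → x :* x := x :* x :+ con 0ℚ :* con 0ℚ) refl (seq x n)))) ev))

    private
      module R = Geometric ℂ-algebra

      w̄-unit : Unit w̄
      w̄-unit = norm²#0⇒Unit w̄ (positive⇒#0 {norm² w̄} 1ℚ 0<1 (0 , λ n _ →
        ≤-by (seq t n ℚ.* seq t n) (0≤² (seq t n))
          (solve 1 (λ x → con 1ℚ :+ x :* x := con 1ℚ :* con 1ℚ :+ (:- x) :* (:- x)) refl (seq t n))))

      difference-unit : Pos t → Unit (w R.- w̄)
      difference-unit (ε , 0<ε , ev) = norm²#0⇒Unit (w R.- w̄) (positive⇒#0 {norm² (w R.- w̄)} (ε ℚ.* ε) (0<* 0<ε 0<ε)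
        (ev-map (λ n ε≤t → ℚₚ.≤-trans (*-mono-≤ (ℚₚ.<⇒≤ 0<ε) ε≤t (ℚₚ.<⇒≤ 0<ε) ε≤t)
          (≤-by (seq t n ℚ.* seq t n ℚ.+ (seq t n ℚ.* seq t n ℚ.+ seq t n ℚ.* seq t n))
            (0≤+ (0≤² (seq t n)) (0≤+ (0≤² (seq t n)) (0≤² (seq t n))))
            (solve 1 (λ x → x :* x :+ (x :* x :+ (x :* x :+ x :* x)) :=
              (con 1ℚ :- con 1ℚ) :* (con 1ℚ :- con 1ℚ) :+ (x :- (:- x)) :* (x :- (:- x))) refl (seq t n)))) ev))

      recursion : ∀ k → embed (β t (suc (suc k))) R.≈
        (w R.+ w̄) R.* embed (β t (suc k)) R.- (w R.* w̄) R.* embed (β t k)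
      recursion k = ≈ᶜ-pointwise (embed (β t (suc (suc k))))
        ((w R.+ w̄) R.* embed (β t (suc k)) R.- (w R.* w̄) R.* embed (β t k))
        (λ n → solve 3 (λ x u v → con 2ℚ :* u :- (con 1ℚ :+ x :* x) :* v :=
           ((con 1ℚ :+ con 1ℚ) :* u :- (x :- x) :* con 0ℚ) :-
           ((con 1ℚ :* con 1ℚ :- x :* (:- x)) :* v :- (con 1ℚ :* (:- x) :+ x :* con 1ℚ) :* con 0ℚ)) refl
           (seq t n) (seq (β t (suc k)) n) (seq (β t k) n))
        (λ n → solve 3 (λ x u v → con 0ℚ :=
           ((con 1ℚ :+ con 1ℚ) :* con 0ℚ :+ (x :- x) :* u) :-
           ((con 1ℚ :* con 1ℚ :- x :* (:- x)) :* con 0ℚ :+ (con 1ℚ :* (:- x) :+ x :* con 1ℚ) :* v)) refl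
           (seq t n) (seq (β t (suc k)) n) (seq (β t k) n))

      embed≈0 : ∀ {x} → x ≈ 0ℝ → embed x R.≈ R.0#
      embed≈0 x≈0 = x≈0 , ≈-refl {0ℝ}

      B₁ : embed (β t 1) R.≈ R.1#
      B₁ = ≈-refl {1ℝ} , ≈-refl {0ℝ}

      open Lucas ℂ-algebra

    solution⇒primitive : Solution → Pos t → ∃[ z ] PrimitiveRoot N z
    solution⇒primitive (βN≈0 , pos) t-pos = w R.* v ,
      lucas-primitive w w̄ (λ k → embed (β t k)) (embed≈0 {0ℝ} (≈-refl {0ℝ})) B₁ recursion {N} {v}
        (proj₂ w̄-unit) (difference-unit t-pos) (embed≈0 {β t N} βN≈0)
        (λ k 1≤k k<N → Pos⇒Unit (β t k) (pos k 1≤k k<N))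
      where v = proj₁ w̄-unit

    ∃-primitive : ¬ ¬ (∃[ z ] PrimitiveRoot N z)
    ∃-primitive = solution >>= λ sol → t-Pos sol >>= λ t-pos → return (solution⇒primitive sol t-pos)

  -- The orders 1 and 2 are given directly, by 1 and -1: tan(π/N) is 0 or infinite there. `half`
  -- inverts -1 - 1.
  primitive-root : ∀ n → ¬ ¬ (∃[ z ] PrimitiveRoot (suc n) z)
  primitive-root zero = return (ℤ→ℂ (ℤ.+ 1) , 1^ 1 , λ k 1≤k k<1 → contradiction k<1 (ℕₚ.≤⇒≯ 1≤k))
  primitive-root (suc zero) = return (-1ᶜ , ≈ᶜ-pointwise (-1ᶜ R.^ 2) R.1# (λ _ → refl) (λ _ → refl) , λ
      { (suc zero) _ _ → half , ≈ᶜ-pointwise ((-1ᶜ R.^ 1 R.- R.1#) R.* half) R.1# (λ _ → refl) (λ _ → refl)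
      ; (suc (suc k)) _ (s≤s (s≤s ()))
      })
    where
    module R = Geometric ℂ-algebra
    -1ᶜ half : ℂ
    -1ᶜ = ℤ→ℂ (ℤ.- (ℤ.+ 1))
    half = fromℚ (ℚ.- ½) +i 0ℝ
  primitive-root (suc (suc n)) = Tangent.∃-primitive 3≤ (proj₂ (FirstZero.firstZero (suc (suc (suc n))) 3≤))
    where 3≤ = s≤s (s≤s (s≤s z≤n))

-- The cardinality of Ω₁(X) in terms of the integer part of X.

module Cardinality where

  open import Data.Fin.Base using (Fin; zero; suc; splitAt; _↑ˡ_; _↑ʳ_; remQuot; combine; toℕ; fromℕ<)
  import Data.Fin.Properties as Finₚ
  open import Data.Nat.Coprimality using (Coprime; coprime?)
  open import Function.Bundles using (Bijection)
  open import Relation.Binary.Bundles using (Setoid)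
  open import Defs
  open ≡ using (refl; sym; trans; cong; cong₂; subst; subst₂)
  open RationalOrder
  open RealNumbers
  open RootCount using (∑ℕ; weight; W)
  open IntegerAlgebra
  open ComplexField
  open PrimitiveRoots using (primitive-root; first-failure)

  open ℚ-Solver.+-*-Solver using (solve; _:=_; _:+_; _:*_; _:-_; :-_; con)

  module Enumerations (S : Setoid 0ℓ 0ℓ) where
    private
      module S = Setoid S
    open S using (Carrier)

    -- A bijection relative to a predicate, in a form that glues along disjoint predicates: Ω₁ is
    -- assembled from its parts with fixed p and q.
    record Enum (P : Carrier → Set) (k : ℕ) : Set where
      field
        element   : Fin k → Carrier
        valid     : ∀ i → P (element i)
        injective : ∀ i j → element i S.≈ element j → i ≡ j
        covering  : ∀ x → P x → ∃[ i ] element i S.≈ x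

    open Enum

    Enum-map : ∀ {P Q k} → (∀ x → P x → Q x) → (∀ x → Q x → P x) → Enum P k → Enum Q k
    Enum-map f g e = record
      { element = element e ; valid = λ i → f _ (valid e i)
      ; injective = injective e ; covering = λ x q → covering e x (g x q) }

    Enum-empty : ∀ {P} → (∀ x → ¬ P x) → Enum P 0
    Enum-empty ¬P = record
      { element = λ () ; valid = λ () ; injective = λ () ; covering = λ x p → contradiction p (¬P x) }

    Enum-⊎ : ∀ {P Q m n} → (∀ {x y} → P x → Q y → ¬ x S.≈ y) → Enum P m → Enum Q n →
      Enum (λ x → P x ⊎ Q x) (m ℕ.+ n)
    Enum-⊎ {P} {Q} {m} {n} disjoint e f = record
      { element = λ i → el (splitAt m i)
      ; valid = λ i → val (splitAt m i)
      ; injective = λ i j eq → trans (sym (Finₚ.join-splitAt m n i))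
          (trans (cong (Data.Fin.Base.join m n) (inj (splitAt m i) (splitAt m j) eq)) (Finₚ.join-splitAt m n j))
      ; covering = λ where
          x (inj₁ p) → let i , eq = covering e x p in
            i ↑ˡ n , subst (λ s → el s S.≈ x) (sym (Finₚ.splitAt-↑ˡ m i n)) eq
          x (inj₂ q) → let i , eq = covering f x q in
            m ↑ʳ i , subst (λ s → el s S.≈ x) (sym (Finₚ.splitAt-↑ʳ m n i)) eq
      }
      where
      import Data.Fin.Base
      el : Fin m ⊎ Fin n → Carrier
      el (inj₁ i) = element e i
      el (inj₂ j) = element f j
      val : ∀ s → P (el s) ⊎ Q (el s)
      val (inj₁ i) = inj₁ (valid e i)
      val (inj₂ j) = inj₂ (valid f j)
      inj : ∀ s t → el s S.≈ el t → s ≡ t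
      inj (inj₁ i) (inj₁ j) eq = cong inj₁ (injective e i j eq)
      inj (inj₁ i) (inj₂ j) eq = contradiction eq (disjoint (valid e i) (valid f j))
      inj (inj₂ i) (inj₁ j) eq = contradiction (S.sym eq) (disjoint (valid e j) (valid f i))
      inj (inj₂ i) (inj₂ j) eq = cong inj₂ (injective f i j eq)

    -- Each part is enumerated only up to double negation. Finitely many double negations merge into
    -- one by induction on `n`.
    Enum-∑ : ∀ n (P : ℕ → Carrier → Set) (f : ℕ → ℕ) →
      (∀ {i j x y} → P i x → P j y → x S.≈ y → i ≡ j) →
      (∀ i → i ℕ.< n → ¬ ¬ Enum (P i) (f i)) →
      ¬ ¬ Enum (λ x → ∃[ i ] i ℕ.< n × P i x) (∑ℕ n f)
    Enum-∑ zero    P f _ _ = return (Enum-empty λ { x (i , () , _) })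
    Enum-∑ (suc n) P f disjoint enum =
      Enum-∑ n P f disjoint (λ i i<n → enum i (ℕₚ.m<n⇒m<1+n i<n)) >>= λ below →
      enum n ℕₚ.≤-refl >>= λ top →
      return (Enum-map to from (Enum-⊎ (λ { (i , i<n , p) q eq → ℕₚ.<-irrefl (disjoint p q eq) i<n }) below top))
      where
      to : ∀ x → (∃[ i ] i ℕ.< n × P i x) ⊎ P n x → ∃[ i ] i ℕ.< suc n × P i x
      to x (inj₁ (i , i<n , p)) = i , ℕₚ.m<n⇒m<1+n i<n , p
      to x (inj₂ p)             = n , ℕₚ.≤-refl , p
      from : ∀ x → ∃[ i ] i ℕ.< suc n × P i x → (∃[ i ] i ℕ.< n × P i x) ⊎ P n x
      from x (i , i<1+n , p) with ℕₚ.m≤n⇒m<n∨m≡n (ℕₚ.≤-pred i<1+n)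
      ... | inj₁ i<n  = inj₁ (i , i<n , p)
      ... | inj₂ refl = inj₂ p

    Enum⇒cardinality : ∀ {P k} → (∀ x → P x) → Enum P k → HasCardinality S k
    Enum⇒cardinality all e = record
      { to = element e
      ; cong = λ { refl → S.refl }
      ; bijective = (λ {i} {j} → injective e i j) ,
          λ x → let i , eq = covering e x (all x) in i , λ { refl → eq }
      }

    cardinality-≤ : ∀ {m n} → HasCardinality S m → HasCardinality S n → m ℕ.≤ n
    cardinality-≤ f g = Finₚ.injective⇒≤ {f = λ i → proj₁ (G.surjective (F.to i))} λ {i} {j} eq →
      F.injective (S.trans (S.sym (proj₂ (G.surjective (F.to i)) refl))
        (S.trans (S.reflexive (cong G.to eq)) (proj₂ (G.surjective (F.to j)) refl)))
      where
      module F = Bijection f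
      module G = Bijection g

    cardinality-unique : ∀ {m n} → HasCardinality S m → HasCardinality S n → m ≡ n
    cardinality-unique f g = ℕₚ.≤-antisym (cardinality-≤ f g) (cardinality-≤ g f)

  ≤-trans : ∀ {x y z} → x ≤ y → y ≤ z → x ≤ z
  ≤-trans {x} {y} {z} x≤y y≤z ε 0<ε = ev-map
    (λ n (a , b) → <-by ((seq y n ℚ.+ ε ℚ.* ½ ℚ.- seq x n) ℚ.+ (seq z n ℚ.+ ε ℚ.* ½ ℚ.- seq y n))
      (0<+ (0<-diff a) (0<-diff b))
      (solve 4 (λ x y z e → x :+ ((y :+ e :* con ½ :- x) :+ (z :+ e :* con ½ :- y)) := z :+ e) refl
        (seq x n) (seq y n) (seq z n) ε))
    (ev-× (x≤y (ε ℚ.* ½) (½-pos 0<ε)) (y≤z (ε ℚ.* ½) (½-pos 0<ε)))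

  fromℕ-mono : ∀ {m n} → m ℕ.≤ n → fromℕ m ≤ fromℕ n
  fromℕ-mono {m} {n} m≤n ε 0<ε = 0 , λ _ _ → subst₂ (λ a b → a ℚ.< b ℚ.+ ε) (⟦⟧-def m) (⟦⟧-def n)
    (ℚₚ.≤-<-trans (⟦⟧-mono-≤ m≤n) (<-by ε 0<ε refl))

  IsFloor : ℝ → ℕ → Set
  IsFloor X m = fromℕ m ≤ X × ¬ fromℕ (suc m) ≤ X

  -- The first k at which k + 1 ≤ X fails. It occurs in a finite range because X is bounded, but the
  -- test is undecidable, whence the double negation.
  floor : ∀ X → 0ℝ ≤ X → ¬ ¬ (∃[ m ] IsFloor X m)
  floor X 0≤X = first-failure M {λ k → fromℕ (suc k) ≤ X} ¬all >>= λ
    { (zero  , _ , ¬1≤X , _)     → return (0 , 0≤X , ¬1≤X)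
    ; (suc k , _ , ¬k≤X , below) → return (suc k , below k ℕₚ.≤-refl , ¬k≤X)
    }
    where
    B = proj₁ (bounded X)
    M = suc (proj₁ (archimedean (B ℚ.+ 1ℚ)))
    ¬all : ¬ (∀ k → k ℕ.< M → fromℕ (suc k) ≤ X)
    ¬all h = let n , (M<X+1 , ∣X∣≤B) = ev-witness (ev-× (h (proj₁ (archimedean (B ℚ.+ 1ℚ))) ℕₚ.≤-refl 1ℚ 0<1)
                                        (proj₂ (proj₂ (bounded X))))
             in ℚₚ.<-irrefl refl (ℚₚ.<-trans
                  (ℚₚ.<-≤-trans M<X+1 (ℚₚ.+-monoˡ-≤ 1ℚ (ℚₚ.≤-trans (p≤∣p∣ (seq X n)) ∣X∣≤B)))
                  (ℚₚ.<-≤-trans (proj₂ (archimedean (B ℚ.+ 1ℚ)))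
                    (subst (⟦ proj₁ (archimedean (B ℚ.+ 1ℚ)) ⟧ ℚ.≤_) (⟦⟧-def M) (⟦⟧-mono-≤ (ℕₚ.n≤1+n _)))))

  toAlexanderRoot : ∀ p q α → IsRoot p q α → IsAlexanderRoot p q α
  toAlexanderRoot p q α (D , isD , vanish) =
    D , isD , R.trans {evalᶜ D α} {eval D α} {0ᶜ} (eval-unique D α) vanish
    where module R = Geometric ℂ-algebra

  fromAlexanderRoot : ∀ p q α → IsAlexanderRoot p q α → IsRoot p q α
  fromAlexanderRoot p q α (D , isD , vanish) =
    D , isD , R.trans {eval D α} {evalᶜ D α} {0ᶜ} (R.sym {evalᶜ D α} {eval D α} (eval-unique D α)) vanish
    where module R = Geometric ℂ-algebra

  module _ (X : ℝ) (m : ℕ) (isFloor : IsFloor X m) where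
    private
      module Ω = Ω₁-Element
    open Enumerations (Ω₁ X)

    OfType : ℕ → ℕ → Ω₁-Element X → Set
    OfType p q s = Ω.p s ≡ p × Ω.q s ≡ q

    private
      module OnKnot {p′ q′ : ℕ} (coprime : Coprime (suc p′) (suc q′)) (system : RootSystem p′ q′)
        (p≤m : suc p′ ℕ.≤ m) (q≤m : suc q′ ℕ.≤ m) where
        open RootSystem system

        element′ : Fin p′ × Fin q′ → Ω₁-Element X
        element′ (i , j) = record
          { p = suc p′ ; q = suc q′ ; p>0 = s≤s z≤n ; q>0 = s≤s z≤n ; coprime = coprime
          ; max≤X = ≤-trans {fromℕ (suc p′ ℕ.⊔ suc q′)} {fromℕ m} {X} (fromℕ-mono (ℕₚ.⊔-lub p≤m q≤m)) (proj₁ isFloor)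
          ; α = rootAt (toℕ i) (toℕ j)
          ; root = toAlexanderRoot (suc p′) (suc q′) (rootAt (toℕ i) (toℕ j))
              (isRoot (toℕ i) (toℕ j) (Finₚ.toℕ<n i) (Finₚ.toℕ<n j))
          }

        index-injective : ∀ s t → Ω.α (element′ s) ≈ᶜ Ω.α (element′ t) → s ≡ t
        index-injective (i , j) (k , l) eq =
          let i≡k , j≡l = injective (Finₚ.toℕ<n i) (Finₚ.toℕ<n j) (Finₚ.toℕ<n k) (Finₚ.toℕ<n l) eq
          in cong₂ _,_ (Finₚ.toℕ-injective i≡k) (Finₚ.toℕ-injective j≡l)

        cover : ∀ s → OfType (suc p′) (suc q′) s → ∃[ u ] Setoid._≈_ (Ω₁ X) (element′ u) s
        cover s (p≡ , q≡) =
          let i , j , i<p , j<q , α≈ = surjective (Ω.α s) (fromAlexanderRoot (suc p′) (suc q′) (Ω.α s)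
                (subst₂ (λ p q → IsAlexanderRoot p q (Ω.α s)) p≡ q≡ (Ω.root s)))
          in (fromℕ< i<p , fromℕ< j<q) , sym p≡ , sym q≡ ,
             subst₂ (λ a b → rootAt a b ≈ᶜ Ω.α s) (sym (Finₚ.toℕ-fromℕ< i<p)) (sym (Finₚ.toℕ-fromℕ< j<q)) α≈

        enum : Enum (OfType (suc p′) (suc q′)) (p′ ℕ.* q′)
        enum = record
          { element = λ k → element′ (remQuot q′ k)
          ; valid = λ k → refl , refl
          ; injective = λ k l (_ , _ , eq) → trans (sym (Finₚ.combine-remQuot {p′} q′ k)) (trans
              (cong (λ (i , j) → combine i j) (index-injective (remQuot q′ k) (remQuot q′ l) eq))
              (Finₚ.combine-remQuot {p′} q′ l))
          ; covering = λ s h → let u , eq = cover s h in combine (proj₁ u) (proj₂ u) ,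
              subst (λ u → Setoid._≈_ (Ω₁ X) (element′ u) s) (sym (Finₚ.remQuot-combine (proj₁ u) (proj₂ u))) eq
          }

    enum-type : ∀ p q → p ℕ.≤ m → q ℕ.≤ m → ¬ ¬ Enum (OfType p q) (weight p q)
    enum-type p q p≤m q≤m with coprime? p q
    ... | no ¬cop = return (Enum-empty λ { s (refl , refl) → ¬cop (Ω.coprime s) })
    enum-type zero    q       _ _ | yes _ = return (Enum-empty λ { s (p≡0 , _) →
      ℕₚ.<-irrefl (sym p≡0) (Ω.p>0 s) })
    enum-type (suc p) zero    _ _ | yes _ = return (subst (Enum (OfType (suc p) 0)) (sym (ℕₚ.*-zeroʳ p))
      (Enum-empty λ { s (_ , q≡0) → ℕₚ.<-irrefl (sym q≡0) (Ω.q>0 s) }))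
    enum-type (suc p) (suc q) p≤m q≤m | yes cop =
      primitive-root p >>= λ (x , x-prim) → primitive-root q >>= λ (y , y-prim) →
      return (OnKnot.enum cop (rootSystem 1≉0 ℂ-local ι-unit cop x-prim y-prim) p≤m q≤m)

    Ω₁-cardinality : ¬ ¬ HasCardinality (Ω₁ X) (W m)
    Ω₁-cardinality =
      Enum-∑ (suc m) (λ p s → ∃[ q ] q ℕ.< suc m × OfType p q s) (λ p → ∑ℕ (suc m) (weight p))
        (λ { (_ , _ , refl , _) (_ , _ , refl , _) (p≡ , _) → p≡ })
        (λ p p≤m → Enum-∑ (suc m) (OfType p) (weight p)
          (λ { (_ , refl) (_ , refl) (_ , q≡ , _) → q≡ })
          (λ q q≤m → enum-type p q (ℕₚ.≤-pred p≤m) (ℕₚ.≤-pred q≤m)))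
      >>= λ e → return (Enum⇒cardinality
        (λ s → Ω.p s , s≤s (ℕₚ.m⊔n≤o⇒m≤o (Ω.p s) (Ω.q s) (bound s)) ,
               Ω.q s , s≤s (ℕₚ.m⊔n≤o⇒n≤o (Ω.p s) (Ω.q s) (bound s)) , refl , refl) e)
      where
      bound : ∀ s → Ω.p s ℕ.⊔ Ω.q s ℕ.≤ m
      bound s = ℕₚ.≮⇒≥ λ m< → proj₂ isFloor
        (≤-trans {fromℕ (suc m)} {fromℕ (Ω.p s ℕ.⊔ Ω.q s)} {X} (fromℕ-mono m<) (Ω.max≤X s))

    cardinality≡W : ∀ {N} → HasCardinality (Ω₁ X) N → ¬ ¬ N ≡ W m
    cardinality≡W card = Ω₁-cardinality >>= λ card′ → return (cardinality-unique card card′)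

-- The error term and the asymptotic equivalence.

module Asymptotics where

  open import Defs
  open ≡ using (refl; sym; trans; cong; cong₂; subst)
  open RationalOrder
  open CoprimeSums using (H; Z; rec; rec-*; *-rec; 0≤rec; rec-1; 1≤Z; Z≤2; 2ℚ; 4ℚ; 8ℚ; 0≤2)
  open RootCount using (W; W-approx; 72ℚ; 1≤H; 0≤H; H²≤4n; rec≤1)
  open FiniteSums using (∑-monoⁿ)
  open Exponential using (exp; G; double; exp-≤-below-G)
  open RealNumbers
  open Cardinality

  open ℚ-Solver.+-*-Solver using (solve; _:=_; _:+_; _:*_; _:-_; :-_; con)

  5ℚ 30ℚ 102ℚ 103ℚ : ℚ
  5ℚ = ℤ.+ 5 ℚ./ 1
  30ℚ = ℤ.+ 30 ℚ./ 1
  102ℚ = ℤ.+ 102 ℚ./ 1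
  103ℚ = ℤ.+ 103 ℚ./ 1

  _⁴ _³ : ℚ → ℚ
  x ⁴ = x ℚ.* x ℚ.* x ℚ.* x
  x ³ = x ℚ.* x ℚ.* x

  0≤³ : ∀ {x} → 0ℚ ℚ.≤ x → 0ℚ ℚ.≤ x ³
  0≤³ 0≤x = 0≤* (0≤* 0≤x 0≤x) 0≤x

  0≤⁴ : ∀ {x} → 0ℚ ℚ.≤ x → 0ℚ ℚ.≤ x ⁴
  0≤⁴ 0≤x = 0≤* (0≤³ 0≤x) 0≤x

  ³-mono : ∀ {x y} → 0ℚ ℚ.≤ x → x ℚ.≤ y → x ³ ℚ.≤ y ³
  ³-mono 0≤x x≤y = *-mono-≤ (0≤* 0≤x 0≤x) (*-mono-≤ 0≤x x≤y 0≤x x≤y) 0≤x x≤y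

  ⁴-mono : ∀ {x y} → 0ℚ ℚ.≤ x → x ℚ.≤ y → x ⁴ ℚ.≤ y ⁴
  ⁴-mono 0≤x x≤y = *-mono-≤ (0≤³ 0≤x) (³-mono 0≤x x≤y) 0≤x x≤y

  -- What m = ⌊X⌋ implies for late terms of the sequence of X: the bounds m and m + 1, relaxed by ½
  -- below and by 1 above.
  Near : ℚ → ℕ → Set
  Near x m = ⟦ m ⟧ ℚ.≤ x ℚ.+ ½ × x ℚ.≤ ⟦ m ⟧ ℚ.+ 2ℚ

  -- For the upper bound one late term is compared with m + 3/2: above it, m + 1 ≤ X would follow;
  -- otherwise a variation below ½ keeps all later terms under m + 2.
  near-floor : ∀ {X m} → IsFloor X m → Eventually λ n → Near (seq X n) m
  near-floor {X} {m} (m≤X , ¬1+m≤X) = ev-map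
    (λ n (a , b) → ℚₚ.<⇒≤ (subst (ℚ._< seq X n ℚ.+ ½) (sym (⟦⟧-def m)) a) , b)
    (ev-× (m≤X ½ 0<½) upper)
    where
    M = ⟦ suc m ⟧
    upper : Eventually λ n → seq X n ℚ.≤ ⟦ m ⟧ ℚ.+ 2ℚ
    upper with cauchy X ½ 0<½
    ... | N , close with seq X N ℚₚ.≤? M ℚ.+ ½
    ...   | yes XN≤ = N , λ n N≤n → ≤-by ((½ ℚ.- (seq X n ℚ.- seq X N)) ℚ.+ (M ℚ.+ ½ ℚ.- seq X N))
            (0≤+ (0≤-diff (ℚₚ.<⇒≤ (ℚₚ.≤-<-trans (p≤∣p∣ (seq X n ℚ.- seq X N)) (close n N N≤n ℕₚ.≤-refl)))) (0≤-diff XN≤))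
            (trans (solve 3 (λ x y M → x :+ ((con ½ :- (x :- y)) :+ (M :+ con ½ :- y)) := M :+ con 1ℚ) refl
                (seq X n) (seq X N) M)
              (trans (cong (ℚ._+ 1ℚ) (⟦⟧-suc m)) (solve 1 (λ m → con 1ℚ :+ m :+ con 1ℚ := m :+ con 2ℚ) refl ⟦ m ⟧)))
    ...   | no XN≰ = contradiction
            (λ ε 0<ε → N , λ n N≤n → subst (ℚ._< seq X n ℚ.+ ε) (⟦⟧-def (suc m))
              (<-by ((½ ℚ.- (seq X N ℚ.- seq X n)) ℚ.+ (seq X N ℚ.- (M ℚ.+ ½)) ℚ.+ ε)
                (0<+ (0<+ (0<-diff (ℚₚ.≤-<-trans (p≤∣p∣ (seq X N ℚ.- seq X n)) (close N n ℕₚ.≤-refl N≤n)))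
                  (0<-diff (ℚₚ.≰⇒> XN≰))) 0<ε)
                (solve 4 (λ x y M e → M :+ ((con ½ :- (y :- x)) :+ (y :- (M :+ con ½)) :+ e) := x :+ e) refl
                  (seq X n) (seq X N) M ε)))
            ¬1+m≤X

  module _ {x m} (2≤m : 2 ℕ.≤ m) (near : Near x m) where
    private
      N = ⟦ m ⟧
      0≤N = 0≤⟦⟧ m
      2≤N : 2ℚ ℚ.≤ N
      2≤N = subst (ℚ._≤ N) (⟦⟧-def 2) (⟦⟧-mono-≤ 2≤m)

    near-1≤x : 1ℚ ℚ.≤ x
    near-1≤x = ≤-by ((x ℚ.+ ½ ℚ.- N) ℚ.+ (N ℚ.- 2ℚ) ℚ.+ ½) (0≤+ (0≤+ (0≤-diff (proj₁ near)) (0≤-diff 2≤N)) (ℚₚ.<⇒≤ 0<½))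
      (solve 2 (λ x n → con 1ℚ :+ ((x :+ con ½ :- n) :+ (n :- con 2ℚ) :+ con ½) := x) refl x N)

    near-0≤x : 0ℚ ℚ.≤ x
    near-0≤x = ℚₚ.≤-trans 0≤1 near-1≤x

    near-m≤2x : N ℚ.≤ 2ℚ ℚ.* x
    near-m≤2x = ≤-by ((x ℚ.+ ½ ℚ.- N) ℚ.+ (x ℚ.- 1ℚ) ℚ.+ ½) (0≤+ (0≤+ (0≤-diff (proj₁ near)) (0≤-diff near-1≤x)) (ℚₚ.<⇒≤ 0<½))
      (solve 2 (λ x n → n :+ ((x :+ con ½ :- n) :+ (x :- con 1ℚ) :+ con ½) := con 2ℚ :* x) refl x N)

    near-x≤2m : x ℚ.≤ 2ℚ ℚ.* N
    near-x≤2m = ≤-by ((N ℚ.+ 2ℚ ℚ.- x) ℚ.+ (N ℚ.- 2ℚ)) (0≤+ (0≤-diff (proj₂ near)) (0≤-diff 2≤N))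
      (solve 2 (λ x n → x :+ ((n :+ con 2ℚ :- x) :+ (n :- con 2ℚ)) := con 2ℚ :* n) refl x N)

    -- N⁴ - x⁴ is (N - x)(N + x)(N² + x²), and 30 is 2 · 3 · 5 from |N - x| ≤ 2 and x ≤ 2 N.
    near-⁴ : ℚ.∣ N ⁴ ℚ.- x ⁴ ∣ ℚ.≤ 30ℚ ℚ.* N ³
    near-⁴ = begin
      ℚ.∣ N ⁴ ℚ.- x ⁴ ∣
        ≡⟨ cong ℚ.∣_∣ (solve 2 (λ n x → n :* n :* n :* n :- x :* x :* x :* x :=
             (n :- x) :* ((n :+ x) :* (n :* n :+ x :* x))) refl N x) ⟩
      ℚ.∣ (N ℚ.- x) ℚ.* s ∣                    ≡⟨ ℚₚ.∣p*q∣≡∣p∣*∣q∣ (N ℚ.- x) s ⟩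
      ℚ.∣ N ℚ.- x ∣ ℚ.* ℚ.∣ s ∣                ≡⟨ cong (ℚ.∣ N ℚ.- x ∣ ℚ.*_) (ℚₚ.0≤p⇒∣p∣≡p 0≤s) ⟩
      ℚ.∣ N ℚ.- x ∣ ℚ.* s
        ≤⟨ *-mono-≤ (ℚₚ.0≤∣p∣ (N ℚ.- x)) distance 0≤s
             (*-mono-≤ (0≤+ 0≤N near-0≤x) (ℚₚ.+-monoʳ-≤ N near-x≤2m)
               (0≤+ (0≤* 0≤N 0≤N) (0≤* near-0≤x near-0≤x))
               (ℚₚ.+-monoʳ-≤ (N ℚ.* N) (*-mono-≤ near-0≤x near-x≤2m near-0≤x near-x≤2m))) ⟩
      2ℚ ℚ.* ((N ℚ.+ 2ℚ ℚ.* N) ℚ.* (N ℚ.* N ℚ.+ 2ℚ ℚ.* N ℚ.* (2ℚ ℚ.* N)))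
        ≡⟨ solve 1 (λ n → con 2ℚ :* ((n :+ con 2ℚ :* n) :* (n :* n :+ con 2ℚ :* n :* (con 2ℚ :* n))) :=
             con 30ℚ :* (n :* n :* n)) refl N ⟩
      30ℚ ℚ.* N ³                              ∎
      where
      open ℚₚ.≤-Reasoning
      s = (N ℚ.+ x) ℚ.* (N ℚ.* N ℚ.+ x ℚ.* x)
      0≤s = 0≤* (0≤+ 0≤N near-0≤x) (0≤+ (0≤* 0≤N 0≤N) (0≤* near-0≤x near-0≤x))
      distance : ℚ.∣ N ℚ.- x ∣ ℚ.≤ 2ℚ
      distance = ∣p-q∣≤ N x (ℚₚ.≤-trans (proj₁ near) (ℚₚ.+-monoʳ-≤ x (ℚₚ.<⇒≤ ½<2))) (proj₂ near)
        where
        ½<2 : ½ ℚ.< 2ℚ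
        ½<2 = <-by (½ ℚ.+ 1ℚ) (0<+ 0<½ 0<1) refl

    -- The constant is 72 + 30, from `W-approx` and `near-⁴`, merged by H ≥ 1.
    W-x⁴ : ∀ {n} → m ℕ.≤ n → ℚ.∣ 4ℚ ℚ.* Z n ℚ.* ⟦ W m ⟧ ℚ.- x ⁴ ∣ ℚ.≤ 102ℚ ℚ.* (N ³ ℚ.* H m)
    W-x⁴ {n} m≤n = begin
      ℚ.∣ w ℚ.- x ⁴ ∣                            ≤⟨ triangle w (N ⁴) (x ⁴) ⟩
      ℚ.∣ w ℚ.- N ⁴ ∣ ℚ.+ ℚ.∣ N ⁴ ℚ.- x ⁴ ∣      ≤⟨ ℚₚ.+-mono-≤ (W-approx 1≤m m≤n) near-⁴ ⟩
      72ℚ ℚ.* N ³ ℚ.* H m ℚ.+ 30ℚ ℚ.* N ³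
        ≤⟨ ℚₚ.+-monoʳ-≤ (72ℚ ℚ.* N ³ ℚ.* H m) (subst (ℚ._≤ 30ℚ ℚ.* N ³ ℚ.* H m) (ℚₚ.*-identityʳ (30ℚ ℚ.* N ³))
             (*-monoˡ-≤ (30ℚ ℚ.* N ³) (0≤* (ℚₚ.nonNegative⁻¹ 30ℚ) (0≤³ 0≤N)) (1≤H 1≤m))) ⟩
      72ℚ ℚ.* N ³ ℚ.* H m ℚ.+ 30ℚ ℚ.* N ³ ℚ.* H m
        ≡⟨ solve 2 (λ n h → con 72ℚ :* n :* h :+ con 30ℚ :* n :* h := con 102ℚ :* (n :* h)) refl (N ³) (H m) ⟩
      102ℚ ℚ.* (N ³ ℚ.* H m)                     ∎
      where
      open ℚₚ.≤-Reasoning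
      w = 4ℚ ℚ.* Z n ℚ.* ⟦ W m ⟧
      1≤m = ℕₚ.≤-trans (s≤s z≤n) 2≤m

  invℚ-pos : ∀ {q} → 0ℚ ℚ.< q → 0ℚ ℚ.< invℚ q × q ℚ.* invℚ q ≡ 1ℚ
  invℚ-pos {q} 0<q = subst (0ℚ ℚ.<_) (sym inv≡r) 0<r , q*inv≡1
    where
    r = proj₁ (reciprocal 0<q)
    0<r = proj₁ (proj₂ (reciprocal 0<q))
    qr≡1 = proj₂ (proj₂ (reciprocal 0<q))
    q*inv≡1 = invℚ-inverseʳ q 0<q (p≤∣p∣ q)
    inv≡r : invℚ q ≡ r
    inv≡r = trans (sym (ℚₚ.*-identityʳ (invℚ q))) (trans (cong (invℚ q ℚ.*_) (sym qr≡1))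
      (trans (solve 3 (λ i q r → i :* (q :* r) := (q :* i) :* r) refl (invℚ q) q r)
        (trans (cong (ℚ._* r) q*inv≡1) (ℚₚ.*-identityˡ r))))

  ζ₂-sum≡Z : ∀ n → ζ₂-sum n ≡ Z n
  ζ₂-sum≡Z zero    = refl
  ζ₂-sum≡Z (suc n) = cong₂ ℚ._+_ (ζ₂-sum≡Z n)
    (trans (sym (1/+1-def (n ℕ.+ n ℕ.* suc n))) (rec-* (suc n) (suc n)))

  main-term : ℝ → ℝ
  main-term X = (1ℝ ÷ (fromℕ 4 * ζ₂) [ 4ζ₂#0 ]) * X ^ 4

  seq-main-term : ∀ X n → seq (main-term X) n ≡ invℚ (4ℚ ℚ.* Z n) ℚ.* seq X n ⁴
  seq-main-term X n = trans
    (cong (λ z → 1ℚ ℚ.* invℚ (4ℚ ℚ.* z) ℚ.* (1ℚ ℚ.* seq X n ℚ.* seq X n ℚ.* seq X n ℚ.* seq X n)) (ζ₂-sum≡Z n))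
    (solve 2 (λ i x → con 1ℚ :* i :* (con 1ℚ :* x :* x :* x :* x) := i :* (x :* x :* x :* x)) refl
      (invℚ (4ℚ ℚ.* Z n)) (seq X n))

  1≤4Z : ∀ {n} → 1 ℕ.≤ n → 1ℚ ℚ.≤ 4ℚ ℚ.* Z n
  1≤4Z {n} 1≤n = ℚₚ.≤-trans (≤-by (1ℚ ℚ.+ 2ℚ) (0≤+ 0≤1 0≤2) refl)
    (*-monoˡ-≤ 4ℚ (ℚₚ.nonNegative⁻¹ 4ℚ) (1≤Z 1≤n))

  4Z≤8 : ∀ {n} → 1 ℕ.≤ n → 4ℚ ℚ.* Z n ℚ.≤ 8ℚ
  4Z≤8 1≤n = *-monoˡ-≤ 4ℚ (ℚₚ.nonNegative⁻¹ 4ℚ) (Z≤2 1≤n)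

  ∣*∣-nonNeg : ∀ {q} p → 0ℚ ℚ.≤ q → ℚ.∣ q ℚ.* p ∣ ≡ q ℚ.* ℚ.∣ p ∣
  ∣*∣-nonNeg {q} p 0≤q = trans (ℚₚ.∣p*q∣≡∣p∣*∣q∣ q p) (cong (ℚ._* ℚ.∣ p ∣) (ℚₚ.0≤p⇒∣p∣≡p 0≤q))

  module MainTerm {n : ℕ} (1≤n : 1 ℕ.≤ n) (x : ℚ) where
    q h : ℚ
    q = 4ℚ ℚ.* Z n
    h = invℚ q ℚ.* x ⁴

    1≤q : 1ℚ ℚ.≤ q
    1≤q = 1≤4Z 1≤n

    0<q : 0ℚ ℚ.< q
    0<q = ℚₚ.<-≤-trans 0<1 1≤q

    0≤q : 0ℚ ℚ.≤ q
    0≤q = ℚₚ.<⇒≤ 0<q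

    qh≡x⁴ : q ℚ.* h ≡ x ⁴
    qh≡x⁴ = trans (sym (ℚₚ.*-assoc q (invℚ q) (x ⁴)))
      (trans (cong (ℚ._* x ⁴) (proj₂ (invℚ-pos 0<q))) (ℚₚ.*-identityˡ (x ⁴)))

    q∣-h∣ : ∀ v → q ℚ.* ℚ.∣ v ℚ.- h ∣ ≡ ℚ.∣ q ℚ.* v ℚ.- x ⁴ ∣
    q∣-h∣ v = trans (sym (∣*∣-nonNeg (v ℚ.- h) 0≤q)) (cong ℚ.∣_∣
      (trans (solve 3 (λ q v h → q :* (v :- h) := q :* v :- q :* h) refl q v h)
        (cong (λ z → q ℚ.* v ℚ.- z) qh≡x⁴)))

    ∣-h∣≤q∣-h∣ : ∀ v → ℚ.∣ v ℚ.- h ∣ ℚ.≤ q ℚ.* ℚ.∣ v ℚ.- h ∣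
    ∣-h∣≤q∣-h∣ v = subst (ℚ._≤ q ℚ.* ℚ.∣ v ℚ.- h ∣) (ℚₚ.*-identityˡ ℚ.∣ v ℚ.- h ∣)
      (*-monoʳ-≤ ℚ.∣ v ℚ.- h ∣ (ℚₚ.0≤∣p∣ (v ℚ.- h)) 1≤q)

    1≤8h : 1ℚ ℚ.≤ x → 1ℚ ℚ.≤ 8ℚ ℚ.* h
    1≤8h 1≤x = ℚₚ.≤-trans (⁴-mono 0≤1 1≤x) (subst (ℚ._≤ 8ℚ ℚ.* h) qh≡x⁴
      (*-monoʳ-≤ h (0≤* (ℚₚ.<⇒≤ (proj₁ (invℚ-pos 0<q))) (0≤⁴ (ℚₚ.≤-trans 0≤1 1≤x))) (4Z≤8 1≤n)))

  seq-pow : ∀ l k n → seq (l ^ k) n ≡ Exponential.pow (seq l n) k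
  seq-pow l zero    n = refl
  seq-pow l (suc k) n = cong (ℚ._* seq l n) (seq-pow l k n)

  seq-expSum : ∀ l k n → seq (expSum l k) n ≡ exp (seq l n) k
  seq-expSum l zero    n = refl
  seq-expSum l (suc k) n = cong₂ ℚ._+_ (seq-expSum l k n) (cong (ℚ._* k !⁻¹) (seq-pow l k n))

  n≤double : ∀ n → n ℕ.≤ double n
  n≤double zero    = z≤n
  n≤double (suc n) = s≤s (ℕₚ.m≤n⇒m≤1+n (n≤double n))

  -- If l were at most G (m + 1), the truncated exponential would be at most m + 1. It is within ¼
  -- of X, whose approximations are at least m + 3/2. The index of G is one below the floor m + 2 to
  -- leave room for these errors.
  log-lower : ∀ X l m → Eventually (λ n → Near (seq X n) (suc (suc m))) → IsLog X l →
    Eventually (λ n → G (suc m) ℚ.≤ seq l n)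
  log-lower X l m near isLog =
    let K , limit = isLog (fromℚ ¼) (¼ , 0<¼ , 0 , λ _ _ → ℚₚ.≤-reflexive (ℚₚ.+-identityˡ ¼))
        -- An even truncation past `K`, as `exp-≤-below-G` demands.
        δ , 0<δ , ev = limit (double (suc K)) (ℕₚ.≤-trans (ℕₚ.n≤1+n K) (n≤double (suc K)))
    in ev-map (λ n (close , near) → ℚₚ.<⇒≤ (ℚₚ.≰⇒> λ l≤G →
         large n (subst (λ e → ℚ.∣ e ℚ.- seq X n ∣ ℚ.+ δ ℚ.≤ ¼) (seq-expSum l (double (suc K)) n) close)
           0<δ (proj₁ near) (exp-≤-below-G m K l≤G)))
       (ev-× ev near)
    where
    ¼ : ℚ
    ¼ = ½ ℚ.* ½
    0<¼ : 0ℚ ℚ.< ¼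
    0<¼ = 0<* 0<½ 0<½
    large : ∀ n {e δ} → ℚ.∣ e ℚ.- seq X n ∣ ℚ.+ δ ℚ.≤ ¼ → 0ℚ ℚ.< δ →
      ⟦ suc (suc m) ⟧ ℚ.≤ seq X n ℚ.+ ½ → ¬ e ℚ.≤ ⟦ suc m ⟧
    large n {e} {δ} close 0<δ near e≤ = ℚₚ.<-irrefl refl (ℚₚ.<-≤-trans (<-by
        ((¼ ℚ.- (d ℚ.+ δ)) ℚ.+ (d ℚ.- (ℚ.- (e ℚ.- x))) ℚ.+ (x ℚ.+ ½ ℚ.- (1ℚ ℚ.+ M)) ℚ.+ (¼ ℚ.+ δ))
        (ℚₚ.+-mono-≤-< (0≤+ (0≤+ (0≤-diff close) (0≤-diff (-p≤∣p∣ (e ℚ.- x))))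
          (0≤-diff (subst (ℚ._≤ x ℚ.+ ½) (⟦⟧-suc (suc m)) near))) (0<+ 0<¼ 0<δ))
        (solve 5 (λ M d δ e x → M :+ ((con ¼ :- (d :+ δ)) :+ (d :- (:- (e :- x))) :+
            (x :+ con ½ :- (con 1ℚ :+ M)) :+ (con ¼ :+ δ)) := e) refl M d δ e x)) e≤)
      where
      x = seq X n
      d = ℚ.∣ e ℚ.- x ∣
      M = ⟦ suc m ⟧

  2rec2≡1 : 2ℚ ℚ.* rec 2 ≡ 1ℚ
  2rec2≡1 = subst (λ z → z ℚ.* rec 2 ≡ 1ℚ) (⟦⟧-def 2) (*-rec {2} (s≤s z≤n))

  1≤2G : ∀ {m} → 2 ℕ.≤ m → 1ℚ ℚ.≤ 2ℚ ℚ.* G m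
  1≤2G {m} 2≤m = begin
    1ℚ                                     ≡⟨ 2rec2≡1 ⟨
    2ℚ ℚ.* rec 2
      ≡⟨ cong (2ℚ ℚ.*_) (solve 1 (λ r → r := con 0ℚ :+ con 0ℚ :+ con 1ℚ :+ r :- con 1ℚ) refl (rec 2)) ⟩
    2ℚ ℚ.* (0ℚ ℚ.+ 0ℚ ℚ.+ 1ℚ ℚ.+ rec 2 ℚ.- 1ℚ)
      ≡⟨ cong (λ z → 2ℚ ℚ.* (0ℚ ℚ.+ 0ℚ ℚ.+ z ℚ.+ rec 2 ℚ.- 1ℚ)) rec-1 ⟨
    2ℚ ℚ.* (H 2 ℚ.- 1ℚ)
      ≤⟨ *-monoˡ-≤ 2ℚ 0≤2 (ℚₚ.+-monoˡ-≤ (ℚ.- 1ℚ) (∑-monoⁿ 0≤rec (s≤s 2≤m))) ⟩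
    2ℚ ℚ.* G m                             ∎
    where open ℚₚ.≤-Reasoning

  -- H (m + 1) is G m + 1 + 1/(m + 1) ≤ G m + 2, and 2 ≤ 4 G m because G m ≥ G 2 = ½.
  H≤5G : ∀ {m} → 2 ℕ.≤ m → H (suc m) ℚ.≤ 5ℚ ℚ.* G m
  H≤5G {m} 2≤m = ≤-by ((1ℚ ℚ.- rec (suc m)) ℚ.+ 2ℚ ℚ.* (2ℚ ℚ.* G m ℚ.- 1ℚ))
    (0≤+ (0≤-diff (rec≤1 m)) (0≤* 0≤2 (0≤-diff (1≤2G 2≤m))))
    (solve 2 (λ h r → h :+ r :+ ((con 1ℚ :- r) :+ con 2ℚ :* (con 2ℚ :* (h :- con 1ℚ) :- con 1ℚ)) :=
       con 5ℚ :* (h :- con 1ℚ)) refl (H m) (rec (suc m)))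

  -- 102 · 2³ · 5: the constant of `W-x⁴`, the cube of N ≤ 2 x, and the factor of `H≤5G`.
  4080ℚ : ℚ
  4080ℚ = ℤ.+ 4080 ℚ./ 1

  upper-bound : ∀ X y z l m → IsFloor X (suc m) → 2 ℕ.≤ m → y ≈ fromℕ (W (suc m)) → IsLog X l → z ≈ X ^ 3 * l →
    ∣ y - main-term X ∣ ≤ fromℚ 4080ℚ * z
  upper-bound X y z l m@(suc m′) isFloor 2≤m y≈W isLog z≈ ε 0<ε =
    ev-map (λ n (near , G≤l , closeʸ , closeᶻ , m≤n) →
        subst (λ g → ℚ.∣ seq y n ℚ.- g ∣ ℚ.< 4080ℚ ℚ.* seq z n ℚ.+ ε) (sym (seq-main-term X n))
          (estimate n (seq X n) (seq y n) (seq z n) (seq l n) m≤n near G≤l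
            (subst (λ w → ℚ.∣ seq y n ℚ.- w ∣ ℚ.≤ δ) (sym (⟦⟧-def (W (suc m)))) (ℚₚ.<⇒≤ closeʸ))
            (subst (λ w → ℚ.∣ seq z n ℚ.- w ℚ.* seq l n ∣ ℚ.≤ δ)
              (solve 1 (λ x → con 1ℚ :* x :* x :* x := x :* x :* x) refl (seq X n)) (ℚₚ.<⇒≤ closeᶻ))))
      (ev-× near (ev-× (log-lower X l m′ near isLog) (ev-× (y≈W δ 0<δ) (ev-× (z≈ δ 0<δ) (suc m , λ n h → h)))))
    where
    near = near-floor {X} isFloor
    -- The estimate spends 4080 δ on z and δ on y; a further δ makes the inequality strict.
    r = rec 4082
    δ = ε ℚ.* r
    0<δ = 0<* 0<ε (0<1/+1 4081)
    N = ⟦ suc m ⟧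
    4082r≡1 : (ℤ.+ 4082 ℚ./ 1) ℚ.* r ≡ 1ℚ
    4082r≡1 = subst (λ w → w ℚ.* r ≡ 1ℚ) (⟦⟧-def 4082) (*-rec {4082} (s≤s z≤n))
    δ-small : 4080ℚ ℚ.* δ ℚ.+ δ ℚ.< ε
    δ-small = <-by δ 0<δ (trans (solve 2 (λ e r → con 4080ℚ :* (e :* r) :+ e :* r :+ e :* r :=
        e :* (con (ℤ.+ 4082 ℚ./ 1) :* r)) refl ε r) (trans (cong (ε ℚ.*_) 4082r≡1) (ℚₚ.*-identityʳ ε)))
    estimate : ∀ n x y z l → suc m ℕ.≤ n → Near x (suc m) → G m ℚ.≤ l →
      ℚ.∣ y ℚ.- ⟦ W (suc m) ⟧ ∣ ℚ.≤ δ → ℚ.∣ z ℚ.- x ³ ℚ.* l ∣ ℚ.≤ δ →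
      ℚ.∣ y ℚ.- invℚ (4ℚ ℚ.* Z n) ℚ.* x ⁴ ∣ ℚ.< 4080ℚ ℚ.* z ℚ.+ ε
    estimate n x y z l m≤n near G≤l closeʸ closeᶻ = begin-strict
      ℚ.∣ y ℚ.- h ∣                              ≤⟨ triangle y w h ⟩
      ℚ.∣ y ℚ.- w ∣ ℚ.+ ℚ.∣ w ℚ.- h ∣
        ≤⟨ ℚₚ.+-mono-≤ closeʸ (ℚₚ.≤-trans (∣-h∣≤q∣-h∣ w) (ℚₚ.≤-reflexive (q∣-h∣ w))) ⟩
      δ ℚ.+ ℚ.∣ q ℚ.* w ℚ.- x ⁴ ∣                ≤⟨ ℚₚ.+-monoʳ-≤ δ (W-x⁴ 2≤1+m near m≤n) ⟩
      δ ℚ.+ 102ℚ ℚ.* (N ³ ℚ.* H (suc m))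
        ≤⟨ ℚₚ.+-monoʳ-≤ δ (*-monoˡ-≤ 102ℚ (ℚₚ.nonNegative⁻¹ 102ℚ)
             (*-mono-≤ (0≤³ 0≤N) (³-mono 0≤N (near-m≤2x 2≤1+m near)) (0≤H (suc m))
               (ℚₚ.≤-trans (H≤5G 2≤m) (*-monoˡ-≤ 5ℚ (ℚₚ.nonNegative⁻¹ 5ℚ) G≤l)))) ⟩
      δ ℚ.+ 102ℚ ℚ.* ((2ℚ ℚ.* x) ³ ℚ.* (5ℚ ℚ.* l))
        ≡⟨ solve 3 (λ d x l → d :+ con 102ℚ :* ((con 2ℚ :* x) :* (con 2ℚ :* x) :* (con 2ℚ :* x) :* (con 5ℚ :* l)) :=
             d :+ con 4080ℚ :* (x :* x :* x :* l)) refl δ x l ⟩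
      δ ℚ.+ 4080ℚ ℚ.* (x ³ ℚ.* l)
        ≤⟨ ℚₚ.+-monoʳ-≤ δ (*-monoˡ-≤ 4080ℚ (ℚₚ.nonNegative⁻¹ 4080ℚ) (∣p-q∣≤⇒q≤ z (x ³ ℚ.* l) closeᶻ)) ⟩
      δ ℚ.+ 4080ℚ ℚ.* (z ℚ.+ δ)
        ≡⟨ solve 2 (λ d z → d :+ con 4080ℚ :* (z :+ d) := con 4080ℚ :* z :+ (con 4080ℚ :* d :+ d)) refl δ z ⟩
      4080ℚ ℚ.* z ℚ.+ (4080ℚ ℚ.* δ ℚ.+ δ)        <⟨ ℚₚ.+-monoʳ-< (4080ℚ ℚ.* z) δ-small ⟩
      4080ℚ ℚ.* z ℚ.+ ε                          ∎
      where
      open ℚₚ.≤-Reasoning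
      open MainTerm {n} (ℕₚ.≤-trans (s≤s z≤n) m≤n) x
      w = ⟦ W (suc m) ⟧
      0≤N = 0≤⟦⟧ (suc m)
      2≤1+m = ℕₚ.m≤n⇒m≤1+n 2≤m

  ²-cancel-≤ : ∀ {a b} → 0ℚ ℚ.≤ b → a ℚ.* a ℚ.≤ b ℚ.* b → a ℚ.≤ b
  ²-cancel-≤ {a} {b} 0≤b aa≤bb = ℚₚ.≮⇒≥ λ b<a → ℚₚ.<-irrefl refl (ℚₚ.<-≤-trans
    (<-by ((a ℚ.- b) ℚ.* (a ℚ.- b) ℚ.+ 2ℚ ℚ.* b ℚ.* (a ℚ.- b))
      (ℚₚ.+-mono-<-≤ (0<* (0<-diff b<a) (0<-diff b<a)) (0≤* (0≤* 0≤2 0≤b) (ℚₚ.<⇒≤ (0<-diff b<a))))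
      (solve 2 (λ a b → b :* b :+ ((a :- b) :* (a :- b) :+ con 2ℚ :* b :* (a :- b)) := a :* a) refl a b))
    aa≤bb)

  -- Compared after squaring: (R H)² ≤ R² · 4 m ≤ m². It turns N³ H into at most N⁴ / R with R at
  -- choice.
  R*H≤m : ∀ R {m} → 4 ℕ.* (R ℕ.* R) ℕ.≤ m → ⟦ R ⟧ ℚ.* H m ℚ.≤ ⟦ m ⟧
  R*H≤m R {m} 4R²≤m = ²-cancel-≤ (0≤⟦⟧ m) (begin
    ρ ℚ.* H m ℚ.* (ρ ℚ.* H m)
      ≡⟨ solve 2 (λ r h → r :* h :* (r :* h) := r :* r :* (h :* h)) refl ρ (H m) ⟩
    ρ ℚ.* ρ ℚ.* (H m ℚ.* H m)          ≤⟨ *-monoˡ-≤ (ρ ℚ.* ρ) (0≤² ρ) (H²≤4n m) ⟩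
    ρ ℚ.* ρ ℚ.* (4ℚ ℚ.* ⟦ m ⟧)         ≡⟨ solve 2 (λ r m → r :* r :* (con 4ℚ :* m) := con 4ℚ :* (r :* r) :* m) refl ρ ⟦ m ⟧ ⟩
    4ℚ ℚ.* (ρ ℚ.* ρ) ℚ.* ⟦ m ⟧
      ≤⟨ *-monoʳ-≤ ⟦ m ⟧ (0≤⟦⟧ m) (subst (ℚ._≤ ⟦ m ⟧)
           (trans (⟦⟧-* 4 (R ℕ.* R)) (cong₂ ℚ._*_ (⟦⟧-def 4) (⟦⟧-* R R))) (⟦⟧-mono-≤ 4R²≤m)) ⟩
    ⟦ m ⟧ ℚ.* ⟦ m ⟧                    ∎)
    where
    open ℚₚ.≤-Reasoning
    ρ = ⟦ R ⟧

  -- 103 · 2⁴: the 102 of `W-x⁴`, 1 for the distance of y from `W m`, and the fourth power of N ≤ 2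
  -- x.
  1648ℚ : ℚ
  1648ℚ = ℤ.+ 1648 ℚ./ 1

  relative-error : ∀ R {m n x y} → 2 ℕ.≤ m → 4 ℕ.* (R ℕ.* R) ℕ.≤ m → (m≤n : m ℕ.≤ n) → Near x m →
    8ℚ ℚ.* ℚ.∣ y ℚ.- ⟦ W m ⟧ ∣ ℚ.≤ 1ℚ →
    let h = invℚ (4ℚ ℚ.* Z n) ℚ.* x ⁴ in ⟦ R ⟧ ℚ.* ℚ.∣ y ℚ.- h ∣ ℚ.≤ 1648ℚ ℚ.* h
  relative-error R {m} {n} {x} {y} 2≤m 4R²≤m m≤n near close = *-cancelˡ-≤ q 0<q (begin
    q ℚ.* (ρ ℚ.* ℚ.∣ y ℚ.- h ∣)
      ≡⟨ solve 3 (λ q r d → q :* (r :* d) := r :* (q :* d)) refl q ρ ℚ.∣ y ℚ.- h ∣ ⟩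
    ρ ℚ.* (q ℚ.* ℚ.∣ y ℚ.- h ∣)                  ≡⟨ cong (ρ ℚ.*_) (q∣-h∣ y) ⟩
    ρ ℚ.* ℚ.∣ q ℚ.* y ℚ.- x ⁴ ∣                  ≤⟨ *-monoˡ-≤ ρ 0≤ρ absolute ⟩
    ρ ℚ.* (103ℚ ℚ.* (N ³ ℚ.* H m))
      ≡⟨ solve 3 (λ r n h → r :* (con 103ℚ :* (n :* h)) := con 103ℚ :* (n :* (r :* h))) refl ρ (N ³) (H m) ⟩
    103ℚ ℚ.* (N ³ ℚ.* (ρ ℚ.* H m))
      ≤⟨ *-monoˡ-≤ 103ℚ (ℚₚ.nonNegative⁻¹ 103ℚ) (*-monoˡ-≤ (N ³) (0≤³ 0≤N) (R*H≤m R 4R²≤m)) ⟩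
    103ℚ ℚ.* N ⁴
      ≤⟨ *-monoˡ-≤ 103ℚ (ℚₚ.nonNegative⁻¹ 103ℚ) (⁴-mono 0≤N (near-m≤2x 2≤m near)) ⟩
    103ℚ ℚ.* (2ℚ ℚ.* x) ⁴
      ≡⟨ solve 1 (λ x → con 103ℚ :* ((con 2ℚ :* x) :* (con 2ℚ :* x) :* (con 2ℚ :* x) :* (con 2ℚ :* x)) :=
           con 1648ℚ :* (x :* x :* x :* x)) refl x ⟩
    1648ℚ ℚ.* x ⁴                                ≡⟨ cong (1648ℚ ℚ.*_) qh≡x⁴ ⟨
    1648ℚ ℚ.* (q ℚ.* h)                          ≡⟨ solve 2 (λ q h → con 1648ℚ :* (q :* h) := q :* (con 1648ℚ :* h)) refl q h ⟩
    q ℚ.* (1648ℚ ℚ.* h)                          ∎)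
    where
    open ℚₚ.≤-Reasoning
    1≤m = ℕₚ.≤-trans (s≤s z≤n) 2≤m
    1≤n = ℕₚ.≤-trans 1≤m m≤n
    open MainTerm {n} 1≤n x
    ρ N w : ℚ
    ρ = ⟦ R ⟧
    N = ⟦ m ⟧
    w = ⟦ W m ⟧
    0≤ρ = 0≤⟦⟧ R
    0≤N = 0≤⟦⟧ m
    1≤N³H : 1ℚ ℚ.≤ N ³ ℚ.* H m
    1≤N³H = *-mono-≤ 0≤1 (³-mono 0≤1 (subst (ℚ._≤ N) ⟦1⟧ (⟦⟧-mono-≤ 1≤m))) 0≤1 (1≤H 1≤m)
    absolute : ℚ.∣ q ℚ.* y ℚ.- x ⁴ ∣ ℚ.≤ 103ℚ ℚ.* (N ³ ℚ.* H m)
    absolute = begin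
      ℚ.∣ q ℚ.* y ℚ.- x ⁴ ∣                      ≤⟨ triangle (q ℚ.* y) (q ℚ.* w) (x ⁴) ⟩
      ℚ.∣ q ℚ.* y ℚ.- q ℚ.* w ∣ ℚ.+ ℚ.∣ q ℚ.* w ℚ.- x ⁴ ∣
        ≡⟨ cong (λ d → d ℚ.+ ℚ.∣ q ℚ.* w ℚ.- x ⁴ ∣) (trans
             (cong ℚ.∣_∣ (solve 3 (λ q y w → q :* y :- q :* w := q :* (y :- w)) refl q y w)) (∣*∣-nonNeg (y ℚ.- w) 0≤q)) ⟩
      q ℚ.* ℚ.∣ y ℚ.- w ∣ ℚ.+ ℚ.∣ q ℚ.* w ℚ.- x ⁴ ∣
        ≤⟨ ℚₚ.+-mono-≤ (ℚₚ.≤-trans (*-monoʳ-≤ ℚ.∣ y ℚ.- w ∣ (ℚₚ.0≤∣p∣ (y ℚ.- w)) (4Z≤8 1≤n)) (ℚₚ.≤-trans close 1≤N³H))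
             (W-x⁴ 2≤m near m≤n) ⟩
      N ³ ℚ.* H m ℚ.+ 102ℚ ℚ.* (N ³ ℚ.* H m)
        ≡⟨ solve 1 (λ a → a :+ con 102ℚ :* a := con 103ℚ :* a) refl (N ³ ℚ.* H m) ⟩
      103ℚ ℚ.* (N ³ ℚ.* H m)                     ∎

  main-term-large : ∀ X → fromℕ 2 ≤ X → Eventually λ n → 1ℚ ℚ.≤ 8ℚ ℚ.* seq (main-term X) n
  main-term-large X 2≤X = ev-map (λ n (2<X+1 , 1≤n) → subst (λ h → 1ℚ ℚ.≤ 8ℚ ℚ.* h) (sym (seq-main-term X n))
      (MainTerm.1≤8h 1≤n (seq X n) (≤-by (seq X n ℚ.+ 1ℚ ℚ.- 2ℚ) (0≤-diff (ℚₚ.<⇒≤ 2<X+1))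
        (solve 1 (λ x → con 1ℚ :+ (x :+ con 1ℚ :- con 2ℚ) := x) refl (seq X n)))))
    (ev-× (2≤X 1ℚ 0<1) (1 , λ n h → h))

  ⅛ : ℚ
  ⅛ = ½ ℚ.* ½ ℚ.* ½

  main-term#0 : ∀ X → fromℕ 2 ≤ X → main-term X #0
  main-term#0 X 2≤X = positive⇒#0 {main-term X} ⅛ (ℚₚ.positive⁻¹ ⅛)
    (ev-map (λ n 1≤8h → *-cancelˡ-≤ 8ℚ (ℚₚ.positive⁻¹ 8ℚ) 1≤8h) (main-term-large X 2≤X))

  -- Multiplying |y/h - 1| by R h leaves R |y - h|, which `relative-error` bounds by 1648 h < R e h.
  quotient-bound : ∀ X y e R m → (2≤X : fromℕ 2 ≤ X) → IsFloor X m → 2 ℕ.≤ m → 4 ℕ.* (R ℕ.* R) ℕ.≤ m →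
    0ℚ ℚ.< e → 1648ℚ ℚ.< ⟦ R ⟧ ℚ.* e → y ≈ fromℕ (W m) →
    ∣ (y ÷ main-term X [ main-term#0 X 2≤X ]) - 1ℝ ∣ ≤ fromℚ e
  quotient-bound X y e R m 2≤X isFloor 2≤m 4R²≤m 0<e 1648<Re y≈W ε 0<ε =
    ev-map (λ n (near , 1≤8h , closeʸ , m≤n) → ℚₚ.≤-<-trans
        (divide (seq y n) (seq (main-term X) n) 1≤8h
          (subst (λ h → ⟦ R ⟧ ℚ.* ℚ.∣ seq y n ℚ.- h ∣ ℚ.≤ 1648ℚ ℚ.* h) (sym (seq-main-term X n))
            (relative-error R {y = seq y n} 2≤m 4R²≤m m≤n near
              (*-monoˡ-≤ 8ℚ (ℚₚ.nonNegative⁻¹ 8ℚ) (subst (λ w → ℚ.∣ seq y n ℚ.- w ∣ ℚ.≤ ⅛)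
                (sym (⟦⟧-def (W m))) (ℚₚ.<⇒≤ closeʸ))))))
        (<-by ε 0<ε refl))
      (ev-× (near-floor {X} isFloor) (ev-× (main-term-large X 2≤X) (ev-× (y≈W ⅛ (ℚₚ.positive⁻¹ ⅛)) (m , λ n h → h))))
    where
    divide : ∀ v h → 1ℚ ℚ.≤ 8ℚ ℚ.* h → ⟦ R ⟧ ℚ.* ℚ.∣ v ℚ.- h ∣ ℚ.≤ 1648ℚ ℚ.* h →
      ℚ.∣ v ℚ.* invℚ h ℚ.- 1ℚ ∣ ℚ.≤ e
    divide v h 1≤8h bound = *-cancelˡ-≤ (⟦ R ⟧ ℚ.* h) (0<* 0<R 0<h) (begin
      ⟦ R ⟧ ℚ.* h ℚ.* ℚ.∣ v ℚ.* invℚ h ℚ.- 1ℚ ∣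
        ≡⟨ trans (ℚₚ.*-assoc ⟦ R ⟧ h ℚ.∣ v ℚ.* invℚ h ℚ.- 1ℚ ∣)
             (cong (⟦ R ⟧ ℚ.*_) (sym (∣*∣-nonNeg (v ℚ.* invℚ h ℚ.- 1ℚ) (ℚₚ.<⇒≤ 0<h)))) ⟩
      ⟦ R ⟧ ℚ.* ℚ.∣ h ℚ.* (v ℚ.* invℚ h ℚ.- 1ℚ) ∣
        ≡⟨ cong (λ z → ⟦ R ⟧ ℚ.* ℚ.∣ z ∣) (trans
             (solve 3 (λ h v i → h :* (v :* i :- con 1ℚ) := v :* (h :* i) :- h) refl h v (invℚ h))
             (cong (ℚ._- h) (trans (cong (v ℚ.*_) (proj₂ (invℚ-pos 0<h))) (ℚₚ.*-identityʳ v)))) ⟩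
      ⟦ R ⟧ ℚ.* ℚ.∣ v ℚ.- h ∣                   ≤⟨ bound ⟩
      1648ℚ ℚ.* h                               ≤⟨ *-monoʳ-≤ h (ℚₚ.<⇒≤ 0<h) (ℚₚ.<⇒≤ 1648<Re) ⟩
      ⟦ R ⟧ ℚ.* e ℚ.* h
        ≡⟨ solve 3 (λ r e h → r :* e :* h := r :* h :* e) refl ⟦ R ⟧ e h ⟩
      ⟦ R ⟧ ℚ.* h ℚ.* e                         ∎)
      where
      open ℚₚ.≤-Reasoning
      0<h : 0ℚ ℚ.< h
      0<h = ℚₚ.<-≤-trans (ℚₚ.positive⁻¹ ⅛) (*-cancelˡ-≤ 8ℚ (ℚₚ.positive⁻¹ 8ℚ) 1≤8h)
      0<R : 0ℚ ℚ.< ⟦ R ⟧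
      0<R = ℚₚ.≰⇒> λ R≤0 → ℚₚ.<-irrefl refl (ℚₚ.<-trans (ℚₚ.positive⁻¹ 1648ℚ) (ℚₚ.<-≤-trans 1648<Re
        (subst (⟦ R ⟧ ℚ.* e ℚ.≤_) (ℚₚ.*-zeroˡ e) (*-monoʳ-≤ e (ℚₚ.<⇒≤ 0<e) R≤0))))

  floor-≥ : ∀ {X K m} → fromℕ K ≤ X → IsFloor X m → K ℕ.≤ m
  floor-≥ {X} {K} {m} K≤X (_ , ¬1+m≤X) = ℕₚ.≮⇒≥ λ m<K →
    ¬1+m≤X (≤-trans {fromℕ (suc m)} {fromℕ K} {X} (fromℕ-mono m<K) K≤X)

  fromℕ-≤⇒0≤ : ∀ {X} K → fromℕ K ≤ X → 0ℝ ≤ X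
  fromℕ-≤⇒0≤ {X} K K≤X = ≤-trans {0ℝ} {fromℕ K} {X} (fromℕ-mono {0} {K} z≤n) K≤X

  -- Guards the two asymptotic statements against vacuity, since they quantify over the values y
  -- with `#Ω₁ X y`.
  cardinality-exists : ∀ X → 0ℝ < X → ¬ ¬ (∃[ N ] HasCardinality (Ω₁ X) N)
  cardinality-exists X (δ , 0<δ , ev) =
    floor X (λ ε 0<ε → ev-map (λ n δ≤X → ℚₚ.<-≤-trans 0<δ (ℚₚ.≤-trans (ℚₚ.≤-trans
      (ℚₚ.≤-reflexive (sym (ℚₚ.+-identityˡ δ))) δ≤X) (≤-by ε (ℚₚ.<⇒≤ 0<ε) refl))) ev) >>= λ (m , isFloor) →
    Ω₁-cardinality X m isFloor >>= λ card → return (W m , card)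

  cardinality-O : #Ω₁ ≐ main-term +O[ (λ X z → ∃[ l ] IsLog X l × z ≈ X ^ 3 * l) ]
  -- X ≥ 3 makes ⌊X⌋ - 1 at least 2, the range of `H≤5G`.
  cardinality-O = fromℚ 4080ℚ , fromℕ 3 , λ X 3≤X y z (N , card , y≈N) (l , isLog , z≈) →
    ≤-stable {∣ y - main-term X ∣} {fromℚ 4080ℚ * z} (
      floor X (fromℕ-≤⇒0≤ {X} 3 3≤X) >>= λ (m , isFloor) →
      cardinality≡W X m isFloor card >>= λ N≡W →
      return (bound X y z l m (floor-≥ {X} {3} 3≤X isFloor) isFloor
        (subst (λ N → y ≈ fromℕ N) N≡W y≈N) isLog z≈))
    where
    bound : ∀ X y z l m → 3 ℕ.≤ m → IsFloor X m → y ≈ fromℕ (W m) → IsLog X l → z ≈ X ^ 3 * l →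
      ∣ y - main-term X ∣ ≤ fromℚ 4080ℚ * z
    bound X y z l (suc m) (s≤s 2≤m) isFloor = upper-bound X y z l m isFloor 2≤m

  cardinality-∼ : #Ω₁ ∼ main-term
  cardinality-∼ ε (e , 0<e , e≤ε) = fromℕ K , λ X K≤X →
    let 2≤X = ≤-trans {fromℕ 2} {fromℕ K} {X} (fromℕ-mono {2} {K} (ℕₚ.m≤m+n 2 _)) K≤X
    in main-term#0 X 2≤X , λ y (N , card , y≈N) →
      let T = ∣ (y ÷ main-term X [ main-term#0 X 2≤X ]) - 1ℝ ∣
          T≤ : T ≤ fromℚ d
          T≤ = ≤-stable {T} {fromℚ d} (
            floor X (fromℕ-≤⇒0≤ {X} K K≤X) >>= λ (m , isFloor) →
            cardinality≡W X m isFloor card >>= λ N≡W →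
            return (quotient-bound X y d R m 2≤X isFloor
              (ℕₚ.≤-trans (ℕₚ.m≤m+n 2 _) (floor-≥ {X} {K} K≤X isFloor))
              (ℕₚ.≤-trans (ℕₚ.m≤n+m _ 2) (floor-≥ {X} {K} K≤X isFloor))
              0<d R-large (subst (λ N → y ≈ fromℕ N) N≡W y≈N)))
      in d ℚ.+ d , 0<+ 0<d 0<d , ev-map (λ n (T<2d , e≤) → ℚₚ.≤-trans
           (ℚₚ.≤-trans (ℚₚ.+-monoˡ-≤ (d ℚ.+ d) (ℚₚ.<⇒≤ T<2d))
             (ℚₚ.≤-reflexive (solve 1 (λ e → (e :* con ½ :* con ½ :+ e :* con ½ :* con ½) :+
                (e :* con ½ :* con ½ :+ e :* con ½ :* con ½) := con 0ℚ :+ e) refl e))) e≤)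
           (ev-× (T≤ d 0<d) e≤ε)
    where
    -- T ≤ d gives T < 2 d eventually, and the remaining 2 d of e = 4 d is the gap that `<` on reals
    -- requires.
    d = e ℚ.* ½ ℚ.* ½
    0<d = ½-pos (½-pos 0<e)
    r = proj₁ (reciprocal 0<d)
    0<r = proj₁ (proj₂ (reciprocal 0<d))
    dr≡1 = proj₂ (proj₂ (reciprocal 0<d))
    R = proj₁ (archimedean (1648ℚ ℚ.* r))
    -- Makes the floor at least 2 and at least 4 R², the conditions of `quotient-bound`.
    K = 2 ℕ.+ 4 ℕ.* (R ℕ.* R)
    R-large : 1648ℚ ℚ.< ⟦ R ⟧ ℚ.* d
    R-large = subst (ℚ._< ⟦ R ⟧ ℚ.* d)
      (trans (ℚₚ.*-assoc 1648ℚ r d) (trans (cong (1648ℚ ℚ.*_) (trans (ℚₚ.*-comm r d) dr≡1)) (ℚₚ.*-identityʳ 1648ℚ)))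
      (ℚₚ.*-monoˡ-<-pos d {{ℚ.positive 0<d}} (proj₂ (archimedean (1648ℚ ℚ.* r))))

open import Defs
open Asymptotics using (cardinality-exists; cardinality-O; cardinality-∼)

proposition3p3 : (∀ X → 0ℝ < X → ¬ ¬ (∃[ N ] HasCardinality (Ω₁ X) N)) ×
    (#Ω₁ ≐ (λ X → (1ℝ ÷ (fromℕ 4 * ζ₂) [ 4ζ₂#0 ]) * X ^ 4)
    +O[ (λ X z → ∃[ l ] IsLog X l × z ≈ X ^ 3 * l) ]) ×
    (#Ω₁ ∼ (λ X → (1ℝ ÷ (fromℕ 4 * ζ₂) [ 4ζ₂#0 ]) * X ^ 4))
proposition3p3 = cardinality-exists , cardinality-O , cardinality-∼
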